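{- Let $\lambda$ be a $k$-bounded partition and $\alpha=(\alpha_1,\ldots,\alpha_r)$ a composition of $|\lambda|$. The map $\Gamma$ sending an $\alpha$-admissible chain $P=(\lambda^{(0)},\ldots,\lambda^{(r)})\in\mathcal{D}^k_\alpha(\lambda)$ to the filling of $\mathfrak{c}(\lambda)$ in which the letter $j$ occupies the cells of $\mathfrak{c}(\lambda^{(j)})/\mathfrak{c}(\lambda^{(j-1)})$ ($j=1,\ldots,r$) is a bijection from $\mathcal{D}^k_\alpha(\lambda)$ onto $\mathcal{T}^k_\alpha(\lambda)$. Its inverse $\bar\Gamma$ sends $T\in\mathcal{T}^k_\alpha(\lambda)$ to $(\lambda^{(0)},\ldots,\lambda^{(r)})$, where $\mathfrak{c}(\lambda^{(i)})$ is the shape of the tableau obtained from $T$ by deleting the letters $i+1,\ldots,r$.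
   Context: Fix $k\ge1$. Partitions are Ferrers diagrams in French convention: cells $(i,j)$, $1\le j\le\lambda_i$, $i$ the row (row 1 at bottom), $j$ the column. For partitions $\lambda\subseteq\mu$, $\mu/\lambda$ is a horizontal (resp. vertical) $s$-strip if it has $s$ cells and at most one cell in each column (resp. row). The hook length of a cell $(i,j)$ of $\gamma$ is the number of cells $(i,j')\in\gamma$ with $j'\ge j$ plus the number of cells $(i',j)\in\gamma$ with $i'>i$; a cell is $k$-bounded if its hook length is at most $k$. A $(k+1)$-core is a partition with no cell of hook length $k+1$; $\mathcal{C}_{k+1}$ is the set of $(k+1)$-cores, $\mathcal{P}_k$ the set of $k$-bounded partitions (largest part at most $k$). $\mathfrak{p}:\mathcal{C}_{k+1}\to\mathcal{P}_k$, $\mathfrak{p}(\gamma)_i=$ number of $k$-bounded cells in row $i$ of $\gamma$, is a bijection with inverse $\mathfrak{c}$; the $k$-conjugate is $\lambda^{\omega_k}=\mathfrak{p}(\mathfrak{c}(\lambda)')$, $'$ denoting conjugation. A pair $\mu,\lambda\in\mathcal{P}_k$ is $s$-admissible if $\mu/\lambda$ is a horizontal $s$-strip and $\mu^{\omega_k}/\lambda^{\omega_k}$ is a vertical $s$-strip. $\mathcal{D}^k_\alpha(\lambda)$ is the set of sequences $(\lambda^{(0)},\ldots,\lambda^{(r)})$ of $k$-bounded partitions with $\lambda^{(0)}=\emptyset$, $\lambda^{(r)}=\lambda$, and $\lambda^{(j)},\lambda^{(j-1)}$ $\alpha_j$-admissible for $j=1,\ldots,r$. The residue of $(i,j)$ is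 $j-i\bmod(k+1)$. For $\gamma\in\mathcal{C}_{k+1}$ with $n$ $k$-bounded cells and a composition $\alpha=(\alpha_1,\ldots,\alpha_r)$ of $n$, a (semi-standard) $k$-tableau of shape $\gamma$ and evaluation $\alpha$ is a filling of the cells of $\gamma$ with $1,\ldots,r$, weakly increasing along rows and strictly increasing up columns, such that for each $i$ the cells filled with $i$ carry exactly $\alpha_i$ distinct residues. $\mathcal{T}^k_\alpha(\lambda)$ is the set of such tableaux of shape $\mathfrak{c}(\lambda)$. -}

module Defs where

open import Data.Nat using (ℕ; zero; suc; _+_; _*_; _∸_; _≤_; _<_; _≤ᵇ_; _%_)
open import Data.Bool using (Bool; true; false; if_then_else_; _∧_; not)
open import Data.List using (List; []; _∷_; map; length; upTo; filter)
open import Data.Nat.ListAction using (sum)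
open import Data.List.Relation.Unary.All using (All)
open import Data.List.Relation.Unary.Linked using (Linked)
open import Data.Vec using (Vec; lookup; head; last; tabulate; toList; _∷_; [])
open import Data.Fin using (Fin; toℕ; inject₁)
open import Data.Product using (_×_)
open import Relation.Binary.PropositionalEquality using (_≡_; _≢_)
open import Data.Nat using (_>?_; _≥_)

oneTo : ℕ → List ℕ
oneTo n = map suc (upTo n)

countB : (ℕ → Bool) → ℕ → ℕ
countB p zero    = zero
countB p (suc n) = countB p n + (if p (suc n) then 1 else 0)

anyB : (ℕ → Bool) → ℕ → Bool
anyB p zero    = false
anyB p (suc n) = if p (suc n) then true else anyB p n

nth : {A : Set} → A → List A → ℕ → A
nth d []       _       = d
nth d (x ∷ xs) zero    = x
nth d (x ∷ xs) (suc n) = nth d xs n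

_<ᵇ'_ : ℕ → ℕ → Bool
m <ᵇ' n = suc m ≤ᵇ n

-- Partitions: a partition is the list of its (positive) parts
-- λ₁ ≥ λ₂ ≥ … ≥ λ_ℓ > 0, row 1 first (French convention: row 1 at bottom).

IsPartition : List ℕ → Set
IsPartition γ = All (λ x → 1 ≤ x) γ × Linked _≥_ γ

row : List ℕ → ℕ → ℕ
row γ zero    = 0
row γ (suc i) = nth 0 γ i

size : List ℕ → ℕ
size = sum

KBounded : ℕ → List ℕ → Set
KBounded k λ' = IsPartition λ' × All (λ x → x ≤ k) λ'

IsCell : List ℕ → ℕ → ℕ → Set
IsCell γ i j = (1 ≤ i) × (1 ≤ j) × (j ≤ row γ i)

colLen : List ℕ → ℕ → ℕ
colLen γ j = countB (λ i → j ≤ᵇ row γ i) (length γ)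

conj : List ℕ → List ℕ
conj γ = map (colLen γ) (oneTo (row γ 1))

-- hook length of cell (i,j) of γ: cells (i,j') with j' ≥ j plus cells (i',j) with i' > i
hook : List ℕ → ℕ → ℕ → ℕ
hook γ i j = (suc (row γ i ∸ j)) + (colLen γ j ∸ i)

IsCore : ℕ → List ℕ → Set
IsCore k γ = IsPartition γ × (∀ i j → IsCell γ i j → hook γ i j ≢ suc k)

boundedInRow : ℕ → List ℕ → ℕ → ℕ
boundedInRow k γ i = countB (λ j → hook γ i j ≤ᵇ k) (row γ i)

𝔭 : ℕ → List ℕ → List ℕ
𝔭 k γ = filter (λ x → x >? 0) (map (boundedInRow k γ) (oneTo (length γ)))

-- 𝔠 : inverse of 𝔭 on k-bounded partitions, computed by the standard
-- algorithm: rows of λ are added from the top (shortest) row downwards;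
-- the new bottom row of λ_i cells is slid right by the least shift s
-- making all its cells k-bounded (i.e. λ_i + #{rows above of length ≥ s+1} ≤ k),
-- and the s cells to its left are filled in.
shiftSearch : ℕ → ℕ → List ℕ → ℕ → ℕ → ℕ
shiftSearch k x L zero    s = s
shiftSearch k x L (suc f) s =
  if x + colLen L (suc s) ≤ᵇ k then s else shiftSearch k x L f (suc s)

𝔠 : ℕ → List ℕ → List ℕ
𝔠 k []       = []
𝔠 k (x ∷ xs) = (shiftSearch k x L (row L 1) 0 + x) ∷ L
  where L = 𝔠 k xs

kconj : ℕ → List ℕ → List ℕ
kconj k λ' = 𝔭 k (conj (𝔠 k λ'))

_⊆ₚ_ : List ℕ → List ℕ → Set
λ' ⊆ₚ μ = ∀ i → row λ' i ≤ row μ i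

inSkewB : List ℕ → List ℕ → ℕ → ℕ → Bool
inSkewB μ λ' i j = (row λ' i <ᵇ' j) ∧ (j ≤ᵇ row μ i)

HStrip : ℕ → List ℕ → List ℕ → Set
HStrip s μ λ' = (λ' ⊆ₚ μ) × (size μ ≡ size λ' + s)
              × (∀ j → countB (λ i → inSkewB μ λ' i j) (length μ) ≤ 1)

VStrip : ℕ → List ℕ → List ℕ → Set
VStrip s μ λ' = (λ' ⊆ₚ μ) × (size μ ≡ size λ' + s)
              × (∀ i → countB (λ j → inSkewB μ λ' i j) (row μ i) ≤ 1)

Admissible : ℕ → ℕ → List ℕ → List ℕ → Set
Admissible k s μ λ' = KBounded k μ × KBounded k λ'
                    × HStrip s μ λ' × VStrip s (kconj k μ) (kconj k λ')

IsComposition : {r : ℕ} → Vec ℕ r → ℕ → Set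
IsComposition α n = (∀ j → 1 ≤ lookup α j) × (sum (toList α) ≡ n)

InD : (k : ℕ) {r : ℕ} → Vec ℕ r → List ℕ → Vec (List ℕ) (suc r) → Set
InD k {r} α λ' P =
    (head P ≡ []) × (last P ≡ λ')
  × (∀ (j : Fin (suc r)) → KBounded k (lookup P j))
  × (∀ (j : Fin r) → Admissible k (lookup α j) (lookup P (Fin.suc j)) (lookup P (inject₁ j)))
  where import Data.Fin as Fin

-- Fillings: a filling is the list of its rows (row 1 first), each row the
-- list of its letters from left to right.

Filling : Set
Filling = List (List ℕ)

shape : Filling → List ℕ
shape T = map length T

entry : Filling → ℕ → ℕ → ℕ
entry T zero    j       = 0
entry T (suc i) zero    = 0
entry T (suc i) (suc j) = nth 0 (nth [] T i) j

residue : ℕ → ℕ → ℕ → ℕ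
-- (j - i) mod (k+1), computed as (j + k*i) mod (k+1)
residue k i j = (j + k * i) % suc k

distinctRes : ℕ → Filling → ℕ → ℕ
distinctRes k T m = countB hasRes (suc k)
  where
  hasRes : ℕ → Bool
  -- residue c ∈ {0..k} is encoded as c+1 ∈ {1..k+1}
  hasRes c = anyB (λ i → anyB (λ j → (entry T i j Data.Nat.≡ᵇ m)
                                  ∧ (residue k i j Data.Nat.≡ᵇ (c ∸ 1)))
                              (row (shape T) i))
                  (length T)

InT : (k : ℕ) {r : ℕ} → Vec ℕ r → List ℕ → Filling → Set
InT k {r} α λ' T =
    (shape T ≡ 𝔠 k λ')
  × (∀ i j → IsCell (shape T) i j → (1 ≤ entry T i j) × (entry T i j ≤ r))
  × (∀ i j → IsCell (shape T) i (suc j) → entry T i j ≤ entry T i (suc j))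
  × (∀ i j → IsCell (shape T) (suc i) j → entry T i j < entry T (suc i) j)
  × (∀ (m : Fin r) → distinctRes k T (suc (toℕ m)) ≡ lookup α m)

-- least m ∈ {1,…,r} with (i,j) ∈ 𝔠(λ^(m)), i.e. the m with
-- (i,j) ∈ 𝔠(λ^(m)) / 𝔠(λ^(m-1)) (the cores of a chain are nested)
letterSearch : ℕ → List (List ℕ) → ℕ → ℕ → ℕ → ℕ → ℕ
letterSearch k Ps i j zero    m = 0
letterSearch k Ps i j (suc f) m =
  if j ≤ᵇ row (𝔠 k (nth [] Ps m)) i then m else letterSearch k Ps i j f (suc m)

Γ : (k : ℕ) {r : ℕ} → Vec ℕ r → List ℕ → Vec (List ℕ) (suc r) → Filling
Γ k {r} α λ' P =
  map (λ i → map (λ j → letterSearch k (toList P) i j r 1) (oneTo (row γ i)))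
      (oneTo (length γ))
  where γ = 𝔠 k λ'

shapeLE : Filling → ℕ → List ℕ
shapeLE T m = filter (λ x → x >? 0)
                (map (λ w → length (filter (λ x → x Data.Nat.≤? m) w)) T)

Γ̄ : (k : ℕ) {r : ℕ} → Vec ℕ r → Filling → Vec (List ℕ) (suc r)
Γ̄ k {r} α T = tabulate (λ (m : Fin (suc r)) → 𝔭 k (shapeLE T (toℕ m)))

module Submission where

-- Let n = k+1. A core γ and its bounded partition λ determine each other by
--     γ i = λ i + γ (i + n − λ i)   for all rows i,
-- from which containments between cores and between bounded partitions are read off: if μ/λ is a
-- horizontal strip, then so is 𝔠(μ)/𝔠(λ).
--
-- Call a pair (letter, residue) used if the letter fills a cell of this residue. Let a
-- semistandard filling of the core 𝔠(λ) be given and let Δ be a core inside the shape of the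
-- letters ≤ m. Removing from Δ, in a suitable cyclic order, all removable cells of the residues
-- used by m yields a core inside the shape of the letters < m, and each residue costs at most one
-- bounded cell (if m uses all n residues, drop the first row instead, which costs at most k).
-- Descending to the empty core, at least |λ| pairs are used. If exactly |λ| are used, then no
-- removal was void, so adding the cells back shows that all shapes of the chain are cores, and
-- that consecutive ones are admissible.
--
-- Conversely, if μ, λ is an admissible pair, the strip 𝔠(μ)/𝔠(λ) has at most |μ| − |λ| residues:
-- since μ/λ is a horizontal and the strip of the k-conjugates a vertical one, shifting the
-- contents of row i of the strip down by n turns all but μ i − λ i of them into contents of
-- higher rows of the strip. With the lower bound |λ| on the number of used pairs, the chain gives
-- exactly α m residues to the letter m.

-- A k-tableau is not assumed to have cores as shapes of its smaller letters, and the residues of a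
-- single letter do not show it; only the comparison of the whole evaluation with |λ| does. An
-- induction along the shapes would thus lack its hypothesis. Hence the descent is stated for an
-- arbitrary core inside a shape, as an inequality between sizes, and the shapes are recognized as
-- cores by following the case of equality back up from the empty core. The cyclic order needs a
-- residue that the letter does not use as its starting point: a cell can be removed only after its
-- right neighbour, which carries the next residue, and the gap is what breaks the cycle. A letter
-- using all n residues offers no gap, but the row dropped in its place costs at most n - 1 bounded
-- cells, so equality never meets this case. Containment of cores implies neither containment of the
-- bounded partitions nor that of the k-conjugates. The first follows with interlacing of the rows.
-- The second is obtained residue by residue, since each single removal is also a vertical strip.
-- Contents and hooks are kept in subtraction-free form, so that most steps are linear over the
-- natural numbers and can be decided by reflection.

open import Defs
open import Data.Bool using (Bool; true; false; T; if_then_else_; _∧_; _∨_; not)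
open import Data.Bool.Properties using (T?; T-∧; T-∨)
open import Data.Empty using (⊥; ⊥-elim)
open import Data.Fin as Fin using (Fin; toℕ; inject₁; fromℕ; fromℕ<)
open import Data.Fin.Properties using (toℕ-inject₁; toℕ-fromℕ; toℕ<n; toℕ-fromℕ<)
open import Data.List using (List; []; _∷_; _++_; length; map; filter; applyUpTo)
open import Data.List.Membership.Propositional using (_∈_)
open import Data.List.Membership.Propositional.Properties using (∈-applyUpTo⁺; ∈-++⁺ˡ; ∈-++⁺ʳ; ∈-map⁺)
open import Data.List.Properties
  using (map-upTo; map-applyUpTo; length-applyUpTo; length-++; length-map; filter-accept; filter-reject)
open import Data.List.Relation.Unary.All using (All; []; _∷_)
open import Data.List.Relation.Unary.All.Properties using (++⁺; all-filter)
open import Data.List.Relation.Unary.Any using (here; there)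
open import Data.List.Relation.Unary.Linked as Linked using (Linked; []; [-]; _∷_)
open import Data.Nat hiding (_≟_)
open import Data.Nat.DivMod using (m≡m%n+[m/n]*n; [m+kn]%n≡m%n; [m+n]%n≡m%n; m%n<n; m<n⇒m%n≡m; %-distribˡ-+)
open import Data.Nat.ListAction using (sum)
open import Data.Nat.Properties
open import Data.Nat.Tactic.RingSolver using (solve-∀)
open import Data.Product using (∃; _×_; _,_; proj₁; proj₂)
open import Data.Sum using (_⊎_; inj₁; inj₂)
open import Data.Vec as Vec using (Vec; []; _∷_; lookup; head; last; toList)
open import Data.Vec.N-ary using (N-ary; _$ⁿ_)
open import Data.Vec.Properties using (lookup∘tabulate; tabulate∘lookup; tabulate-cong)
open import Function using (_∘_)
open import Function.Bundles using (Equivalence)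
open import Relation.Binary.Definitions using (tri<; tri≈; tri>)
open import Relation.Binary.PropositionalEquality
open import Relation.Nullary using (¬_; Dec; yes; no)
open import Relation.Nullary.Decidable using (_×-dec_; ¬?)

-- Linear arithmetic

infixl 7 _·_
_·_ : ∀ {n} → Vec ℕ n → Vec ℕ n → ℕ
[]       · []      = 0
(a ∷ as) · (x ∷ ρ) = a * x + as · ρ

_⊞_ _⊟_ : ∀ {n} → Vec ℕ n → Vec ℕ n → Vec ℕ n
_⊞_ = Vec.zipWith _+_
_⊟_ = Vec.zipWith _∸_

⊞-· : ∀ {n} (u v ρ : Vec ℕ n) → (u ⊞ v) · ρ ≡ u · ρ + v · ρ
⊞-· []      []      []      = refl
⊞-· (a ∷ u) (b ∷ v) (x ∷ ρ) rewrite ⊞-· u v ρ = lemma a b x (u · ρ) (v · ρ)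
  where lemma : ∀ a b x p q → (a + b) * x + (p + q) ≡ a * x + p + (b * x + q)
        lemma = solve-∀

scale-· : ∀ {n} c (u ρ : Vec ℕ n) → Vec.map (c *_) u · ρ ≡ c * (u · ρ)
scale-· c []      []      = sym (*-zeroʳ c)
scale-· c (a ∷ u) (x ∷ ρ) rewrite scale-· c u ρ = lemma c a x (u · ρ)
  where lemma : ∀ c a x p → c * a * x + c * p ≡ c * (a * x + p)
        lemma = solve-∀

-- Both sides are the product of `ρ` with the componentwise maximum of `u` and `v`. So truncated
-- subtraction of coefficients is a legitimate cancellation.
⊟-· : ∀ {n} (u v ρ : Vec ℕ n) → (u ⊟ v) · ρ + v · ρ ≡ (v ⊟ u) · ρ + u · ρ
⊟-· []      []      []      = refl
⊟-· (a ∷ u) (b ∷ v) (x ∷ ρ) = begin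
  (a ∸ b) * x + (u ⊟ v) · ρ + (b * x + v · ρ)   ≡⟨ lemma (a ∸ b) b x _ _ ⟩
  (a ∸ b + b) * x + ((u ⊟ v) · ρ + v · ρ)       ≡⟨ cong₂ (λ c p → c * x + p) swap (⊟-· u v ρ) ⟩
  (b ∸ a + a) * x + ((v ⊟ u) · ρ + u · ρ)       ≡⟨ sym (lemma (b ∸ a) a x _ _) ⟩
  (b ∸ a) * x + (v ⊟ u) · ρ + (a * x + u · ρ)   ∎
  where
  open ≡-Reasoning
  lemma : ∀ c b x p q → c * x + p + (b * x + q) ≡ (c + b) * x + (p + q)
  lemma = solve-∀
  swap : a ∸ b + b ≡ b ∸ a + a
  swap = trans (+-comm (a ∸ b) b) (trans (sym (m⊔n≡m+n∸m′ b a)) (trans (⊔-comm b a)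
         (trans (m⊔n≡m+n∸m′ a b) (+-comm a (b ∸ a)))))
    where m⊔n≡m+n∸m′ : ∀ m n → m ⊔ n ≡ m + (n ∸ m)
          m⊔n≡m+n∸m′ zero    n       = refl
          m⊔n≡m+n∸m′ (suc m) zero    = cong suc (sym (+-identityʳ m))
          m⊔n≡m+n∸m′ (suc m) (suc n) = cong suc (m⊔n≡m+n∸m′ m n)

Ineq : ℕ → Set
Ineq n = Vec ℕ n × Vec ℕ n

Sat : ∀ {n} → Vec ℕ n → Ineq n → Set
Sat ρ (l , r) = l · ρ ≤ r · ρ

-- Leaves each variable on at most one side. The case distinctions of `resolve` and `eliminate` rely
-- on this form: an inequality with the variable on both sides would be discarded, which is sound
-- but loses information.
cancel : ∀ {n} → Ineq n → Ineq n
cancel (l , r) = (l ⊟ r) , (r ⊟ l)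

cancel-sat : ∀ {n} (ρ l r : Vec ℕ n) → l · ρ ≤ r · ρ → Sat ρ (cancel (l , r))
cancel-sat ρ l r h = +-cancelʳ-≤ (r · ρ) _ _
  (≤-trans (≤-reflexive (⊟-· l r ρ)) (+-monoʳ-≤ ((r ⊟ l) · ρ) h))

-- Fourier–Motzkin elimination of the first variable, which is a natural number: an upper
-- bound on it also remains valid without it.
resolve : ∀ {n} → ℕ → Ineq n → List (Ineq (suc n)) → List (Ineq n)
resolve a c       []                        = []
resolve a c       ((a′ ∷ l′ , zero  ∷ r′) ∷ cs) = resolve a c cs
resolve a (l , r) ((zero ∷ l′ , suc b ∷ r′) ∷ cs) =
  cancel (Vec.map (suc b *_) l ⊞ Vec.map (a *_) l′ , Vec.map (suc b *_) r ⊞ Vec.map (a *_) r′)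
    ∷ resolve a (l , r) cs
resolve a c       ((suc _ ∷ l′ , suc b ∷ r′) ∷ cs) = resolve a c cs

-- While the second list is traversed, `ds` keeps all inequalities, so that each upper bound meets
-- every lower bound.
eliminate : ∀ {n} → List (Ineq (suc n)) → List (Ineq (suc n)) → List (Ineq n)
eliminate ds []                             = []
eliminate ds ((zero  ∷ l , zero  ∷ r) ∷ cs) = (l , r) ∷ eliminate ds cs
eliminate ds ((suc a ∷ l , zero  ∷ r) ∷ cs) = (l , r) ∷ resolve (suc a) (l , r) ds ++ eliminate ds cs
eliminate ds ((a     ∷ l , suc b ∷ r) ∷ cs) = eliminate ds cs

resolve-sat : ∀ {n} a (l r : Vec ℕ n) x ρ → a * x + l · ρ ≤ r · ρ →
              ∀ cs → All (Sat (x ∷ ρ)) cs → All (Sat ρ) (resolve a (l , r) cs)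
resolve-sat a l r x ρ h []                              []       = []
resolve-sat a l r x ρ h ((a′ ∷ l′ , zero  ∷ r′) ∷ cs)   (p ∷ ps) = resolve-sat a l r x ρ h cs ps
resolve-sat a l r x ρ h ((suc _ ∷ l′ , suc b ∷ r′) ∷ cs) (p ∷ ps) = resolve-sat a l r x ρ h cs ps
resolve-sat a l r x ρ h ((zero ∷ l′ , suc b ∷ r′) ∷ cs) (p ∷ ps) =
  cancel-sat ρ _ (Vec.map (B *_) r ⊞ Vec.map (a *_) r′) combined ∷ resolve-sat a l r x ρ h cs ps
  where
  B = suc b
  open ≤-Reasoning
  lemma₁ : ∀ a B x p q → B * p + a * q + a * (B * x) ≡ B * (a * x + p) + a * q
  lemma₁ = solve-∀
  lemma₂ : ∀ a B x p q → B * p + a * (B * x + q) ≡ B * p + a * q + a * (B * x)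
  lemma₂ = solve-∀
  mix : ∀ (u v : Vec ℕ _) → (Vec.map (B *_) u ⊞ Vec.map (a *_) v) · ρ ≡ B * (u · ρ) + a * (v · ρ)
  mix u v = trans (⊞-· (Vec.map (B *_) u) (Vec.map (a *_) v) ρ) (cong₂ _+_ (scale-· B u ρ) (scale-· a v ρ))
  combined : (Vec.map (B *_) l ⊞ Vec.map (a *_) l′) · ρ ≤ (Vec.map (B *_) r ⊞ Vec.map (a *_) r′) · ρ
  combined = subst₂ _≤_ (sym (mix l l′)) (sym (mix r r′)) (+-cancelʳ-≤ (a * (B * x)) _ _ (begin
    B * (l · ρ) + a * (l′ · ρ) + a * (B * x)  ≡⟨ lemma₁ a B x (l · ρ) (l′ · ρ) ⟩
    B * (a * x + l · ρ) + a * (l′ · ρ)        ≤⟨ +-mono-≤ (*-monoʳ-≤ B h) (*-monoʳ-≤ a p) ⟩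
    B * (r · ρ) + a * (B * x + r′ · ρ)        ≡⟨ lemma₂ a B x (r · ρ) (r′ · ρ) ⟩
    B * (r · ρ) + a * (r′ · ρ) + a * (B * x)  ∎))

eliminate-sat : ∀ {n} x (ρ : Vec ℕ n) {ds} → All (Sat (x ∷ ρ)) ds →
                ∀ cs → All (Sat (x ∷ ρ)) cs → All (Sat ρ) (eliminate ds cs)
eliminate-sat x ρ hs []                             []       = []
eliminate-sat x ρ hs ((zero  ∷ l , zero  ∷ r) ∷ cs) (p ∷ ps) = p ∷ eliminate-sat x ρ hs cs ps
eliminate-sat x ρ hs ((suc a ∷ l , zero  ∷ r) ∷ cs) (p ∷ ps) =
  m+n≤o⇒n≤o (suc a * x) p
    ∷ ++⁺ (resolve-sat (suc a) l r x ρ p _ hs) (eliminate-sat x ρ hs cs ps)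
eliminate-sat x ρ hs ((zero  ∷ l , suc b ∷ r) ∷ cs) (p ∷ ps) = eliminate-sat x ρ hs cs ps
eliminate-sat x ρ hs ((suc a ∷ l , suc b ∷ r) ∷ cs) (p ∷ ps) = eliminate-sat x ρ hs cs ps

absurd? : List (Ineq 1) → Bool
absurd? []                       = false
absurd? ((a ∷ [] , b ∷ []) ∷ cs) = (b <ᵇ a) ∨ absurd? cs

refute : ∀ n → List (Ineq (suc n)) → Bool
refute zero    cs = absurd? cs
refute (suc n) cs = refute n (eliminate cs cs)

-- The final coordinate 1 turns constants into coefficients; it is the one coordinate never
-- eliminated, and `absurd?` compares its coefficients.
homogenize : ∀ {n} → Vec ℕ n → Vec ℕ (suc n)
homogenize []      = 1 ∷ []
homogenize (x ∷ ρ) = x ∷ homogenize ρ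

absurd?-sound : ∀ cs → All (Sat (1 ∷ [])) cs → T (absurd? cs) → ⊥
absurd?-sound ((a ∷ [] , b ∷ []) ∷ cs) (p ∷ ps) t with Equivalence.to (T-∨ {b <ᵇ a}) t
... | inj₂ t′ = absurd?-sound cs ps t′
... | inj₁ b<a rewrite *-identityʳ a | *-identityʳ b | +-identityʳ a | +-identityʳ b =
  <⇒≱ (<ᵇ⇒< b a b<a) p

refute-sound : ∀ {n} (ρ : Vec ℕ n) cs → All (Sat (homogenize ρ)) cs → T (refute n cs) → ⊥
refute-sound []      cs ps t = absurd?-sound cs ps t
refute-sound (x ∷ ρ) cs ps t = refute-sound ρ _ (eliminate-sat x (homogenize ρ) ps cs ps) t

-- Reflection of linear goals

infixl 6 _⊕_
data Expr (n : ℕ) : Set where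
  var : Fin n → Expr n
  con : ℕ → Expr n
  _⊕_ : Expr n → Expr n → Expr n

eval : ∀ {n} → Vec ℕ n → Expr n → ℕ
eval ρ       (con c)       = c
eval ρ       (e ⊕ f)       = eval ρ e + eval ρ f
eval ρ       (var i)       = lookup ρ i

unit : ∀ {n} → Fin n → Vec ℕ (suc n)
unit Fin.zero    = 1 ∷ Vec.replicate _ 0
unit (Fin.suc i) = 0 ∷ unit i

constant : ∀ {n} → ℕ → Vec ℕ (suc n)
constant {zero}  c = c ∷ []
constant {suc n} c = 0 ∷ constant c

coefficients : ∀ {n} → Expr n → Vec ℕ (suc n)
coefficients (var i) = unit i
coefficients (con c) = constant c
coefficients (e ⊕ f) = coefficients e ⊞ coefficients f

zeros-· : ∀ {n} (ρ : Vec ℕ n) → Vec.replicate n 0 · ρ ≡ 0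
zeros-· []      = refl
zeros-· (x ∷ ρ) = zeros-· ρ

coefficients-· : ∀ {n} (ρ : Vec ℕ n) e → coefficients e · homogenize ρ ≡ eval ρ e
coefficients-· (x ∷ ρ) (var Fin.zero)    rewrite zeros-· (homogenize ρ) = trans (+-identityʳ _) (+-identityʳ x)
coefficients-· (x ∷ ρ) (var (Fin.suc i)) = coefficients-· ρ (var i)
coefficients-· []      (con c) = trans (+-identityʳ _) (*-identityʳ c)
coefficients-· (x ∷ ρ) (con c) = coefficients-· ρ (con c)
coefficients-· ρ (e ⊕ f) rewrite ⊞-· (coefficients e) (coefficients f) (homogenize ρ) =
  cong₂ _+_ (coefficients-· ρ e) (coefficients-· ρ f)

infix 4 _≼_ _≺_ _≈_
data Atom (n : ℕ) : Set where
  _≼_ _≈_ : Expr n → Expr n → Atom n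
  falsum  : Atom n

pattern _≺_ e f = con 1 ⊕ e ≼ f

infixr 3 _⇒_
infix  3 ⊢_
data Form (n : ℕ) : Set where
  ⊢_  : Atom n → Form n
  _⇒_ : Atom n → Form n → Form n

⟦_⟧ₐ : ∀ {n} → Atom n → Vec ℕ n → Set
⟦ e ≼ f ⟧ₐ  ρ = eval ρ e ≤ eval ρ f
⟦ e ≈ f ⟧ₐ  ρ = eval ρ e ≡ eval ρ f
⟦ falsum ⟧ₐ ρ = ⊥

⟦_⟧ : ∀ {n} → Form n → Vec ℕ n → Set
⟦ ⊢ a ⟧   ρ = ⟦ a ⟧ₐ ρ
⟦ a ⇒ f ⟧ ρ = ⟦ a ⟧ₐ ρ → ⟦ f ⟧ ρ

leq : ∀ {n} → Expr n → Expr n → Ineq (suc n)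
leq e f = cancel (coefficients e , coefficients f)

leq-sat : ∀ {n} (ρ : Vec ℕ n) e f → eval ρ e ≤ eval ρ f → Sat (homogenize ρ) (leq e f)
leq-sat ρ e f h = cancel-sat (homogenize ρ) (coefficients e) (coefficients f)
  (subst₂ _≤_ (sym (coefficients-· ρ e)) (sym (coefficients-· ρ f)) h)

assume : ∀ {n} → Atom n → List (Ineq (suc n)) → List (Ineq (suc n))
assume (e ≼ f) cs = leq e f ∷ cs
assume (e ≈ f) cs = leq e f ∷ leq f e ∷ cs
assume falsum  cs = leq (con 1) (con 0) ∷ cs

valid : ∀ {n} → List (Ineq (suc n)) → Form n → Bool
valid cs (a ⇒ f)      = valid (assume a cs) f
valid cs (⊢ (e ≼ f))  = refute _ (leq (con 1 ⊕ f) e ∷ cs)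
valid cs (⊢ (e ≈ f))  = refute _ (leq (con 1 ⊕ f) e ∷ cs) ∧ refute _ (leq (con 1 ⊕ e) f ∷ cs)
valid cs (⊢ falsum)   = refute _ cs

refute-≤ : ∀ {n} (ρ : Vec ℕ n) e f cs → All (Sat (homogenize ρ)) cs →
           T (refute n (leq (con 1 ⊕ f) e ∷ cs)) → eval ρ e ≤ eval ρ f
refute-≤ ρ e f cs hs t with eval ρ e ≤? eval ρ f
... | yes p = p
... | no ¬p = ⊥-elim (refute-sound ρ _ (leq-sat ρ (con 1 ⊕ f) e (≰⇒> ¬p) ∷ hs) t)

valid-sound : ∀ {n} (ρ : Vec ℕ n) cs → All (Sat (homogenize ρ)) cs → ∀ f → T (valid cs f) → ⟦ f ⟧ ρ
valid-sound ρ cs hs ((e ≼ f) ⇒ g) t h = valid-sound ρ _ (leq-sat ρ e f h ∷ hs) g t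
valid-sound ρ cs hs ((e ≈ f) ⇒ g) t h =
  valid-sound ρ _ (leq-sat ρ e f (≤-reflexive h) ∷ leq-sat ρ f e (≤-reflexive (sym h)) ∷ hs) g t
valid-sound ρ cs hs (⊢ (e ≼ f))   t   = refute-≤ ρ e f cs hs t
valid-sound ρ cs hs (⊢ (e ≈ f))   t   with Equivalence.to (T-∧ {refute _ (leq (con 1 ⊕ f) e ∷ cs)}) t
... | t₁ , t₂ = ≤-antisym (refute-≤ ρ e f cs hs t₁) (refute-≤ ρ f e cs hs t₂)
valid-sound ρ cs hs (⊢ falsum)    t   = refute-sound ρ cs hs t

-- The formula is a function of `n` expressions, so that a call can name its variables in the order
-- of `ρ`. The hidden argument is solved by evaluating the decision procedure to `true`.
lin : ∀ {n} (ρ : Vec ℕ n) (f : N-ary n (Expr n) (Form n)) →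
      {_ : T (valid [] (f $ⁿ Vec.map var (Vec.allFin n)))} → ⟦ f $ⁿ Vec.map var (Vec.allFin n) ⟧ ρ
lin ρ f {t} = valid-sound ρ [] [] (f $ⁿ Vec.map var (Vec.allFin _)) t

-- Lists and counting

part : List ℕ → ℕ → ℕ
part = nth 0

Antitone : (ℕ → ℕ) → Set
Antitone g = ∀ {i j} → i ≤ j → g j ≤ g i

antitone : ∀ {g : ℕ → ℕ} → (∀ i → g (suc i) ≤ g i) → Antitone g
antitone {g} step {i} {j} i≤j with m≤n⇒m<n∨m≡n i≤j
antitone step i≤j | inj₂ refl = ≤-refl
antitone step {i} {suc j} i≤j | inj₁ (s≤s i≤j′) = ≤-trans (step j) (antitone step i≤j′)

nth-≥length : ∀ {A : Set} (d : A) xs {i} → length xs ≤ i → nth d xs i ≡ d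
nth-≥length d []       le                = refl
nth-≥length d (x ∷ xs) {suc i} (s≤s le) = nth-≥length d xs le

nth-applyUpTo : ∀ {A : Set} (d : A) f m {i} → i < m → nth d (applyUpTo f m) i ≡ f i
nth-applyUpTo d f (suc m) {zero}  lt       = refl
nth-applyUpTo d f (suc m) {suc i} (s≤s lt) = nth-applyUpTo d (f ∘ suc) m lt

map-oneTo : ∀ {A : Set} (f : ℕ → A) m → map f (oneTo m) ≡ applyUpTo (f ∘ suc) m
map-oneTo f m rewrite map-upTo suc m = map-applyUpTo suc f m

nth-map-oneTo : ∀ {A : Set} (d : A) f m {i} → i < m → nth d (map f (oneTo m)) i ≡ f (suc i)
nth-map-oneTo d f m lt rewrite map-oneTo f m = nth-applyUpTo d (f ∘ suc) m lt

length-map-oneTo : ∀ {A : Set} (f : ℕ → A) m → length (map f (oneTo m)) ≡ m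
length-map-oneTo f m rewrite map-oneTo f m = length-applyUpTo (f ∘ suc) m

nth-ext : ∀ {A : Set} (d : A) xs ys → length xs ≡ length ys →
          (∀ i → i < length xs → nth d xs i ≡ nth d ys i) → xs ≡ ys
nth-ext d []       []       _ _ = refl
nth-ext d (x ∷ xs) (y ∷ ys) l h =
  cong₂ _∷_ (h 0 z<s) (nth-ext d xs ys (suc-injective l) (λ i lt → h (suc i) (s≤s lt)))

All-nth : ∀ {P : ℕ → Set} {xs} → (∀ i → i < length xs → P (part xs i)) → All P xs
All-nth {xs = []}     h = []
All-nth {xs = x ∷ xs} h = h 0 z<s ∷ All-nth (λ i lt → h (suc i) (s≤s lt))

nth-All : ∀ {P : ℕ → Set} {xs} → All P xs → ∀ {i} → i < length xs → P (part xs i)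
nth-All (p ∷ ps) {zero}  lt       = p
nth-All (p ∷ ps) {suc i} (s≤s lt) = nth-All ps lt

linked-step : ∀ {xs} → Linked _≥_ xs → ∀ i → part xs (suc i) ≤ part xs i
linked-step []       i       = z≤n
linked-step [-]      i       = z≤n
linked-step (p ∷ ps) zero    = p
linked-step (p ∷ ps) (suc i) = linked-step ps i

step-linked : ∀ xs → (∀ i → part xs (suc i) ≤ part xs i) → Linked _≥_ xs
step-linked []           h = []
step-linked (x ∷ [])     h = [-]
step-linked (x ∷ y ∷ xs) h = h 0 ∷ step-linked (y ∷ xs) (h ∘ suc)

part-antitone : ∀ {γ} → IsPartition γ → Antitone (part γ)
part-antitone (_ , l) = antitone (linked-step l)

part-positive : ∀ {γ} → IsPartition γ → ∀ {i} → i < length γ → 1 ≤ part γ i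
part-positive (p , _) = nth-All p

part>0⇒<length : ∀ γ {i} → 0 < part γ i → i < length γ
part>0⇒<length γ {i} pos with i <? length γ
... | yes lt = lt
... | no  ge = ⊥-elim (<⇒≢ pos (sym (nth-≥length 0 γ (≮⇒≥ ge))))

isPartition : ∀ {γ} → All (1 ≤_) γ → (∀ i → part γ (suc i) ≤ part γ i) → IsPartition γ
isPartition p s = p , step-linked _ s

partition-ext : ∀ {γ δ} → IsPartition γ → IsPartition δ → (∀ i → part γ i ≡ part δ i) → γ ≡ δ
partition-ext {γ} {δ} pγ pδ h = nth-ext 0 γ δ (≤-antisym (len {γ} {δ} pγ h) (len {δ} {γ} pδ (sym ∘ h)))
    (λ i _ → h i)
  where
  len : ∀ {γ δ} → IsPartition γ → (∀ i → part γ i ≡ part δ i) → length γ ≤ length δ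
  len {γ} {δ} pγ h with length γ ≤? length δ
  ... | yes p = p
  ... | no ¬p = ⊥-elim (<⇒≢ (part-positive pγ (≰⇒> ¬p))
                              (sym (trans (h _) (nth-≥length 0 δ ≤-refl))))

nonzero : List ℕ → List ℕ
nonzero = filter (λ x → x >? 0)

part-nonzero : ∀ xs → Antitone (part xs) → ∀ i → part (nonzero xs) i ≡ part xs i
part-nonzero []           a i       = refl
part-nonzero (suc x ∷ xs) a zero    = refl
part-nonzero (suc x ∷ xs) a (suc i) = part-nonzero xs (λ le → a (s≤s le)) i
part-nonzero (zero ∷ xs)  a i       =
  trans (part-nonzero xs (λ le → a (s≤s le)) i)
        (trans (n≤0⇒n≡0 (a {0} {suc i} z≤n)) (sym (n≤0⇒n≡0 (a {0} {i} z≤n))))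

nonzero-partition : ∀ xs → Antitone (part xs) → IsPartition (nonzero xs)
nonzero-partition xs a = isPartition (all-filter _ xs)
  (λ i → subst₂ _≤_ (sym (part-nonzero xs a (suc i))) (sym (part-nonzero xs a i)) (a (n≤1+n i)))

sumTo : (ℕ → ℕ) → ℕ → ℕ
sumTo f zero    = 0
sumTo f (suc m) = sumTo f m + f m

sumTo-suc : ∀ f m → sumTo f (suc m) ≡ f 0 + sumTo (f ∘ suc) m
sumTo-suc f zero    = sym (+-identityʳ (f 0))
sumTo-suc f (suc m) = trans (cong (_+ f (suc m)) (sumTo-suc f m)) (+-assoc (f 0) _ _)

sumTo-cong : ∀ {f g} m → (∀ i → i < m → f i ≡ g i) → sumTo f m ≡ sumTo g m
sumTo-cong zero    h = refl
sumTo-cong (suc m) h = cong₂ _+_ (sumTo-cong m (λ i lt → h i (m<n⇒m<1+n lt))) (h m ≤-refl)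

sumTo-0 : ∀ m → sumTo (λ _ → 0) m ≡ 0
sumTo-0 zero    = refl
sumTo-0 (suc m) = trans (+-identityʳ _) (sumTo-0 m)

sumTo-+ : ∀ f g m → sumTo (λ i → f i + g i) m ≡ sumTo f m + sumTo g m
sumTo-+ f g zero    = refl
sumTo-+ f g (suc m) rewrite sumTo-+ f g m = lin (sumTo f m ∷ sumTo g m ∷ f m ∷ g m ∷ [])
  (λ a b c d → ⊢ a ⊕ b ⊕ (c ⊕ d) ≈ a ⊕ c ⊕ (b ⊕ d))

sumTo-mono : ∀ {f g} m → (∀ i → i < m → f i ≤ g i) → sumTo f m ≤ sumTo g m
sumTo-mono zero    h = z≤n
sumTo-mono (suc m) h = +-mono-≤ (sumTo-mono m (λ i lt → h i (m<n⇒m<1+n lt))) (h m ≤-refl)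

sumTo-swap : ∀ (f : ℕ → ℕ → ℕ) m n → sumTo (λ i → sumTo (f i) n) m ≡ sumTo (λ j → sumTo (λ i → f i j) m) n
sumTo-swap f zero    n = sym (sumTo-0 n)
sumTo-swap f (suc m) n rewrite sumTo-swap f m n = sym (sumTo-+ (λ j → sumTo (λ i → f i j) m) (f m) n)

size-sumTo : ∀ γ {m} → length γ ≤ m → size γ ≡ sumTo (part γ) m
size-sumTo []      {m}     le       = sym (sumTo-0 m)
size-sumTo (x ∷ γ) {suc m} (s≤s le) =
  trans (cong (x +_) (size-sumTo γ le)) (sym (sumTo-suc (part (x ∷ γ)) m))

indicator : Bool → ℕ
indicator b = if b then 1 else 0

countB-sumTo : ∀ p m → countB p m ≡ sumTo (λ i → indicator (p (suc i))) m
countB-sumTo p zero    = refl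
countB-sumTo p (suc m) = cong (_+ indicator (p (suc m))) (countB-sumTo p m)

countB≤ : ∀ p m → countB p m ≤ m
countB≤ p zero = z≤n
countB≤ p (suc m) with p (suc m)
... | true  = ≤-trans (+-monoˡ-≤ 1 (countB≤ p m)) (≤-reflexive (+-comm m 1))
... | false = ≤-trans (≤-reflexive (+-identityʳ _)) (m≤n⇒m≤1+n (countB≤ p m))

countB-cong : ∀ {p q} m → (∀ i → 1 ≤ i → i ≤ m → p i ≡ q i) → countB p m ≡ countB q m
countB-cong zero    h = refl
countB-cong (suc m) h =
  cong₂ _+_ (countB-cong m (λ i a b → h i a (m≤n⇒m≤1+n b))) (cong indicator (h (suc m) z<s ≤-refl))

countB-+ : ∀ p a b → countB p (a + b) ≡ countB p a + countB (p ∘ (a +_)) b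
countB-+ p a zero rewrite +-identityʳ a = sym (+-identityʳ _)
countB-+ p a (suc b) rewrite +-suc a b | countB-+ p a b = +-assoc (countB p a) _ _

-- The rows meeting a column are down-closed, the columns of the k-bounded cells of a row up-closed.
-- On such sets a count decides membership: for 1 ≤ i ≤ m, `i` belongs to a down-closed `p` iff
-- `i ≤ countB p m`, and to an up-closed one iff `m < i + countB p m`.
DownClosed UpClosed : (ℕ → Bool) → Set
DownClosed p = ∀ {i} → 1 ≤ i → T (p (suc i)) → T (p i)
UpClosed   p = ∀ {i} → 1 ≤ i → T (p i) → T (p (suc i))

module _ {p : ℕ → Bool} (dc : DownClosed p) where

  down : ∀ {i j} → 1 ≤ i → i ≤ j → T (p j) → T (p i)
  down {i} {j} pos i≤j t with m≤n⇒m<n∨m≡n i≤j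
  ... | inj₂ refl = t
  down {i} {suc j} pos i≤j t | inj₁ (s≤s i≤j′) = down pos i≤j′ (dc (≤-trans pos i≤j′) t)

  countB-all : ∀ m → (1 ≤ m → T (p m)) → countB p m ≡ m
  countB-all zero    t = refl
  countB-all (suc m) t with p (suc m) in eq | t z<s
  ... | true | _ = trans (cong (_+ 1) (countB-all m (λ pos → dc pos (subst T (sym eq) _)))) (+-comm m 1)

  ≤countB : ∀ m {i} → 1 ≤ i → i ≤ m → T (p i) → i ≤ countB p m
  ≤countB zero    pos le t = le
  ≤countB (suc m) {i} pos le t with m≤n⇒m<n∨m≡n le
  ... | inj₂ refl = ≤-reflexive (sym (countB-all (suc m) (λ _ → t)))
  ... | inj₁ (s≤s le′) = ≤-trans (≤countB m pos le′ t) (m≤m+n _ _)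

  countB≥ : ∀ m {i} → 1 ≤ i → i ≤ countB p m → T (p i)
  countB≥ zero (s≤s _) ()
  countB≥ (suc m) {i} pos le with p (suc m) in eq
  ... | false = countB≥ m pos (≤-trans le (≤-reflexive (+-identityʳ _)))
  ... | true  = down pos (≤-trans le (≤-trans (+-monoˡ-≤ 1 (countB≤ p m)) (≤-reflexive (+-comm m 1))))
                     (subst T (sym eq) _)

module _ {p : ℕ → Bool} (uc : UpClosed p) where

  up : ∀ {i j} → 1 ≤ i → i ≤ j → T (p i) → T (p j)
  up {i} {j} pos i≤j t with m≤n⇒m<n∨m≡n i≤j
  ... | inj₂ refl = t
  up {i} {suc j} pos i≤j t | inj₁ (s≤s i≤j′) = uc (≤-trans pos i≤j′) (up pos i≤j′ t)

  countB-none : ∀ m → (1 ≤ m → ¬ T (p m)) → countB p m ≡ 0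
  countB-none zero    t = refl
  countB-none (suc m) t with p (suc m) in eq
  ... | true = ⊥-elim (t z<s _)
  ... | false = trans (+-identityʳ _) (countB-none m (λ pos tm → subst T eq (uc pos tm)))

  <+countB : ∀ m {i} → 1 ≤ i → i ≤ m → T (p i) → m < i + countB p m
  <+countB zero    pos le t = ≤-trans pos (m≤m+n _ _)
  <+countB (suc m) {i} pos le t with p (suc m) in eq | up pos le t
  ... | true | _ with m≤n⇒m<n∨m≡n le
  ... | inj₂ refl = lin (m ∷ countB p m ∷ []) (λ m c → ⊢ con 1 ⊕ (con 1 ⊕ m) ≼ con 1 ⊕ m ⊕ (c ⊕ con 1))
  ... | inj₁ (s≤s le′) = lin (m ∷ i ∷ countB p m ∷ [])
      (λ m i c → m ≺ i ⊕ c ⇒ ⊢ con 1 ⊕ m ≺ i ⊕ (c ⊕ con 1)) (<+countB m pos le′ t)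

  +countB> : ∀ m {i} → 1 ≤ i → i ≤ m → m < i + countB p m → T (p i)
  +countB> zero    pos le lt = ⊥-elim (<⇒≱ pos le)
  +countB> (suc m) {i} pos le lt with T? (p (suc m))
  ... | no ¬t = ⊥-elim (<⇒≱ lt (subst (λ c → i + c ≤ suc m) (sym (countB-none (suc m) (λ _ → ¬t)))
                                  (≤-trans (≤-reflexive (+-identityʳ i)) le)))
  ... | yes t with m≤n⇒m<n∨m≡n le
  ... | inj₂ refl = t
  ... | inj₁ (s≤s le′) with p (suc m)
  ... | true = +countB> m pos le′ (lin (m ∷ i ∷ countB p m ∷ [])
      (λ m i c → con 1 ⊕ m ≺ i ⊕ (c ⊕ con 1) ⇒ ⊢ m ≺ i ⊕ c) lt)

-- Cores

module _ {γ : List ℕ} (pγ : IsPartition γ) where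

  private
    columnDC : ∀ j → DownClosed (λ i → suc j ≤ᵇ row γ i)
    columnDC j {suc i} _ t = ≤⇒≤ᵇ (≤-trans (≤ᵇ⇒≤ _ _ t) (part-antitone pγ (n≤1+n i)))

  cell⇒<colLen : ∀ {i j} → j < part γ i → i < colLen γ (suc j)
  cell⇒<colLen {i} {j} lt =
    ≤countB (columnDC j) (length γ) z<s (part>0⇒<length γ (≤-trans z<s lt)) (≤⇒≤ᵇ lt)

  <colLen⇒cell : ∀ {i j} → i < colLen γ (suc j) → j < part γ i
  <colLen⇒cell {i} {j} lt = ≤ᵇ⇒≤ _ _ (countB≥ (columnDC j) (length γ) z<s lt)

  colLen-antitone : Antitone (λ j → colLen γ (suc j))
  colLen-antitone {i} {j} i≤j = ≮⇒≥ λ lt → <-irrefl refl (cell⇒<colLen (≤-trans (s≤s i≤j) (<colLen⇒cell lt)))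

  part-conj : ∀ j → part (conj γ) j ≡ colLen γ (suc j)
  part-conj j with j <? part γ 0
  ... | yes lt = nth-map-oneTo 0 (colLen γ) (part γ 0) lt
  ... | no  ge = trans (nth-≥length 0 (conj γ)
                         (≤-trans (≤-reflexive (length-map-oneTo (colLen γ) (part γ 0))) (≮⇒≥ ge)))
                       (sym (n≤0⇒n≡0 (≮⇒≥ (ge ∘ <colLen⇒cell))))

  conj-partition : IsPartition (conj γ)
  conj-partition = isPartition
    (All-nth λ j lt → subst (1 ≤_) (sym (part-conj j))
      (cell⇒<colLen (subst (j <_) (length-map-oneTo (colLen γ) (part γ 0)) lt)))
    (λ j → subst₂ _≤_ (sym (part-conj (suc j))) (sym (part-conj j)) (colLen-antitone (n≤1+n j)))

  -- Arm and leg without truncated subtraction, which makes hook lengths accessible to `lin`.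
  hook-+ : ∀ {i j} → j < part γ i → hook γ (suc i) (suc j) + (suc i + j) ≡ part γ i + colLen γ (suc j)
  hook-+ {i} {j} lt =
    lin (part γ i ∸ suc j ∷ colLen γ (suc j) ∸ suc i ∷ i ∷ j ∷ part γ i ∷ colLen γ (suc j) ∷ [])
      (λ a b i j p c → a ⊕ (con 1 ⊕ j) ≈ p ⇒ b ⊕ (con 1 ⊕ i) ≈ c ⇒
                       ⊢ con 1 ⊕ a ⊕ b ⊕ (con 1 ⊕ i ⊕ j) ≈ p ⊕ c)
      (m∸n+n≡m lt) (m∸n+n≡m (cell⇒<colLen lt))

colLen-conj : ∀ {γ} → IsPartition γ → ∀ i → colLen (conj γ) (suc i) ≡ part γ i
colLen-conj {γ} pγ i = ≤-antisym
  (≮⇒≥ λ lt → <-irrefl refl (to lt))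
  (≮⇒≥ λ lt → <-irrefl refl (from lt))
  where
  to : ∀ {j} → j < colLen (conj γ) (suc i) → j < part γ i
  to lt = <colLen⇒cell pγ (subst (_ <_) (part-conj pγ _) (<colLen⇒cell (conj-partition pγ) lt))
  from : ∀ {j} → j < part γ i → j < colLen (conj γ) (suc i)
  from lt = cell⇒<colLen (conj-partition pγ) (subst (_ <_) (sym (part-conj pγ _)) (cell⇒<colLen pγ lt))

hook-conj : ∀ {γ} → IsPartition γ → ∀ {i j} → j < part γ i →
            hook (conj γ) (suc j) (suc i) ≡ hook γ (suc i) (suc j)
hook-conj {γ} pγ {i} {j} lt = +-cancelʳ-≡ (suc i + j) _ _ (begin
  hook (conj γ) (suc j) (suc i) + (suc i + j)    ≡⟨ cong (hook (conj γ) (suc j) (suc i) +_)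
      (cong suc (+-comm i j)) ⟩
  hook (conj γ) (suc j) (suc i) + (suc j + i)    ≡⟨ hook-+ (conj-partition pγ)
      (subst (i <_) (sym (part-conj pγ j)) (cell⇒<colLen pγ lt)) ⟩
  part (conj γ) j + colLen (conj γ) (suc i)      ≡⟨ cong₂ _+_ (part-conj pγ j) (colLen-conj pγ i) ⟩
  colLen γ (suc j) + part γ i                    ≡⟨ +-comm (colLen γ (suc j)) _ ⟩
  part γ i + colLen γ (suc j)                    ≡⟨ sym (hook-+ pγ lt) ⟩
  hook γ (suc i) (suc j) + (suc i + j)           ∎)
  where open ≡-Reasoning

conj-core : ∀ {k γ} → IsCore k γ → IsCore k (conj γ)
conj-core {k} {γ} (pγ , h) = conj-partition pγ , nohook
  where
  nohook : ∀ i j → IsCell (conj γ) i j → hook (conj γ) i j ≢ suc k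
  nohook (suc j) (suc i) (_ , _ , lt) eq = h (suc i) (suc j) (z<s , z<s , cell)
      (trans (sym (hook-conj pγ cell)) eq)
    where cell = <colLen⇒cell pγ (subst (i <_) (part-conj pγ j) lt)

-- A core is recovered from the numbers ℓ i of k-bounded cells of its rows: in terms of the
-- beads g i − i, the bead of row i moved down by k+1 is again a bead, namely that of
-- row i + (k+1) − ℓ i, which therefore has length g i − ℓ i. Rows are counted from 0.
next : ℕ → ℕ → ℕ → ℕ
next k x i = i + suc (k ∸ x)

next-+ : ∀ {k x} → x ≤ k → ∀ i → x + next k x i ≡ i + suc k
next-+ {k} {x} le i = lin (x ∷ i ∷ k ∷ k ∸ x ∷ [])
  (λ x i k d → d ⊕ x ≈ k ⇒ ⊢ x ⊕ (i ⊕ (con 1 ⊕ d)) ≈ i ⊕ (con 1 ⊕ k)) (m∸n+n≡m le)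

<next : ∀ k x i → i < next k x i
<next k x i = ≤-trans (s≤s (m≤m+n i _)) (≤-reflexive (sym (+-suc i _)))

-- Functions instead of lists, so that column lengths, the rows left after dropping the first one,
-- and the result of a removal are instances before any list is built. `height` supplies the start
-- of the induction along `rec`.
record Core (k : ℕ) (ℓ g : ℕ → ℕ) : Set where
  field
    bounded   : ∀ i → ℓ i ≤ k
    mono      : Antitone g
    rec       : ∀ i → g i ≡ ℓ i + g (next k (ℓ i) i)
    height    : ℕ
    vanishing : ∀ {i} → height ≤ i → g i ≡ 0

  below : ℕ → ℕ
  below i = next k (ℓ i) i

  below-+ : ∀ i → ℓ i + below i ≡ i + suc k
  below-+ i = next-+ (bounded i) i

  ℓ≤ : ∀ i → ℓ i ≤ g i
  ℓ≤ i = ≤-trans (m≤m+n _ _) (≤-reflexive (sym (rec i)))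

  -- If `ℓ` grew from `i` to `suc i`, row `below (suc i)` would not come after row `below i`, hence
  -- would be at least as long, and the recursion would make row `suc i` of `g` longer than row `i`.
  ℓ-antitone : Antitone ℓ
  ℓ-antitone = antitone λ i → ≮⇒≥ λ lt →
    lin (ℓ i ∷ ℓ (suc i) ∷ g i ∷ g (suc i) ∷ g (below i) ∷ g (below (suc i)) ∷ [])
      (λ x y gi gj gbi gbj →
        x ≺ y ⇒ gj ≼ gi ⇒ gi ≈ x ⊕ gbi ⇒ gj ≈ y ⊕ gbj ⇒ gbi ≼ gbj ⇒ ⊢ falsum)
      lt (mono (n≤1+n i)) (rec i) (rec (suc i))
      (mono (lin (ℓ i ∷ ℓ (suc i) ∷ i ∷ k ∷ below i ∷ below (suc i) ∷ [])
        (λ x y i k a b → x ≺ y ⇒ x ⊕ a ≈ i ⊕ (con 1 ⊕ k) ⇒ y ⊕ b ≈ con 1 ⊕ i ⊕ (con 1 ⊕ k) ⇒ ⊢ b ≼ a)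
        lt (below-+ i) (below-+ (suc i))))

module _ {k : ℕ} {ℓ g ℓ′ g′ : ℕ → ℕ} (C : Core k ℓ g) (C′ : Core k ℓ′ g′) (ℓ≤ℓ′ : ∀ i → ℓ i ≤ ℓ′ i) where
  private
    module C = Core C
    module C′ = Core C′

  -- Induction from the empty rows towards row 0: a larger part also refers the recursion to an
  -- earlier, hence longer, row.
  core-mono : ∀ i → g i ≤ g′ i
  core-mono i = go C.height i (m≤n+m _ i)
    where
    go : ∀ d i → C.height ≤ i + d → g i ≤ g′ i
    go zero    i le = ≤-trans (≤-reflexive (C.vanishing (≤-trans le (≤-reflexive (+-identityʳ i))))) z≤n
    go (suc d) i le = begin
      g i                         ≡⟨ C.rec i ⟩
      ℓ i + g (C.below i)         ≤⟨ +-mono-≤ (ℓ≤ℓ′ i) (go d (C.below i) below-le) ⟩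
      ℓ′ i + g′ (C.below i)       ≤⟨ +-monoʳ-≤ (ℓ′ i) (C′.mono (+-monoʳ-≤ i (s≤s (∸-monoʳ-≤ k (ℓ≤ℓ′ i))))) ⟩
      ℓ′ i + g′ (C′.below i)      ≡⟨ sym (C′.rec i) ⟩
      g′ i                        ∎
      where
      open ≤-Reasoning
      below-le : C.height ≤ C.below i + d
      below-le = lin (C.height ∷ i ∷ d ∷ C.below i ∷ []) (λ h i d b → h ≼ i ⊕ (con 1 ⊕ d) ⇒ i ≺ b ⇒ ⊢ h ≼ b ⊕ d)
                   le (<next k (ℓ i) i)

core-unique : ∀ {k ℓ g ℓ′ g′} → Core k ℓ g → Core k ℓ′ g′ → (∀ i → ℓ i ≡ ℓ′ i) → ∀ i → g i ≡ g′ i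
core-unique C C′ eq i = ≤-antisym (core-mono C C′ (≤-reflexive ∘ eq) i)
    (core-mono C′ C (≤-reflexive ∘ sym ∘ eq) i)

module _ (k : ℕ) {γ : List ℕ} (pγ : IsPartition γ) where

  cell-bounded : ℕ → ℕ → Bool
  cell-bounded i j = hook γ i j ≤ᵇ k

  hook-antitone : ∀ i {j} → 1 ≤ j → hook γ (suc i) (suc j) ≤ hook γ (suc i) j
  hook-antitone i {suc j} _ = s≤s
      (+-mono-≤ (∸-monoʳ-≤ (part γ i) (n≤1+n (suc j))) (∸-monoˡ-≤ (suc i) (colLen-antitone pγ (n≤1+n j))))

  hook-UC : ∀ i → UpClosed (cell-bounded (suc i))
  hook-UC i {j} pos t = ≤⇒≤ᵇ (≤-trans (hook-antitone i pos) (≤ᵇ⇒≤ _ k t))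

  boundedInRow≤ : ∀ i → boundedInRow k γ (suc i) ≤ part γ i
  boundedInRow≤ i = countB≤ _ (part γ i)

-- Hooks decrease along a row, so its bounded cells are the last ones. The last unbounded cell has a
-- hook exceeding k+1, as k+1 itself does not occur; this forces row `below i` to meet its column.
-- The hook of the first bounded cell forbids row `below i` to go further.
core-rec : ∀ {k γ} → IsCore k γ → Core k (boundedInRow k γ ∘ suc) (part γ)
core-rec {k} {γ} (pγ , nohook) = record
  { bounded = bounded ; mono = part-antitone pγ ; rec = rec
  ; height = length γ ; vanishing = nth-≥length 0 γ }
  where
  ℓ = boundedInRow k γ ∘ suc
  shift : ∀ i → ∃ λ s → part γ i ≡ ℓ i + s
  shift i = part γ i ∸ ℓ i , sym (m+[n∸m]≡n (boundedInRow≤ k pγ i))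
  bounded : ∀ i → ℓ i ≤ k
  bounded i with ℓ i in eq | shift i
  ... | zero  | _ = z≤n
  ... | suc x | s , p = lin (hook γ (suc i) (suc s) ∷ i ∷ s ∷ x ∷ part γ i ∷ colLen γ (suc s) ∷ k ∷ [])
      (λ h i s x p c k → h ⊕ (con 1 ⊕ i ⊕ s) ≈ p ⊕ c ⇒ p ≈ con 1 ⊕ x ⊕ s ⇒ h ≼ k ⇒ i ≺ c ⇒ ⊢ con 1 ⊕ x ≼ k)
      (hook-+ pγ s<) p (≤ᵇ⇒≤ _ _ (+countB> (hook-UC k pγ i) (part γ i) z<s s<
          (subst (λ c → part γ i < suc s + c) (sym eq)
              (lin (part γ i ∷ s ∷ x ∷ []) (λ p s x → p ≈ con 1 ⊕ x ⊕ s ⇒ ⊢ p ≺ con 1 ⊕ s ⊕ (con 1 ⊕ x)) p))))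
      (cell⇒<colLen pγ s<)
      where s< : s < part γ i
            s< = ≤-trans (s≤s (m≤n+m s x)) (≤-reflexive (sym p))
  below = λ i → next k (ℓ i) i
  rec : ∀ i → part γ i ≡ ℓ i + part γ (below i)
  rec i with shift i
  ... | s , p = trans p (cong (ℓ i +_) (≤-antisym (upper s p) (≮⇒≥ (lower s p))))
    where
    nb = next-+ (bounded i) i
    upper : ∀ s → part γ i ≡ ℓ i + s → s ≤ part γ (below i)
    upper zero    p = z≤n
    upper (suc s) p = <colLen⇒cell pγ
      (lin (hook γ (suc i) (suc s) ∷ i ∷ s ∷ ℓ i ∷ part γ i ∷ colLen γ (suc s) ∷ k ∷ below i ∷ [])
        (λ h i s l p c k b → h ⊕ (con 1 ⊕ i ⊕ s) ≈ p ⊕ c ⇒ p ≈ l ⊕ (con 1 ⊕ s) ⇒ con 1 ⊕ k ≺ h ⇒ l ⊕ b ≈ i ⊕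
            (con 1 ⊕ k) ⇒ ⊢ b ≺ c)
        (hook-+ pγ s<) p (≤∧≢⇒< (≰⇒> unbounded) (nohook (suc i) (suc s) (z<s , z<s , s<) ∘ sym)) nb)
      where
      s< : s < part γ i
      s< = ≤-trans (m≤n+m (suc s) (ℓ i)) (≤-reflexive (sym p))
      unbounded : ¬ hook γ (suc i) (suc s) ≤ k
      unbounded le = <-irrefl refl (≤-trans (<+countB (hook-UC k pγ i) (part γ i) z<s s< (≤⇒≤ᵇ le))
        (≤-reflexive (trans (+-comm (suc s) (ℓ i)) (sym p))))
    lower : ∀ s → part γ i ≡ ℓ i + s → s < part γ (below i) → ⊥
    lower s p lt = lin (hook γ (suc i) (suc s) ∷ i ∷ s ∷ ℓ i ∷ part γ i ∷ colLen γ (suc s) ∷ k ∷ below i ∷ [])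
        (λ h i s l p c k b → h ⊕ (con 1 ⊕ i ⊕ s) ≈ p ⊕ c ⇒ p ≈ l ⊕ s ⇒ h ≼ k ⇒ l ⊕ b ≈ i ⊕ (con 1 ⊕ k) ⇒ b ≺
            c ⇒ ⊢ falsum)
        (hook-+ pγ s<) p (≤ᵇ⇒≤ _ _ (+countB> (hook-UC k pγ i) (part γ i) z<s s<
            (≤-reflexive (cong suc (trans p (+-comm (ℓ i) s))))))
        nb (cell⇒<colLen pγ lt)
      where
      s< : s < part γ i
      s< = ≤-trans lt (part-antitone pγ (<⇒≤ (<next k (ℓ i) i)))

module _ {k : ℕ} {γ : List ℕ} {ℓ : ℕ → ℕ} (pγ : IsPartition γ) (C : Core k ℓ (part γ)) where
  private
    module C = Core C

  -- Converse direction of `core-rec`: the end of row `below i` separates the bounded cells of row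
  -- `i` from the others, whose hooks jump over the value k+1.
  bounded-hook : ∀ {i j} → j < part γ i → part γ (C.below i) ≤ j → hook γ (suc i) (suc j) ≤ k
  bounded-hook {i} {j} lt le =
    lin (hook γ (suc i) (suc j) ∷ i ∷ j ∷ ℓ i ∷ part γ i ∷ colLen γ (suc j) ∷ k ∷ C.below i ∷ part γ
        (C.below i) ∷ [])
      (λ h i j l p c k b q → h ⊕ (con 1 ⊕ i ⊕ j) ≈ p ⊕ c ⇒ p ≈ l ⊕ q ⇒ q ≼ j ⇒ c ≼ b ⇒ l ⊕ b ≈ i ⊕
          (con 1 ⊕ k) ⇒ ⊢ h ≼ k)
      (hook-+ pγ lt) (C.rec i) le (≮⇒≥ (≤⇒≯ le ∘ <colLen⇒cell pγ)) (C.below-+ i)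

  unbounded-hook : ∀ {i j} → j < part γ (C.below i) → suc k < hook γ (suc i) (suc j)
  unbounded-hook {i} {j} lt =
    lin (hook γ (suc i) (suc j) ∷ i ∷ j ∷ ℓ i ∷ part γ i ∷ colLen γ (suc j) ∷ k ∷ C.below i ∷ part γ
        (C.below i) ∷ [])
      (λ h i j l p c k b q → h ⊕ (con 1 ⊕ i ⊕ j) ≈ p ⊕ c ⇒ p ≈ l ⊕ q ⇒ j ≺ q ⇒ b ≺ c ⇒ l ⊕ b ≈ i ⊕
          (con 1 ⊕ k) ⇒ ⊢ con 1 ⊕ k ≺ h)
      (hook-+ pγ (≤-trans lt (C.mono (<⇒≤ (<next k (ℓ i) i))))) (C.rec i) lt (cell⇒<colLen pγ lt) (C.below-+ i)

  isCore : IsCore k γ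
  isCore = pγ , nohook
    where
    nohook : ∀ i j → IsCell γ i j → hook γ i j ≢ suc k
    nohook (suc i) (suc j) (_ , _ , lt) eq with part γ (C.below i) ≤? j
    ... | yes le = <-irrefl eq (s≤s (bounded-hook lt le))
    ... | no  nl = <-irrefl (sym eq) (unbounded-hook (≰⇒> nl))

  boundedInRow-core : ∀ i → boundedInRow k γ (suc i) ≡ ℓ i
  boundedInRow-core i = +-cancelʳ-≡ s _ _ (trans (≤-antisym (≮⇒≥ lower) (upper s refl)) (C.rec i))
    where
    s = part γ (C.below i)
    c = boundedInRow k γ (suc i)
    lower : part γ i < c + s → ⊥
    lower lt with s in eq
    ... | zero = <⇒≱ lt (≤-trans (≤-reflexive (+-identityʳ c)) (boundedInRow≤ k pγ i))
    ... | suc s′ = <⇒≱ (unbounded-hook (≤-reflexive (sym eq))) (≤-trans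
           (≤ᵇ⇒≤ _ _ (+countB> (hook-UC k pγ i) (part γ i) z<s
             (≤-trans (≤-reflexive (sym eq)) (C.mono (<⇒≤ (<next k (ℓ i) i))))
             (≤-trans lt (≤-reflexive (+-comm c (suc s′)))))) (n≤1+n k))
    upper : ∀ s′ → s′ ≡ s → part γ i ≤ c + s
    upper s′ eq with s <? part γ i
    ... | no ¬p = ≤-trans (≮⇒≥ ¬p) (m≤n+m s c)
    ... | yes p = s≤s⁻¹ (≤-trans (<+countB (hook-UC k pγ i) (part γ i) z<s p (≤⇒≤ᵇ (bounded-hook p ≤-refl)))
                          (≤-reflexive (cong suc (+-comm s c))))

-- The maps `𝔭` and `𝔠` on lists of parts

fromParts : (ℕ → ℕ) → ℕ → List ℕ
fromParts f m = nonzero (map f (oneTo m))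

module _ {f : ℕ → ℕ} (m : ℕ) (anti : Antitone (f ∘ suc)) (vanish : ∀ {i} → m ≤ i → f (suc i) ≡ 0) where
  private
    xs = map f (oneTo m)

    part-xs : ∀ i → part xs i ≡ f (suc i)
    part-xs i with i <? m
    ... | yes lt = nth-map-oneTo 0 f m lt
    ... | no  ge = trans (nth-≥length 0 xs (≤-trans (≤-reflexive (length-map-oneTo f m)) (≮⇒≥ ge)))
                         (sym (vanish (≮⇒≥ ge)))

    xs-antitone : Antitone (part xs)
    xs-antitone {i} {j} le = subst₂ _≤_ (sym (part-xs j)) (sym (part-xs i)) (anti le)

  part-fromParts : ∀ i → part (fromParts f m) i ≡ f (suc i)
  part-fromParts i = trans (part-nonzero xs xs-antitone i) (part-xs i)

  fromParts-partition : IsPartition (fromParts f m)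
  fromParts-partition = nonzero-partition xs xs-antitone

kBounded : ∀ {k xs} → IsPartition xs → (∀ i → part xs i ≤ k) → KBounded k xs
kBounded p h = p , All-nth (λ i _ → h i)

kBounded-part : ∀ {k xs} → KBounded k xs → ∀ i → part xs i ≤ k
kBounded-part {k} {xs} (_ , b) i with i <? length xs
... | yes lt = nth-All b lt
... | no  ge = ≤-trans (≤-reflexive (nth-≥length 0 xs (≮⇒≥ ge))) z≤n

module _ {k : ℕ} {γ : List ℕ} (core : IsCore k γ) where
  private
    pγ = proj₁ core
    module C = Core (core-rec core)

    vanish : ∀ {i} → length γ ≤ i → boundedInRow k γ (suc i) ≡ 0
    vanish {i} le = n≤0⇒n≡0 (≤-trans (boundedInRow≤ k pγ i) (≤-reflexive (C.vanishing le)))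

  part-𝔭 : ∀ i → part (𝔭 k γ) i ≡ boundedInRow k γ (suc i)
  part-𝔭 = part-fromParts (length γ) C.ℓ-antitone vanish

  𝔭-kBounded : KBounded k (𝔭 k γ)
  𝔭-kBounded = kBounded (fromParts-partition (length γ) C.ℓ-antitone vanish)
    (λ i → subst (_≤ k) (sym (part-𝔭 i)) (C.bounded i))

  core-𝔭 : Core k (part (𝔭 k γ)) (part γ)
  core-𝔭 = record
    { bounded   = kBounded-part 𝔭-kBounded
    ; mono      = C.mono
    ; rec       = λ i → subst (λ x → part γ i ≡ x + part γ (next k x i)) (sym (part-𝔭 i)) (C.rec i)
    ; height    = length γ
    ; vanishing = C.vanishing }

𝔭-unique : ∀ {k ℓs γ} → IsPartition ℓs → IsPartition γ → Core k (part ℓs) (part γ) → 𝔭 k γ ≡ ℓs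
𝔭-unique {k} {ℓs} {γ} pℓ pγ C = partition-ext (proj₁ (𝔭-kBounded core)) pℓ
  (λ i → trans (part-𝔭 core i) (boundedInRow-core pγ C i))
  where core = isCore pγ C

-- The test at shift `s` asks that row `k ∸ x` of `L` not reach column `s`, so the search ends at
-- the length of this row. In the enlarged diagram it is row `next k x 0`, which is the row that the
-- recursion of a core requires.
shiftSearch-least : ∀ k x L {t} → IsPartition L → t ≡ part L (k ∸ x) → x ≤ k →
                    ∀ f {s} → s ≤ t → t ≤ s + f → shiftSearch k x L f s ≡ t
shiftSearch-least k x L pL refl x≤k zero {s} s≤t t≤ = ≤-antisym s≤t (≤-trans t≤ (≤-reflexive (+-identityʳ s)))
shiftSearch-least k x L pL refl x≤k (suc f) {s} s≤t t≤ with x + colLen L (suc s) ≤ᵇ k in eq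
... | true = ≤-antisym s≤t (≮⇒≥ λ lt →
        lin (x ∷ k ∷ k ∸ x ∷ colLen L (suc s) ∷ []) (λ x k d c → x ⊕ c ≼ k ⇒ d ⊕ x ≈ k ⇒ d ≺ c ⇒ ⊢ falsum)
          (≤ᵇ⇒≤ _ _ (subst T (sym eq) _)) (m∸n+n≡m x≤k) (cell⇒<colLen pL lt))
... | false with s <? part L (k ∸ x)
...   | yes lt = shiftSearch-least k x L pL refl x≤k f lt (≤-trans t≤ (≤-reflexive (+-suc s f)))
...   | no  ge = ⊥-elim (subst T eq (≤⇒≤ᵇ (lin (x ∷ k ∷ k ∸ x ∷ colLen L (suc s) ∷ [])
          (λ x k d c → d ⊕ x ≈ k ⇒ c ≼ d ⇒ ⊢ x ⊕ c ≼ k) (m∸n+n≡m x≤k) (≮⇒≥ (ge ∘ <colLen⇒cell pL)))))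

kBounded-tail : ∀ {k x xs} → KBounded k (x ∷ xs) → KBounded k xs
kBounded-tail ((_ ∷ p , l) , _ ∷ b) = (p , Linked.tail l) , b

𝔠-head : ∀ {k x xs} → KBounded k (x ∷ xs) → IsPartition (𝔠 k xs) → part (𝔠 k (x ∷ xs)) 0 ≡ part (𝔠 k xs)
    (k ∸ x) + x
𝔠-head {k} {x} {xs} (_ , x≤k ∷ _) p =
  cong (_+ x) (shiftSearch-least k x (𝔠 k xs) p refl x≤k _ z≤n (part-antitone p z≤n))

𝔠-correct : ∀ {k xs} → KBounded k xs → IsPartition (𝔠 k xs) × Core k (part xs) (part (𝔠 k xs))
𝔠-correct {k} {[]} _ = ([] , []) , record
  { bounded = λ _ → z≤n ; mono = λ _ → z≤n ; rec = λ _ → refl ; height = 0 ; vanishing = λ _ → refl }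
𝔠-correct {k} {x ∷ xs} kb@(((x>0 ∷ _) , l) , (x≤k ∷ _)) with 𝔠-correct (kBounded-tail kb)
... | pL , C = isPartition (≤-trans x>0 (m≤n+m x _) ∷ proj₁ pL) step , record
  { bounded = kBounded-part kb
  ; mono = antitone step
  ; rec = rec
  ; height = suc C.height
  ; vanishing = vanishing }
  where
  module C = Core C
  L = 𝔠 k xs
  head≡ : part (𝔠 k (x ∷ xs)) 0 ≡ part L (k ∸ x) + x
  head≡ = 𝔠-head kb pL
  step : ∀ i → part (𝔠 k (x ∷ xs)) (suc i) ≤ part (𝔠 k (x ∷ xs)) i
  step zero = begin
    part L 0                                     ≡⟨ C.rec 0 ⟩
    part xs 0 + part L (suc (k ∸ part xs 0))     ≤⟨ +-mono-≤ (linked-step l 0)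
        (C.mono (m≤n⇒m≤1+n (∸-monoʳ-≤ k (linked-step l 0)))) ⟩
    x + part L (k ∸ x)                           ≡⟨ +-comm x _ ⟩
    part L (k ∸ x) + x                           ≡⟨ sym head≡ ⟩
    part (𝔠 k (x ∷ xs)) 0                        ∎
    where open ≤-Reasoning
  step (suc i) = C.mono (n≤1+n i)
  rec : ∀ i → part (𝔠 k (x ∷ xs)) i ≡ part (x ∷ xs) i + part (𝔠 k (x ∷ xs)) (next k (part (x ∷ xs) i) i)
  rec zero    = trans head≡ (+-comm _ x)
  rec (suc i) = C.rec i
  vanishing : ∀ {i} → suc C.height ≤ i → part (𝔠 k (x ∷ xs)) i ≡ 0
  vanishing {suc i} (s≤s le) = C.vanishing le

module _ {k : ℕ} {xs : List ℕ} (kb : KBounded k xs) where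

  abstract
    𝔠-partition : IsPartition (𝔠 k xs)
    𝔠-partition = proj₁ (𝔠-correct kb)

    𝔠-core : Core k (part xs) (part (𝔠 k xs))
    𝔠-core = proj₂ (𝔠-correct kb)

    𝔠-isCore : IsCore k (𝔠 k xs)
    𝔠-isCore = isCore 𝔠-partition 𝔠-core

    𝔭𝔠 : 𝔭 k (𝔠 k xs) ≡ xs
    𝔭𝔠 = 𝔭-unique (proj₁ kb) 𝔠-partition 𝔠-core

    -- Column lengths replace the rows of `conj`, so that a strip between two cores can be
    -- transposed cell by cell.
    kconj-core : Core k (part (kconj k xs)) (λ j → colLen (𝔠 k xs) (suc j))
    kconj-core = record
      { bounded   = C.bounded
      ; mono      = colLen-antitone 𝔠-partition
      ; rec       = λ j → subst₂ (λ a b → a ≡ part (kconj k xs) j + b) (pc _) (pc _) (C.rec j)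
      ; height    = C.height
      ; vanishing = λ le → trans (sym (pc _)) (C.vanishing le) }
      where
      C₀ : Core k (part (kconj k xs)) (part (conj (𝔠 k xs)))
      C₀ = core-𝔭 (conj-core 𝔠-isCore)
      module C = Core C₀
      pc : ∀ j → part (conj (𝔠 k xs)) j ≡ colLen (𝔠 k xs) (suc j)
      pc = part-conj 𝔠-partition

-- Strips

sumTo-extend : ∀ {f m} n → (∀ {i} → m ≤ i → f i ≡ 0) → m ≤ n → sumTo f n ≡ sumTo f m
sumTo-extend {f} {m} n z m≤n with m≤n⇒m<n∨m≡n m≤n
... | inj₂ refl = refl
sumTo-extend {f} {m} (suc n) z m≤n | inj₁ (s≤s m≤n′) =
  trans (cong₂ _+_ (sumTo-extend n z m≤n′) (z m≤n′)) (+-identityʳ _)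

T-ext : ∀ {a b} → (T a → T b) → (T b → T a) → a ≡ b
T-ext {false} {false} f g = refl
T-ext {false} {true}  f g = ⊥-elim (g _)
T-ext {true}  {false} f g = ⊥-elim (f _)
T-ext {true}  {true}  f g = refl

∧-intro : ∀ {a b} → T a → T b → T (a ∧ b)
∧-intro {true} {true} _ _ = _

∧-left : ∀ {a b} → T (a ∧ b) → T a
∧-left {true} _ = _

∧-right : ∀ {a b} → T (a ∧ b) → T b
∧-right {true} t = t

indicator-false : ∀ {b} → ¬ T b → indicator b ≡ 0
indicator-false {false} _ = refl
indicator-false {true}  h = ⊥-elim (h _)

-- Bounded cells counted by rows and by columns

boundedCell : ℕ → List ℕ → ℕ → ℕ → Bool
boundedCell k γ i j = (suc j ≤ᵇ part γ i) ∧ (hook γ (suc i) (suc j) ≤ᵇ k)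

module _ {k : ℕ} {γ : List ℕ} (core : IsCore k γ) where

  boundedInRow-sumTo : ∀ i {n} → part γ i ≤ n →
    boundedInRow k γ (suc i) ≡ sumTo (λ j → indicator (boundedCell k γ i j)) n
  boundedInRow-sumTo i {n} le = begin
    boundedInRow k γ (suc i)                                              ≡⟨ countB-sumTo
        (λ j → hook γ (suc i) j ≤ᵇ k) (part γ i) ⟩
    sumTo (λ j → indicator (hook γ (suc i) (suc j) ≤ᵇ k)) (part γ i)      ≡⟨ sumTo-cong (part γ i)
        (λ j lt → cong indicator (T-ext (∧-intro (≤⇒≤ᵇ lt)) (∧-right {suc j ≤ᵇ part γ i}))) ⟩
    sumTo (λ j → indicator (boundedCell k γ i j)) (part γ i)              ≡⟨ sym (sumTo-extend n (λ {j} ge → indicator-false (<⇒≱ (s≤s ge) ∘ ≤ᵇ⇒≤ (suc j) (part γ i) ∘ ∧-left)) le) ⟩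
    sumTo (λ j → indicator (boundedCell k γ i j)) n                       ∎
    where open ≡-Reasoning

  size-𝔭 : ∀ {m n} → length γ ≤ m → part γ 0 ≤ n →
           size (𝔭 k γ) ≡ sumTo (λ i → sumTo (λ j → indicator (boundedCell k γ i j)) n) m
  size-𝔭 {m} {n} lm ln = begin
    size (𝔭 k γ)                                  ≡⟨ size-sumTo (𝔭 k γ) {m + length (𝔭 k γ)} (m≤n+m _ m) ⟩
    sumTo (part (𝔭 k γ)) (m + length (𝔭 k γ))     ≡⟨ sumTo-extend (m + length (𝔭 k γ)) vanish (m≤m+n m _) ⟩
    sumTo (part (𝔭 k γ)) m                        ≡⟨ sumTo-cong m
        (λ i _ → trans (part-𝔭 core i) (boundedInRow-sumTo i (≤-trans (part-antitone (proj₁ core) z≤n) ln))) ⟩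
    sumTo (λ i → sumTo (λ j → indicator (boundedCell k γ i j)) n) m ∎
    where
    open ≡-Reasoning
    vanish : ∀ {i} → m ≤ i → part (𝔭 k γ) i ≡ 0
    vanish {i} le = n≤0⇒n≡0 (≤-trans (Core.ℓ≤ (core-𝔭 core) i) (≤-reflexive (nth-≥length 0 γ (≤-trans lm le))))

boundedCell-conj : ∀ k {γ} → IsPartition γ → ∀ i j → boundedCell k (conj γ) j i ≡ boundedCell k γ i j
boundedCell-conj k {γ} pγ i j = T-ext
  (λ t → let lt = <colLen⇒cell pγ (subst (i <_) (part-conj pγ j) (≤ᵇ⇒≤ (suc i) _ (∧-left t))) in
     ∧-intro (≤⇒≤ᵇ lt) (subst (λ h → T (h ≤ᵇ k)) (hook-conj pγ lt) (∧-right {suc i ≤ᵇ part (conj γ) j} t)))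
  (λ t → let lt = ≤ᵇ⇒≤ (suc j) _ (∧-left t) in
     ∧-intro (≤⇒≤ᵇ (subst (i <_) (sym (part-conj pγ j)) (cell⇒<colLen pγ lt)))
             (subst (λ h → T (h ≤ᵇ k)) (sym (hook-conj pγ lt)) (∧-right {suc j ≤ᵇ part γ i} t)))

-- Conjugation preserves hook lengths, so both sides count the k-bounded cells of `γ`. Hence the two
-- size conditions of an admissible pair amount to one.
size-𝔭-conj : ∀ {k γ} → IsCore k γ → size (𝔭 k (conj γ)) ≡ size (𝔭 k γ)
size-𝔭-conj {k} {γ} core@(pγ , _) = begin
  size (𝔭 k (conj γ))
    ≡⟨ size-𝔭 (conj-core core) {part γ 0} {length γ} (≤-reflexive (length-map-oneTo (colLen γ) (part γ 0)))
         (≤-trans (≤-reflexive (part-conj pγ 0)) (countB≤ _ (length γ))) ⟩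
  sumTo (λ j → sumTo (λ i → indicator (boundedCell k (conj γ) j i)) (length γ)) (part γ 0)
    ≡⟨ sumTo-cong (part γ 0) (λ j _ → sumTo-cong (length γ)
        (λ i _ → cong indicator (boundedCell-conj k pγ i j))) ⟩
  sumTo (λ j → sumTo (λ i → indicator (boundedCell k γ i j)) (length γ)) (part γ 0)
    ≡⟨ sym (sumTo-swap (λ i j → indicator (boundedCell k γ i j)) (length γ) (part γ 0)) ⟩
  sumTo (λ i → sumTo (λ j → indicator (boundedCell k γ i j)) (part γ 0)) (length γ)
    ≡⟨ sym (size-𝔭 core ≤-refl ≤-refl) ⟩
  size (𝔭 k γ) ∎
  where open ≡-Reasoning

size-kconj : ∀ {k xs} → KBounded k xs → size (kconj k xs) ≡ size xs
size-kconj kb = trans (size-𝔭-conj (𝔠-isCore kb)) (cong size (𝔭𝔠 kb))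

countB≥1 : ∀ p m {i} → 1 ≤ i → i ≤ m → T (p i) → 1 ≤ countB p m
countB≥1 p zero (s≤s _) () t
countB≥1 p (suc m) pos le t with m≤n⇒m<n∨m≡n le
... | inj₁ (s≤s le′) = ≤-trans (countB≥1 p m pos le′ t) (m≤m+n _ _)
countB≥1 p (suc m) pos le t | inj₂ refl with p (suc m)
... | true = m≤n+m 1 _

countB≥2 : ∀ p m {i j} → 1 ≤ i → i < j → j ≤ m → T (p i) → T (p j) → 2 ≤ countB p m
countB≥2 p zero pos (s≤s _) () _ _
countB≥2 p (suc m) pos lt le ti tj with m≤n⇒m<n∨m≡n le
... | inj₁ (s≤s le′) = ≤-trans (countB≥2 p m pos lt le′ ti tj) (m≤m+n _ _)
countB≥2 p (suc m) pos (s≤s lt) le ti tj | inj₂ refl with p (suc m)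
... | true = +-monoˡ-≤ 1 (countB≥1 p m pos lt ti)

countB-empty : ∀ p m → (∀ i → 1 ≤ i → i ≤ m → ¬ T (p i)) → countB p m ≡ 0
countB-empty p zero    h = refl
countB-empty p (suc m) h = cong₂ _+_ (countB-empty p m (λ i a b → h i a (m≤n⇒m≤1+n b)))
    (indicator-false (h (suc m) z<s ≤-refl))

countB≤1 : ∀ p m → (∀ i j → 1 ≤ i → i < j → j ≤ m → T (p i) → T (p j) → ⊥) → countB p m ≤ 1
countB≤1 p zero    h = z≤n
countB≤1 p (suc m) h with p (suc m) in eq
... | false = ≤-trans (≤-reflexive (+-identityʳ _)) (countB≤1 p m (λ i j a b c → h i j a b (m≤n⇒m≤1+n c)))
... | true  = ≤-reflexive (cong (_+ 1) (countB-empty p m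
                (λ i a b t → h i (suc m) a (s≤s b) ≤-refl t (subst T (sym eq) _))))

inSkewB-intro : ∀ {μ λ' i j} → row λ' i < j → j ≤ row μ i → T (inSkewB μ λ' i j)
inSkewB-intro a b = ∧-intro (≤⇒≤ᵇ a) (≤⇒≤ᵇ b)

inSkewB-elim : ∀ {μ λ' i j} → T (inSkewB μ λ' i j) → row λ' i < j × j ≤ row μ i
inSkewB-elim {μ} {λ'} {i} {j} t = ≤ᵇ⇒≤ _ _ (∧-left {row λ' i <ᵇ' j} t) , ≤ᵇ⇒≤ _ _ (∧-right {row λ' i <ᵇ' j} t)

module _ {s : ℕ} {μ λ' : List ℕ} where

  hstrip⇒⊆ : HStrip s μ λ' → ∀ i → part λ' i ≤ part μ i
  hstrip⇒⊆ (sub , _ , _) i = sub (suc i)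

  -- Otherwise the column of the last cell of row `suc i` of `μ` would contain strip cells of both
  -- rows.
  hstrip⇒interlaced : IsPartition λ' → IsPartition μ → HStrip s μ λ' → ∀ i → part μ (suc i) ≤ part λ' i
  hstrip⇒interlaced pλ pμ (_ , _ , h) i = ≮⇒≥ λ lt → <⇒≱
    (countB≥2 (λ a → inSkewB μ λ' a (part μ (suc i))) (length μ) {suc i} {suc (suc i)} z<s ≤-refl
      (part>0⇒<length μ (≤-trans z<s lt))
      (inSkewB-intro {μ} {λ'} {suc i} lt (part-antitone pμ (n≤1+n i)))
      (inSkewB-intro {μ} {λ'} {suc (suc i)} (≤-trans (s≤s (part-antitone pλ (n≤1+n i))) lt) ≤-refl))
    (h (part μ (suc i)))

  hstrip : IsPartition λ' → (∀ i → part λ' i ≤ part μ i) → (∀ i → part μ (suc i) ≤ part λ' i) →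
           size μ ≡ size λ' + s → HStrip s μ λ'
  hstrip pλ sub int sz = sub′ , sz , λ j → countB≤1 _ (length μ) (disjoint j)
    where
    sub′ : ∀ i → row λ' i ≤ row μ i
    sub′ zero    = z≤n
    sub′ (suc i) = sub i
    disjoint : ∀ j a b → 1 ≤ a → a < b → b ≤ length μ → T (inSkewB μ λ' a j) → T (inSkewB μ λ' b j) → ⊥
    disjoint j (suc a) (suc (suc b)) _ (s≤s (s≤s a≤b)) _ ta tb = <⇒≱
        (proj₁ (inSkewB-elim {μ} {λ'} {suc a} {j} ta))
      (≤-trans (proj₂ (inSkewB-elim {μ} {λ'} {suc (suc b)} {j} tb)) (≤-trans (int b) (part-antitone pλ a≤b)))

  vstrip⇒⊆ : VStrip s μ λ' → ∀ i → part λ' i ≤ part μ i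
  vstrip⇒⊆ (sub , _ , _) i = sub (suc i)

  vstrip : (∀ i → part λ' i ≤ part μ i) → (∀ i → part μ i ≤ suc (part λ' i)) →
           size μ ≡ size λ' + s → VStrip s μ λ'
  vstrip sub le sz = sub′ , sz , λ i → countB≤1 _ (row μ i) (disjoint i)
    where
    sub′ : ∀ i → row λ' i ≤ row μ i
    sub′ zero    = z≤n
    sub′ (suc i) = sub i
    disjoint : ∀ i a b → 1 ≤ a → a < b → b ≤ row μ i → T (inSkewB μ λ' i a) → T (inSkewB μ λ' i b) → ⊥
    disjoint zero    (suc a) (suc b) _ _   () _ _
    disjoint (suc i) a       b       _ a<b _ ta tb = <⇒≱ a<b (≤-trans (proj₂ (inSkewB-elim {μ} {λ'} {suc i} tb))
      (≤-trans (le i) (proj₁ (inSkewB-elim {μ} {λ'} {suc i} ta))))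

-- Comparison of two cores and of their bounded partitions

core-tail : ∀ {k ℓ g} → Core k ℓ g → Core k (ℓ ∘ suc) (g ∘ suc)
core-tail C = record
  { bounded = C.bounded ∘ suc ; mono = λ le → C.mono (s≤s le) ; rec = C.rec ∘ suc
  ; height = C.height ; vanishing = C.vanishing ∘ m≤n⇒m≤1+n }
  where module C = Core C

module _ {k : ℕ} {ℓ g m h : ℕ → ℕ} (C : Core k ℓ g) (D : Core k m h) where
  private
    module C = Core C
    module D = Core D

  -- Interlacing is containment of a core deprived of its first row, which is again a core.
  core-interlaced : (∀ i → m (suc i) ≤ ℓ i) → ∀ i → h (suc i) ≤ g i
  core-interlaced = core-mono (core-tail D) C

  -- Here and in `data-vertical`, too large a part of `m` makes the recursion of `h` refer to a row
  -- no later than that of `g`, where `h` is at least as long. One step of the recursion then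
  -- carries the violation over to the cores.
  data-interlaced : (∀ i → g i ≤ h i) → (∀ i → h (suc i) ≤ g i) → ∀ i → m (suc i) ≤ ℓ i
  data-interlaced sub int i = ≮⇒≥ λ lt →
    let A = C.below i ; B = D.below (suc i)
        B≤A = lin (i ∷ k ∷ ℓ i ∷ m (suc i) ∷ A ∷ B ∷ [])
            (λ i k l m a b → l ≺ m ⇒ l ⊕ a ≈ i ⊕ (con 1 ⊕ k) ⇒ m ⊕ b ≈ con 1 ⊕ i ⊕ (con 1 ⊕ k) ⇒ ⊢ b ≼ a)
                lt (C.below-+ i) (D.below-+ (suc i)) in
    lin (ℓ i ∷ m (suc i) ∷ g i ∷ h (suc i) ∷ g A ∷ h A ∷ h B ∷ [])
      (λ l m gi hi ga ha hb → l ≺ m ⇒ hi ≼ gi ⇒ gi ≈ l ⊕ ga ⇒ hi ≈ m ⊕ hb ⇒ ha ≼ hb ⇒ ga ≼ ha ⇒ ⊢ falsum)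
      lt (int i) (C.rec i) (D.rec (suc i)) (D.mono B≤A) (sub A)

  data-vertical : (∀ i → g i ≤ h i) → (∀ i → h i ≤ suc (g i)) → ∀ i → m i ≤ suc (ℓ i)
  data-vertical sub ver i = ≮⇒≥ λ lt →
    let A = C.below i ; B = D.below i
        B≤A = lin (i ∷ k ∷ ℓ i ∷ m i ∷ A ∷ B ∷ [])
            (λ i k l m a b → con 1 ⊕ l ≺ m ⇒ l ⊕ a ≈ i ⊕ (con 1 ⊕ k) ⇒ m ⊕ b ≈ i ⊕ (con 1 ⊕ k) ⇒ ⊢ b ≼ a)
                lt (C.below-+ i) (D.below-+ i) in
    lin (ℓ i ∷ m i ∷ g i ∷ h i ∷ g A ∷ h A ∷ h B ∷ [])
      (λ l m gi hi ga ha hb → con 1 ⊕ l ≺ m ⇒ hi ≼ con 1 ⊕ gi ⇒ gi ≈ l ⊕ ga ⇒ hi ≈ m ⊕ hb ⇒ ha ≼ hb ⇒ ga ≼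
          ha ⇒ ⊢ falsum)
      lt (ver i) (C.rec i) (D.rec i) (D.mono B≤A) (sub A)

  -- Containment of the cores is not enough: for k = 2 the core (2,1,1) of (1,1,1) contains the core
  -- (2) of (2). If `m i < ℓ i`, then `D.below i` comes after `C.below i`, and interlacing bounds
  -- `h` there by `g (C.below i)`.
  data-⊆ : (∀ i → g i ≤ h i) → (∀ i → h (suc i) ≤ g i) → ∀ i → ℓ i ≤ m i
  data-⊆ sub int i = ≮⇒≥ λ lt →
    let A = C.below i ; B = D.below i
        A<B = lin (i ∷ k ∷ ℓ i ∷ m i ∷ A ∷ B ∷ [])
            (λ i k l m a b → m ≺ l ⇒ l ⊕ a ≈ i ⊕ (con 1 ⊕ k) ⇒ m ⊕ b ≈ i ⊕ (con 1 ⊕ k) ⇒ ⊢ a ≺ b)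
                lt (C.below-+ i) (D.below-+ i) in
    lin (ℓ i ∷ m i ∷ g i ∷ h i ∷ g A ∷ h (suc A) ∷ h B ∷ [])
      (λ l m gi hi ga ha hb → m ≺ l ⇒ gi ≼ hi ⇒ gi ≈ l ⊕ ga ⇒ hi ≈ m ⊕ hb ⇒ hb ≼ ha ⇒ ha ≼ ga ⇒ ⊢ falsum)
      lt (sub i) (C.rec i) (D.rec i) (D.mono A<B) (int A)

module _ {λ' μ : List ℕ} (pλ : IsPartition λ') (pμ : IsPartition μ) where

  colLen-mono : (∀ i → part λ' i ≤ part μ i) → ∀ j → colLen λ' (suc j) ≤ colLen μ (suc j)
  colLen-mono sub j = ≮⇒≥ λ lt → <-irrefl refl (cell⇒<colLen pμ (≤-trans (<colLen⇒cell pλ lt) (sub _)))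

  colLen-vertical : (∀ i → part μ (suc i) ≤ part λ' i) → ∀ j → colLen μ (suc j) ≤ suc (colLen λ' (suc j))
  colLen-vertical int j = ≮⇒≥ λ lt → <-irrefl refl (cell⇒<colLen pλ (≤-trans (<colLen⇒cell pμ lt) (int _)))

  colLen-interlaced : (∀ i → part μ i ≤ suc (part λ' i)) → ∀ j → colLen μ (suc (suc j)) ≤ colLen λ' (suc j)
  colLen-interlaced ver j = ≮⇒≥ λ lt →
    <-irrefl refl (cell⇒<colLen pλ (s≤s⁻¹ (≤-trans (<colLen⇒cell pμ lt) (ver _))))

module _ {k : ℕ} {λ' μ : List ℕ} (kλ : KBounded k λ') (kμ : KBounded k μ)
         (sub : ∀ i → part (𝔠 k λ') i ≤ part (𝔠 k μ) i) where
  private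
    pγ = 𝔠-partition kλ
    pδ = 𝔠-partition kμ

  -- `data-⊆` for the transposed cores, whose interlacing means that the strip has at most one cell
  -- in each row. A removal of one residue has this property, the strip of a whole letter usually
  -- not; therefore `admissible` takes the containment of the k-conjugates as a hypothesis, to be
  -- composed from single removals.
  kconj-⊆ : (∀ i → part (𝔠 k μ) i ≤ suc (part (𝔠 k λ') i)) → ∀ j → part (kconj k λ') j ≤ part (kconj k μ) j
  kconj-⊆ ver = data-⊆ (kconj-core kλ) (kconj-core kμ) (colLen-mono pγ pδ sub) (colLen-interlaced pγ pδ ver)

  kconj-vertical : (∀ i → part (𝔠 k μ) (suc i) ≤ part (𝔠 k λ') i) → ∀ j → part (kconj k μ) j ≤ suc
      (part (kconj k λ') j)
  kconj-vertical int = data-vertical (kconj-core kλ) (kconj-core kμ) (colLen-mono pγ pδ sub)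
      (colLen-vertical pγ pδ int)

  admissible : ∀ {s} → (∀ i → part (𝔠 k μ) (suc i) ≤ part (𝔠 k λ') i) →
               (∀ j → part (kconj k λ') j ≤ part (kconj k μ) j) → size μ ≡ size λ' + s → Admissible k s μ λ'
  admissible {s} int ω⊆ sz = kμ , kλ
    , hstrip (proj₁ kλ) (data-⊆ (𝔠-core kλ) (𝔠-core kμ) sub int)
        (data-interlaced (𝔠-core kλ) (𝔠-core kμ) sub int) sz
    , vstrip ω⊆ (kconj-vertical int)
        (trans (size-kconj kμ) (trans sz (cong (_+ s) (sym (size-kconj kλ)))))

module _ {k s : ℕ} {μ λ' : List ℕ} (adm : Admissible k s μ λ') where
  private
    kμ = proj₁ adm
    kλ = proj₁ (proj₂ adm)
    h  = proj₁ (proj₂ (proj₂ adm))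
    v  = proj₂ (proj₂ (proj₂ adm))

  admissible⇒data-⊆ : ∀ i → part λ' i ≤ part μ i
  admissible⇒data-⊆ = hstrip⇒⊆ {s} {μ} {λ'} h

  admissible⇒data-interlaced : ∀ i → part μ (suc i) ≤ part λ' i
  admissible⇒data-interlaced = hstrip⇒interlaced {s} {μ} {λ'} (proj₁ kλ) (proj₁ kμ) h

  admissible⇒⊆ : ∀ i → part (𝔠 k λ') i ≤ part (𝔠 k μ) i
  admissible⇒⊆ = core-mono (𝔠-core kλ) (𝔠-core kμ) admissible⇒data-⊆

  admissible⇒interlaced : ∀ i → part (𝔠 k μ) (suc i) ≤ part (𝔠 k λ') i
  admissible⇒interlaced = core-interlaced (𝔠-core kλ) (𝔠-core kμ) admissible⇒data-interlaced

  admissible⇒kconj-⊆ : ∀ j → part (kconj k λ') j ≤ part (kconj k μ) j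
  admissible⇒kconj-⊆ = vstrip⇒⊆ {s} {kconj k μ} {kconj k λ'} v

  admissible⇒size : size μ ≡ size λ' + s
  admissible⇒size = proj₁ (proj₂ h)

-- Removing the cells of one residue

module _ (k : ℕ) where

  -- The equation says that the content of the first cell exceeds that of the second by `m * suc k`,
  -- in a form without subtraction. `residue-≡` is the way back from residues to contents.
  residue-shift : ∀ i c i′ c′ m → c + i′ ≡ c′ + i + m * suc k → residue k (suc i) c ≡ residue k (suc i′) c′
  residue-shift i c i′ c′ m eq = begin
    (c + k * suc i) % suc k                           ≡⟨ sym ([m+kn]%n≡m%n (c + k * suc i) i′ (suc k)) ⟩
    (c + k * suc i + i′ * suc k) % suc k              ≡⟨ cong (_% suc k)
        (trans (lemma₁ c i i′ k) (trans (cong (_+ k * (suc i + i′)) eq) (lemma₂ c′ i i′ m k))) ⟩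
    (c′ + k * suc i′ + (i + m) * suc k) % suc k       ≡⟨ [m+kn]%n≡m%n (c′ + k * suc i′) (i + m) (suc k) ⟩
    (c′ + k * suc i′) % suc k                         ∎
    where
    open ≡-Reasoning
    lemma₁ : ∀ c i i′ k → c + k * suc i + i′ * suc k ≡ c + i′ + k * (suc i + i′)
    lemma₁ = solve-∀
    lemma₂ : ∀ c′ i i′ m k → c′ + i + m * suc k + k * (suc i + i′) ≡ c′ + k * suc i′ + (i + m) * suc k
    lemma₂ = solve-∀

  residue-≡ : ∀ i c i′ c′ → residue k (suc i) c ≡ residue k (suc i′) c′ → c′ + i ≤ c + i′ →
              ∃ λ m → c + i′ ≡ c′ + i + m * suc k
  residue-≡ i c i′ c′ eq le =
    quotient (x % n) (x / n) (y / n) (m≡m%n+[m/n]*n x n)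
      (trans (m≡m%n+[m/n]*n y n) (cong (_+ y / n * n) (sym eq)))
    where
    n = suc k
    x = c + k * suc i
    y = c′ + k * suc i′
    lemma₁ : ∀ r q i′ n → r + q * n + i′ * n ≡ r + (q + i′) * n
    lemma₁ = solve-∀
    lemma₂ : ∀ c i c′ i′ k → c + k * suc i + i′ * suc k + (c′ + i) ≡ c′ + k * suc i′ + i * suc k + (c + i′)
    lemma₂ = solve-∀
    quotient : ∀ r p q → x ≡ r + p * n → y ≡ r + q * n → ∃ λ m → c + i′ ≡ c′ + i + m * n
    -- Since `k * suc i` is `suc i * suc k` less `suc i`, the quotients of `x` and `y` are off from
    -- those of the contents by the row numbers; `a` and `b` correct this.
    quotient r p q xeq yeq = a ∸ b , (begin
      c + i′                           ≡⟨ cancelled (a * n) (b * n) (a * n ∸ b * n) both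
          (m∸n+n≡m (b≤a (a * n) (b * n) both)) ⟩
      c′ + i + (a * n ∸ b * n)         ≡⟨ cong (c′ + i +_) (sym (*-distribʳ-∸ n a b)) ⟩
      c′ + i + (a ∸ b) * n             ∎)
      where
      open ≡-Reasoning
      a = p + i′
      b = q + i
      both : r + a * n + (c′ + i) ≡ r + b * n + (c + i′)
      both = begin
        r + a * n + (c′ + i)           ≡⟨ cong (_+ (c′ + i))
            (sym (trans (cong (_+ i′ * n) xeq) (lemma₁ r p i′ n))) ⟩
        x + i′ * n + (c′ + i)          ≡⟨ lemma₂ c i c′ i′ k ⟩
        y + i * n + (c + i′)           ≡⟨ cong (_+ (c + i′)) (trans (cong (_+ i * n) yeq) (lemma₁ r q i n)) ⟩
        r + b * n + (c + i′)           ∎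
      b≤a : ∀ A B → r + A + (c′ + i) ≡ r + B + (c + i′) → B ≤ A
      b≤a A B eq = lin (r ∷ A ∷ B ∷ c ∷ i ∷ c′ ∷ i′ ∷ []) (λ r a b c i c′ i′ →
            r ⊕ a ⊕ (c′ ⊕ i) ≈ r ⊕ b ⊕ (c ⊕ i′) ⇒ c′ ⊕ i ≼ c ⊕ i′ ⇒ ⊢ b ≼ a) eq le
      cancelled : ∀ A B D → r + A + (c′ + i) ≡ r + B + (c + i′) → D + B ≡ A → c + i′ ≡ c′ + i + D
      cancelled A B D eq = lin (r ∷ A ∷ B ∷ D ∷ c ∷ i ∷ c′ ∷ i′ ∷ []) (λ r a b d c i c′ i′ →
            r ⊕ a ⊕ (c′ ⊕ i) ≈ r ⊕ b ⊕ (c ⊕ i′) ⇒ d ⊕ b ≈ a ⇒ ⊢ c ⊕ i′ ≈ c′ ⊕ i ⊕ d) eq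

  residue-suc≢ : 1 ≤ k → ∀ {i c} → residue k (suc i) (suc c) ≢ residue k (suc i) c
  residue-suc≢ 1≤k {i} {c} eq = not-multiple (proj₁ q) (proj₂ q)
    where
    q = residue-≡ i (suc c) i c eq (n≤1+n _)
    not-multiple : ∀ m → suc (c + i) ≡ c + i + m * suc k → ⊥
    not-multiple zero    p = lin (c ∷ i ∷ []) (λ c i → con 1 ⊕ (c ⊕ i) ≈ c ⊕ i ⊕ con 0 ⇒ ⊢ falsum) p
    not-multiple (suc m) p = lin (c ∷ i ∷ m * suc k ∷ k ∷ [])
      (λ c i x k → con 1 ⊕ (c ⊕ i) ≈ c ⊕ i ⊕ (con 1 ⊕ k ⊕ x) ⇒ con 1 ≼ k ⇒ ⊢ falsum) p 1≤k

  residue-up≢ : 1 ≤ k → ∀ {i c} → 1 ≤ c → residue k (suc (suc i)) c ≢ residue k (suc i) c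
  residue-up≢ 1≤k {i} {suc c} _ eq = residue-suc≢ 1≤k {i} {c}
    (trans (sym eq) (residue-shift (suc i) (suc c) i c 0
      (lin (c ∷ i ∷ []) (λ c i → ⊢ con 1 ⊕ (c ⊕ i) ≈ c ⊕ (con 1 ⊕ i) ⊕ con 0))))

Removable : ℕ → ℕ → (ℕ → ℕ) → ℕ → Set
Removable k r g i = g (suc i) < g i × residue k (suc i) (g i) ≡ r

module _ {k : ℕ} {ℓ g : ℕ → ℕ} (C : Core k ℓ g) where
  private
    module C = Core C
    n = suc k
  open C using (below)

  bead-below : ∀ i → g i + below i ≡ g (below i) + i + n
  bead-below i = lin (g i ∷ ℓ i ∷ below i ∷ g (below i) ∷ i ∷ k ∷ [])
    (λ gi l b gb i k → gi ≈ l ⊕ gb ⇒ l ⊕ b ≈ i ⊕ (con 1 ⊕ k) ⇒ ⊢ gi ⊕ b ≈ gb ⊕ i ⊕ (con 1 ⊕ k))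
    (C.rec i) (C.below-+ i)

  residue-below : ∀ i → residue k (suc (below i)) (g (below i)) ≡ residue k (suc i) (g i)
  residue-below i = sym (residue-shift k i (g i) (below i) (g (below i)) 1
      (trans (bead-below i) (cong (g (below i) + i +_) (sym (*-identityˡ n)))))

  orbit : ∀ m i → ∃ λ e → g i + e ≡ g e + i + m * n
  orbit zero    i = i , sym (+-identityʳ _)
  orbit (suc m) i with orbit m (below i)
  ... | e , p = e , lin (g i ∷ e ∷ g e ∷ i ∷ k ∷ m * n ∷ below i ∷ g (below i) ∷ [])
      (λ gi e ge i k mn b gb → gi ⊕ b ≈ gb ⊕ i ⊕ (con 1 ⊕ k) ⇒ gb ⊕ e ≈ ge ⊕ b ⊕ mn ⇒ ⊢ gi ⊕ e ≈ ge ⊕ i ⊕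
          (con 1 ⊕ k ⊕ mn))
      (bead-below i) p

  bead-injective : ∀ {i e} → g i + e ≡ g e + i → i ≡ e
  bead-injective {i} {e} eq with <-cmp i e
  ... | tri≈ _ p _ = p
  ... | tri< lt _ _ = ⊥-elim (lin (g i ∷ e ∷ g e ∷ i ∷ [])
      (λ gi e ge i → gi ⊕ e ≈ ge ⊕ i ⇒ i ≺ e ⇒ ge ≼ gi ⇒ ⊢ falsum) eq lt (C.mono (<⇒≤ lt)))
  ... | tri> _ _ gt = ⊥-elim (lin (g i ∷ e ∷ g e ∷ i ∷ [])
      (λ gi e ge i → gi ⊕ e ≈ ge ⊕ i ⇒ e ≺ i ⇒ gi ≼ ge ⇒ ⊢ falsum) eq gt (C.mono (<⇒≤ gt)))

  -- Rows `i` and `suc i` of equal length are beads on adjacent positions. In a core both positions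
  -- lowered by k+1 carry beads too, and these are again adjacent.
  flat-below : ∀ {i} → g i ≤ g (suc i) → g (below i) ≤ g (suc (below i))
  flat-below {i} le = ≤-trans (lin (g i ∷ g (suc i) ∷ ℓ i ∷ ℓ (suc i) ∷ g A ∷ g B ∷ [])
      (λ gi gi′ l l′ ga gb → gi ≼ gi′ ⇒ gi ≈ l ⊕ ga ⇒ gi′ ≈ l′ ⊕ gb ⇒ l′ ≼ l ⇒ ⊢ ga ≼ gb)
      le (C.rec i) (C.rec (suc i)) (C.ℓ-antitone (n≤1+n i)))
    (C.mono (lin (i ∷ k ∷ ℓ i ∷ ℓ (suc i) ∷ A ∷ B ∷ [])
      (λ i k l l′ a b → l ⊕ a ≈ i ⊕ (con 1 ⊕ k) ⇒ l′ ⊕ b ≈ con 1 ⊕ i ⊕ (con 1 ⊕ k) ⇒ l′ ≼ l ⇒ ⊢ con 1 ⊕ a ≼ b)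
      (C.below-+ i) (C.below-+ (suc i)) (C.ℓ-antitone (n≤1+n i))))
    where
    A = below i
    B = below (suc i)

  flat-orbit : ∀ m {i e} → g i + e ≡ g e + i + m * n → g i ≤ g (suc i) → g e ≤ g (suc e)
  flat-orbit zero    {i} {e} eq le with bead-injective {i} {e} (trans eq (+-identityʳ _))
  ... | refl = le
  flat-orbit (suc m) {i} {e} eq le = flat-orbit m {below i}
    (lin (g i ∷ e ∷ g e ∷ i ∷ k ∷ m * n ∷ below i ∷ g (below i) ∷ [])
      (λ gi e ge i k mn b gb → gi ⊕ b ≈ gb ⊕ i ⊕ (con 1 ⊕ k) ⇒ gi ⊕ e ≈ ge ⊕ i ⊕ (con 1 ⊕ k ⊕ mn) ⇒ ⊢ gb ⊕ e
          ≈ ge ⊕ b ⊕ mn)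
      (bead-below i) eq)
    (flat-below le)

  -- Otherwise the bead further to the right, moved down by multiples of k+1, would end
  -- strictly between two consecutive beads.
  no-addable : ∀ {r i j} → Removable k r g j → (∀ e → e < i → g i < g e) → residue k (suc i) (suc (g i)) ≢ r
  no-addable {r} {i} {j} (lt , rj) above ri = go (≤-total (suc (g i) + j) (g j + i))
    where
    right : ∀ m → g j + i ≡ suc (g i) + j + m * n → ∀ e → g j + e ≡ g e + j + m * n → ⊥
    right m p e q with i ≤? e
    ... | yes i≤e = lin (i ∷ j ∷ e ∷ g i ∷ g j ∷ g e ∷ m * n ∷ [])
      (λ i j e gi gj ge mn → gj ⊕ i ≈ con 1 ⊕ gi ⊕ j ⊕ mn ⇒ gj ⊕ e ≈ ge ⊕ j ⊕ mn ⇒ i ≼ e ⇒ ge ≼ gi ⇒ ⊢ falsum)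
      p q i≤e (C.mono i≤e)
    ... | no i≰e = lin (i ∷ j ∷ e ∷ g i ∷ g j ∷ g e ∷ m * n ∷ [])
      (λ i j e gi gj ge mn → gj ⊕ i ≈ con 1 ⊕ gi ⊕ j ⊕ mn ⇒ gj ⊕ e ≈ ge ⊕ j ⊕ mn ⇒ e ≺ i ⇒ gi ≺ ge ⇒ ⊢ falsum)
      p q (≰⇒> i≰e) (above e (≰⇒> i≰e))
    left : ∀ m → suc (g i) + j ≡ g j + i + m * n → ∀ e → g i + e ≡ g e + i + m * n → ⊥
    left m p e q with e ≤? j
    ... | yes e≤j = lin (i ∷ j ∷ e ∷ g i ∷ g j ∷ g e ∷ m * n ∷ [])
      (λ i j e gi gj ge mn → con 1 ⊕ gi ⊕ j ≈ gj ⊕ i ⊕ mn ⇒ gi ⊕ e ≈ ge ⊕ i ⊕ mn ⇒ e ≼ j ⇒ gj ≼ ge ⇒ ⊢ falsum)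
      p q e≤j (C.mono e≤j)
    ... | no e≰j = lin (i ∷ j ∷ e ∷ g i ∷ g j ∷ g e ∷ g (suc j) ∷ m * n ∷ [])
      (λ i j e gi gj ge gj′ mn → con 1 ⊕ gi ⊕ j ≈ gj ⊕ i ⊕ mn ⇒ gi ⊕ e ≈ ge ⊕ i ⊕ mn ⇒ j ≺ e ⇒ ge ≼ gj′ ⇒
          gj′ ≺ gj ⇒ ⊢ falsum)
      p q (≰⇒> e≰j) (C.mono (≰⇒> e≰j)) lt
    go : suc (g i) + j ≤ g j + i ⊎ g j + i ≤ suc (g i) + j → ⊥
    go (inj₁ le) = let (m , p) = residue-≡ k j (g j) i (suc (g i)) (trans rj (sym ri)) le
                       (e , q) = orbit m j in right m p e q
    go (inj₂ le) = let (m , p) = residue-≡ k i (suc (g i)) j (g j) (trans ri (sym rj)) le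
                       (e , q) = orbit m i in left m p e q

lower : ∀ {P : Set} → Dec P → ℕ → ℕ
lower (yes _) x = pred x
lower (no _)  x = x

lower≤ : ∀ {P : Set} (d : Dec P) x → lower d x ≤ x
lower≤ (yes _) x = pred[n]≤n
lower≤ (no _)  x = ≤-refl

lower-yes : ∀ {P : Set} (d : Dec P) {x} → P → 1 ≤ x → suc (lower d x) ≡ x
lower-yes (yes _) {suc x} p _ = refl
lower-yes (no ¬p) p _ = ⊥-elim (¬p p)

lower-no : ∀ {P : Set} (d : Dec P) {x} → ¬ P → lower d x ≡ x
lower-no (yes p) ¬p = ⊥-elim (¬p p)
lower-no (no _)  ¬p = refl

-- At most one summand is lowered. The index is returned as well, because `no-addable` later asks
-- for an actual removable cell.
sumTo-lower : ∀ {P : ℕ → Set} (d : ∀ i → Dec (P i)) f → (∀ {i} → P i → 1 ≤ f i) →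
              (∀ {i j} → i < j → P i → P j → ⊥) → ∀ m →
              (∃ λ i → i < m × P i × sumTo f m ≡ suc (sumTo (λ i → lower (d i) (f i)) m))
              ⊎ sumTo f m ≡ sumTo (λ i → lower (d i) (f i)) m
sumTo-lower d f pos unique zero = inj₂ refl
sumTo-lower d f pos unique (suc m) with sumTo-lower d f pos unique m | d m
... | inj₁ (i , lt , p , eq) | yes q = ⊥-elim (unique lt p q)
... | inj₁ (i , lt , p , eq) | no ¬q = inj₁ (i , m<n⇒m<1+n lt , p , cong (_+ f m) eq)
... | inj₂ eq | no ¬q = inj₂ (cong (_+ f m) eq)
... | inj₂ eq | yes q = inj₁ (m , ≤-refl , q , (begin
    sumTo f m + f m                                   ≡⟨ cong₂ _+_ eq
        (sym (suc-pred (f m) {{>-nonZero (pos q)}})) ⟩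
    sumTo f′ m + suc (pred (f m))                     ≡⟨ +-suc _ _ ⟩
    suc (sumTo f′ m + pred (f m))                     ∎))
    where open ≡-Reasoning
          f′ = λ i → lower (d i) (f i)

module _ {k : ℕ} {ℓ g : ℕ → ℕ} (1≤k : 1 ≤ k) (C : Core k ℓ g) (r : ℕ) where
  private
    module C = Core C
    Rem = Removable k r g
  open C using (below)

  removable? : ∀ i → Dec (Rem i)
  removable? i = (g (suc i) <? g i) ×-dec (residue k (suc i) (g i) ≟ r)

  -- Removing the cells of residue r moves the beads of their rows down by one. This lowers the
  -- number of bounded cells only in the row whose bead moves while the bead k+1 below it stays.
  Topmost : ℕ → Set
  Topmost i = Rem i × ¬ Rem (below i)

  topmost? : ∀ i → Dec (Topmost i)
  topmost? i = removable? i ×-dec ¬? (removable? (below i))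

  topmost-flat : ∀ {i} → Topmost i → g (below i) ≤ g (suc (below i))
  topmost-flat {i} ((_ , ri) , ¬rem) = ≮⇒≥ λ lt → ¬rem (lt , trans (residue-below C i) ri)

  -- The bead of row `j` is obtained from that of row `i` by positive multiples of k+1. Row
  -- `below i` is flat, flatness descends along the orbit to row `j`, and a flat row has no
  -- removable cell.
  topmost-unique : ∀ {i j} → i < j → Topmost i → Topmost j → ⊥
  topmost-unique {i} {j} i<j ti@((_ , ri) , _) ((gj , rj) , _) = go (proj₁ q) (proj₂ q)
    where
    q = residue-≡ k i (g i) j (g j) (trans ri (sym rj)) (+-mono-≤ (C.mono (<⇒≤ i<j)) (<⇒≤ i<j))
    go : ∀ m → g i + j ≡ g j + i + m * suc k → ⊥
    go zero    p = <-irrefl (bead-injective C {i} {j} (trans p (+-identityʳ _))) i<j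
    go (suc m) p = <⇒≱ gj (flat-orbit C m {below i} {j}
      (lin (g i ∷ j ∷ g j ∷ i ∷ k ∷ m * suc k ∷ below i ∷ g (below i) ∷ [])
        (λ gi e ge i k mn b gb → gi ⊕ b ≈ gb ⊕ i ⊕ (con 1 ⊕ k) ⇒ gi ⊕ e ≈ ge ⊕ i ⊕ (con 1 ⊕ k ⊕ mn) ⇒ ⊢ gb ⊕
            e ≈ ge ⊕ b ⊕ mn)
        (bead-below C i) p) (topmost-flat ti))

  topmost-positive : ∀ {i} → Topmost i → 1 ≤ ℓ i
  topmost-positive {i} ((lt , _) , _) = ≮⇒≥ λ ℓ<1 →
    lin (g i ∷ g (suc i) ∷ ℓ i ∷ g (below i) ∷ [])
        (λ gi gi′ l gb → gi′ ≺ gi ⇒ gi ≈ l ⊕ gb ⇒ l ≺ con 1 ⇒ gb ≼ gi′ ⇒ ⊢ falsum)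
      lt (C.rec i) ℓ<1 (C.mono (<next k (ℓ i) i))

  removed lowered : ℕ → ℕ
  removed i = lower (removable? i) (g i)
  lowered i = lower (topmost? i) (ℓ i)

  removed-yes : ∀ {i} → Rem i → suc (removed i) ≡ g i
  removed-yes {i} rem@(lt , _) = lower-yes (removable? i) rem (≤-trans z<s lt)

  removed-no : ∀ {i} → ¬ Rem i → removed i ≡ g i
  removed-no {i} = lower-no (removable? i)

  removed-antitone : ∀ i → removed (suc i) ≤ removed i
  removed-antitone i with removable? i
  ... | yes (lt , _) = ≤-trans (lower≤ (removable? (suc i)) _)
      (≤-pred (≤-trans lt (≤-reflexive (sym (suc-pred (g i) {{>-nonZero (≤-trans z<s lt)}})))))
  ... | no _ = ≤-trans (lower≤ (removable? (suc i)) _) (C.mono (n≤1+n i))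

  -- Unless row `i` is topmost, its bead and the bead k+1 below either both move or both stay. For a
  -- topmost row only the upper bead moves; since row `below i` is flat, the position k+1 below the
  -- moved bead is already occupied by the next row, and the part drops by one.
  removed-rec : ∀ i → removed i ≡ lowered i + removed (next k (lowered i) i)
  removed-rec i = go (removable? i) (removable? (below i))
    where
    A = below i
    goal = removed i ≡ lowered i + removed (next k (lowered i) i)
    unchanged : ¬ Topmost i → removed i ≡ ℓ i + removed A → goal
    unchanged ¬top eq = subst (λ x → removed i ≡ x + removed (next k x i)) (sym (lower-no (topmost? i) ¬top)) eq
    go : Dec (Rem i) → Dec (Rem A) → goal
    go (yes p) (yes q) = unchanged (λ t → proj₂ t q)
      (lin (removed i ∷ g i ∷ ℓ i ∷ removed A ∷ g A ∷ []) (λ ri gi l ra ga →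
        con 1 ⊕ ri ≈ gi ⇒ con 1 ⊕ ra ≈ ga ⇒ gi ≈ l ⊕ ga ⇒ ⊢ ri ≈ l ⊕ ra)
        (removed-yes p) (removed-yes q) (C.rec i))
    go (no ¬p) _ = unchanged (¬p ∘ proj₁)
      (trans (removed-no ¬p) (trans (C.rec i) (cong (ℓ i +_) (sym (removed-no ¬remA)))))
      where
      ¬remA : ¬ Rem A
      ¬remA (lt , rA) = <⇒≱ lt (flat-below C (≮⇒≥ λ lt′ → ¬p (lt′ , trans (sym (residue-below C i)) rA)))
    go (yes p) (no ¬q) = begin
      removed i                                       ≡⟨ removed-i ⟩
      lowered i + g (suc A)                           ≡⟨ cong (lowered i +_) (sym (removed-no ¬remA′)) ⟩
      lowered i + removed (suc A)                     ≡⟨ cong (λ b → lowered i + removed b) (sym next≡) ⟩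
      lowered i + removed (next k (lowered i) i)      ∎
      where
      open ≡-Reasoning
      top : Topmost i
      top = p , ¬q
      flat : g A ≡ g (suc A)
      flat = ≤-antisym (topmost-flat top) (C.mono (n≤1+n A))
      lowered-i : suc (lowered i) ≡ ℓ i
      lowered-i = lower-yes (topmost? i) top (topmost-positive top)
      removed-i : removed i ≡ lowered i + g (suc A)
      removed-i = lin (removed i ∷ g i ∷ ℓ i ∷ lowered i ∷ g A ∷ g (suc A) ∷ []) (λ ri gi l l′ ga ga′ →
        con 1 ⊕ ri ≈ gi ⇒ gi ≈ l ⊕ ga ⇒ con 1 ⊕ l′ ≈ l ⇒ ga ≈ ga′ ⇒ ⊢ ri ≈ l′ ⊕ ga′)
        (removed-yes p) (C.rec i) lowered-i flat
      next≡ : next k (lowered i) i ≡ suc A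
      next≡ = lin (next k (lowered i) i ∷ A ∷ lowered i ∷ ℓ i ∷ i ∷ k ∷ []) (λ b a l′ l i k →
        l′ ⊕ b ≈ i ⊕ (con 1 ⊕ k) ⇒ l ⊕ a ≈ i ⊕ (con 1 ⊕ k) ⇒ con 1 ⊕ l′ ≈ l ⇒ ⊢ b ≈ con 1 ⊕ a)
        (next-+ (≤-trans (lower≤ (topmost? i) (ℓ i)) (C.bounded i)) i) (C.below-+ i) lowered-i
      -- The last cell of row `suc A` lies directly above that of row `A`, which has residue `r`; as
      -- k ≥ 1, its own residue differs.
      ¬remA′ : ¬ Rem (suc A)
      ¬remA′ (lt , rA′) = residue-up≢ k 1≤k {A} {g (suc A)} (≤-trans z<s lt)
        (trans rA′ (trans (sym (proj₂ p)) (trans (sym (residue-below C i)) (cong (residue k (suc A)) flat))))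

  removed-core : Core k lowered removed
  removed-core = record
    { bounded   = λ i → ≤-trans (lower≤ (topmost? i) (ℓ i)) (C.bounded i)
    ; mono      = antitone removed-antitone
    ; rec       = removed-rec
    ; height    = C.height
    ; vanishing = λ {i} le → n≤0⇒n≡0 (≤-trans (lower≤ (removable? i) (g i)) (≤-reflexive (C.vanishing le))) }

record Removal (k r : ℕ) (λ' : List ℕ) : Set where
  field
    result   : List ℕ
    kBounded′ : KBounded k result
    row-cases : ∀ i → (Removable k r (part (𝔠 k λ')) i × suc (part (𝔠 k result) i) ≡ part (𝔠 k λ') i)
                    ⊎ (¬ Removable k r (part (𝔠 k λ')) i × part (𝔠 k result) i ≡ part (𝔠 k λ') i)
    size-cases : (∃ λ i → Removable k r (part (𝔠 k λ')) i × size λ' ≡ suc (size result)) ⊎ size λ' ≡ size result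

abstract
  remove : ∀ {k λ'} → 1 ≤ k → KBounded k λ' → ∀ r → Removal k r λ'
  remove {k} {λ'} 1≤k kb r = record
    { result = result ; kBounded′ = kb′ ; row-cases = row-cases ; size-cases = size-cases }
    where
    C : Core k (part λ') (part (𝔠 k λ'))
    C = 𝔠-core kb
    C′ : Core k (lowered 1≤k C r) (removed 1≤k C r)
    C′ = removed-core 1≤k C r
    module C′ = Core C′
    m : ℕ
    m = length λ'
    ℓ′ : ℕ → ℕ
    ℓ′ = lowered 1≤k C r
    vanish : ∀ {i} → m ≤ i → ℓ′ i ≡ 0
    vanish {i} le = n≤0⇒n≡0 (≤-trans (lower≤ (topmost? 1≤k C r i) _) (≤-reflexive (nth-≥length 0 λ' le)))
    result : List ℕ
    result = fromParts (ℓ′ ∘ pred) m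
    part-result : ∀ i → part result i ≡ ℓ′ i
    part-result = part-fromParts {ℓ′ ∘ pred} m C′.ℓ-antitone vanish
    kb′ : KBounded k result
    kb′ = kBounded (fromParts-partition {ℓ′ ∘ pred} m C′.ℓ-antitone vanish)
            (λ i → ≤-trans (≤-reflexive (part-result i)) (C′.bounded i))
    rows : ∀ i → part (𝔠 k result) i ≡ removed 1≤k C r i
    rows = core-unique (𝔠-core kb′) C′ part-result
    row-cases : ∀ i → (Removable k r (part (𝔠 k λ')) i × suc (part (𝔠 k result) i) ≡ part (𝔠 k λ') i)
                    ⊎ (¬ Removable k r (part (𝔠 k λ')) i × part (𝔠 k result) i ≡ part (𝔠 k λ') i)
    row-cases i with removable? 1≤k C r i
    ... | yes p = inj₁ (p , trans (cong suc (rows i)) (removed-yes 1≤k C r p))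
    ... | no ¬p = inj₂ (¬p , trans (rows i) (removed-no 1≤k C r ¬p))
    size-result : size result ≡ sumTo ℓ′ m
    size-result = begin
      size result                                  ≡⟨ size-sumTo result (m≤n+m _ m) ⟩
      sumTo (part result) (m + length result)      ≡⟨ sumTo-cong (m + length result) (λ i _ → part-result i) ⟩
      sumTo ℓ′ (m + length result)                 ≡⟨ sumTo-extend (m + length result) vanish (m≤m+n m _) ⟩
      sumTo ℓ′ m                                   ∎
      where open ≡-Reasoning
    size-λ : size λ' ≡ sumTo (part λ') m
    size-λ = size-sumTo λ' ≤-refl
    size-cases : (∃ λ i → Removable k r (part (𝔠 k λ')) i × size λ' ≡ suc (size result)) ⊎ size λ' ≡ size result
    size-cases with sumTo-lower (topmost? 1≤k C r) (part λ') (topmost-positive 1≤k C r)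
        (topmost-unique 1≤k C r) m
    ... | inj₁ (i , _ , (rem , _) , eq) = inj₁ (i , rem , trans size-λ (trans eq (cong suc (sym size-result))))
    ... | inj₂ eq = inj₂ (trans size-λ (trans eq (sym size-result)))

-- Descending along a strip

-- The shift by one agrees with the encoding in `distinctRes`, which thereby becomes an instance of
-- this count by definition.
numResidues : ℕ → (ℕ → Bool) → ℕ
numResidues k R = countB (λ c → R (c ∸ 1)) (suc k)

%-suc : ∀ k x y → x % suc k ≡ y % suc k → suc x % suc k ≡ suc y % suc k
%-suc k x y eq = trans (%-distribˡ-+ 1 x (suc k))
  (trans (cong (λ z → (1 % suc k + z) % suc k) eq) (sym (%-distribˡ-+ 1 y (suc k))))

%-pred : ∀ k x y → suc x % suc k ≡ suc y % suc k → x % suc k ≡ y % suc k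
%-pred k x y eq = trans (sym (wrap x)) (trans (trans (%-distribˡ-+ (suc x) k (suc k))
  (trans (cong (λ z → (z + k % suc k) % suc k) eq) (sym (%-distribˡ-+ (suc y) k (suc k))))) (wrap y))
  where
  wrap : ∀ x → (suc x + k) % suc k ≡ x % suc k
  wrap x = trans (cong (_% suc k) (sym (+-suc x k))) ([m+n]%n≡m%n x (suc k))

none-or-all : ∀ (R : ℕ → Bool) k → (∃ λ r → r ≤ k × ¬ T (R r)) ⊎ (∀ r → r ≤ k → T (R r))
none-or-all R k with T? (R k)
... | no ¬t = inj₁ (k , ≤-refl , ¬t)
none-or-all R zero | yes t = inj₂ λ { zero _ → t }
none-or-all R (suc k) | yes t with none-or-all R k
... | inj₁ (r , le , ¬t) = inj₁ (r , m≤n⇒m≤1+n le , ¬t)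
... | inj₂ all = inj₂ λ r le → case-le (m≤n⇒m<n∨m≡n le)
  where case-le : ∀ {r} → r < suc k ⊎ r ≡ suc k → T (R r)
        case-le (inj₁ (s≤s le)) = all _ le
        case-le (inj₂ refl)     = t

countB-full : ∀ p m → (∀ i → 1 ≤ i → i ≤ m → T (p i)) → countB p m ≡ m
countB-full p zero    h = refl
countB-full p (suc m) h with p (suc m) | h (suc m) z<s ≤-refl
... | true | _ = trans (cong (_+ 1) (countB-full p m (λ i a b → h i a (m≤n⇒m≤1+n b)))) (+-comm m 1)

module _ {k : ℕ} (1≤k : 1 ≤ k) {g h : ℕ → ℕ} (g-antitone : Antitone g)
         (interlaced : ∀ i → g (suc i) ≤ h i) (R : ℕ → Bool)
         (hits : ∀ i c → h i < c → c ≤ g i → T (R (residue k (suc i) c))) where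

  -- Neither `g` nor `h` is supposed to be a core. In the sharp case, `tight-⊆` lifts the statement
  -- that the core fills its shape from `h` to `g`, and `tight-kconj` provides what admissibility
  -- requires of the k-conjugates.
  record Descent (λ' : List ℕ) : Set where
    field
      inner   : List ℕ
      kb      : KBounded k inner
      inner⊆  : ∀ i → part (𝔠 k inner) i ≤ h i
      size≤   : size λ' ≤ size inner + numResidues k R
      tight-⊆ : size λ' ≡ size inner + numResidues k R →
                (∀ i → h i ≤ part (𝔠 k inner) i) → ∀ i → g i ≤ part (𝔠 k λ') i
      tight-kconj : size λ' ≡ size inner + numResidues k R →
                    ∀ j → part (kconj k inner) j ≤ part (kconj k λ') j

  private
    n = suc k

  -- A row has at most k bounded cells whereas k+1 residues are counted, so equality is impossible
  -- and both sharp fields hold vacuously.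
  descend-all : (∀ r → r ≤ k → T (R r)) → ∀ {λ'} → KBounded k λ' → (∀ i → part (𝔠 k λ') i ≤ g i) → Descent λ'
  descend-all all {λ'} kb sub = record
    { inner = rest λ' ; kb = rest-kb kb ; inner⊆ = inner⊆ λ' sub
    ; size≤ = <⇒≤ (size< kb)
    ; tight-⊆ = λ eq → ⊥-elim (<⇒≢ (size< kb) eq)
    ; tight-kconj = λ eq → ⊥-elim (<⇒≢ (size< kb) eq) }
    where
    full : numResidues k R ≡ n
    full = countB-full (λ c → R (c ∸ 1)) n λ { (suc c) _ (s≤s le) → all c le }
    rest : List ℕ → List ℕ
    rest []       = []
    rest (x ∷ xs) = xs
    rest-kb : ∀ {xs} → KBounded k xs → KBounded k (rest xs)
    rest-kb {[]}     kb = kb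
    rest-kb {x ∷ xs} kb = kBounded-tail kb
    inner⊆ : ∀ xs → (∀ i → part (𝔠 k xs) i ≤ g i) → ∀ i → part (𝔠 k (rest xs)) i ≤ h i
    inner⊆ []       sub i = z≤n
    inner⊆ (x ∷ xs) sub i = ≤-trans (sub (suc i)) (interlaced i)
    size< : ∀ {xs} → KBounded k xs → size xs < size (rest xs) + numResidues k R
    size< {[]}     _  = ≤-trans z<s (≤-reflexive (sym full))
    size< {x ∷ xs} (_ , x≤k ∷ _) = lin (x ∷ size xs ∷ k ∷ numResidues k R ∷ [])
      (λ x s k r → x ≼ k ⇒ r ≈ con 1 ⊕ k ⇒ ⊢ x ⊕ s ≺ s ⊕ r) x≤k full

  -- The residue classes are removed one after the other, in decreasing cyclic order ending
  -- just after a residue r₀ that does not occur in the strip, so that each row of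
  -- the strip loses its cells from right to left.
  module _ (r₀ : ℕ) (r₀≤k : r₀ ≤ k) (r₀∉R : ¬ T (R r₀)) where

    rot : ℕ → ℕ
    rot j = (r₀ + j) % n

    rot-0 : rot 0 ≡ r₀
    rot-0 = trans (cong (_% n) (+-identityʳ r₀)) (m<n⇒m%n≡m (s≤s r₀≤k))

    rot-n : rot n ≡ r₀
    rot-n = trans ([m+n]%n≡m%n r₀ n) (m<n⇒m%n≡m (s≤s r₀≤k))

    residue-rot : ∀ i c → ∃ λ j → j ≤ k × residue k (suc i) c ≡ rot j
    residue-rot i c = j , ≤-pred (m%n<n y n) , sym (begin
      (r₀ + y % n) % n                       ≡⟨ %-distribˡ-+ r₀ (y % n) n ⟩
      (r₀ % n + y % n % n) % n               ≡⟨ cong (λ z → (r₀ % n + z) % n) (m<n⇒m%n≡m (m%n<n y n)) ⟩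
      (r₀ % n + y % n) % n                   ≡⟨ sym (%-distribˡ-+ r₀ y n) ⟩
      (r₀ + y) % n                           ≡⟨ cong (_% n) eq ⟩
      (x + n) % n                            ≡⟨ [m+n]%n≡m%n x n ⟩
      x % n                                  ∎)
      where
      open ≡-Reasoning
      x = c + k * suc i
      y = x + (n ∸ r₀)
      j = y % n
      eq : r₀ + y ≡ x + n
      eq = lin (r₀ ∷ x ∷ n ∸ r₀ ∷ n ∷ []) (λ r x d n → d ⊕ r ≈ n ⇒ ⊢ r ⊕ (x ⊕ d) ≈ x ⊕ n)
          (m∸n+n≡m (m≤n⇒m≤1+n r₀≤k))

    rot-suc : ∀ i c j → residue k (suc i) c ≡ rot j → residue k (suc i) (suc c) ≡ rot (suc j)
    rot-suc i c j eq = trans (%-suc k (c + k * suc i) (r₀ + j) eq) (cong (_% n) (sym (+-suc r₀ j)))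

    rot-pred : ∀ i c j → residue k (suc i) (suc c) ≡ rot (suc j) → residue k (suc i) c ≡ rot j
    rot-pred i c j eq = %-pred k (c + k * suc i) (r₀ + j) (trans eq (cong (_% n) (+-suc r₀ j)))

    not-r₀ : ∀ i c → h i < c → c ≤ g i → residue k (suc i) c ≢ r₀
    not-r₀ i c lo hi eq = r₀∉R (subst (T ∘ R) eq (hits i c lo hi))

    count : ℕ → ℕ
    count = countB (R ∘ rot)

    -- The indices up to `k ∸ r₀` give the residues above `r₀`, the later ones wrap around to those
    -- below it. Index 0, that is `r₀` itself, is left out, whence the inequality.
    count≤ : count k ≤ numResidues k R
    count≤ = begin
      count k                                             ≡⟨ cong count (sym (m∸n+n≡m r₀≤k)) ⟩
      count (e + r₀)                                      ≡⟨ countB-+ (R ∘ rot) e r₀ ⟩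
      count e + countB (R ∘ rot ∘ (e +_)) r₀      ≡⟨ cong₂ _+_ (countB-cong e high) (countB-cong r₀ low) ⟩
      countB (λ j → R (r₀ + j)) e + countB p r₀           ≡⟨ +-comm _ (countB p r₀) ⟩
      countB p r₀ + countB (λ j → R (r₀ + j)) e           ≡⟨ cong (countB p r₀ +_) (countB-cong e shifted) ⟩
      countB p r₀ + countB (p ∘ (r₀ +_) ∘ suc) e          ≤⟨ +-monoʳ-≤ (countB p r₀) skip ⟩
      countB p r₀ + countB (p ∘ (r₀ +_)) (suc e)          ≡⟨ sym (countB-+ p r₀ (suc e)) ⟩
      countB p (r₀ + suc e)                               ≡⟨ cong (countB p) total ⟩
      numResidues k R                                     ∎
      where
      open ≤-Reasoning
      e = k ∸ r₀
      p : ℕ → Bool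
      p c = R (c ∸ 1)
      total : r₀ + suc e ≡ n
      total = trans (+-suc r₀ e) (cong suc (m+[n∸m]≡n r₀≤k))
      skip : countB (p ∘ (r₀ +_) ∘ suc) e ≤ countB (p ∘ (r₀ +_)) (suc e)
      skip = ≤-trans (m≤n+m _ (countB (p ∘ (r₀ +_)) 1)) (≤-reflexive (sym (countB-+ (p ∘ (r₀ +_)) 1 e)))
      high : ∀ j → 1 ≤ j → j ≤ e → R (rot j) ≡ R (r₀ + j)
      high j _ le = cong R (m<n⇒m%n≡m (s≤s (≤-trans (+-monoʳ-≤ r₀ le) (≤-reflexive (m+[n∸m]≡n r₀≤k)))))
      low : ∀ j → 1 ≤ j → j ≤ r₀ → R (rot (e + j)) ≡ p j
      low (suc j) _ le = cong R (trans
          (cong (_% n) (lin (r₀ ∷ e ∷ j ∷ k ∷ [])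
              (λ r e j k → e ⊕ r ≈ k ⇒ ⊢ r ⊕ (e ⊕ (con 1 ⊕ j)) ≈ j ⊕ (con 1 ⊕ k)) (m∸n+n≡m r₀≤k)))
        (trans ([m+n]%n≡m%n j n) (m<n⇒m%n≡m (≤-trans le (m≤n⇒m≤1+n r₀≤k)))))
      shifted : ∀ j → 1 ≤ j → j ≤ e → R (r₀ + j) ≡ p (r₀ + suc j)
      shifted j _ _ = cong (λ z → R (z ∸ 1)) (sym (+-suc r₀ j))

    -- The residues `rot j`, ..., `rot 1` remain to be removed from the core of `λ'`, in this order;
    -- `inner` is what is left at the end.
    record Stage (j : ℕ) (λ' : List ℕ) : Set where
      field
        inner   : List ℕ
        kb      : KBounded k inner
        inner⊆  : ∀ i → part (𝔠 k inner) i ≤ h i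
        nested  : ∀ i → part (𝔠 k inner) i ≤ part (𝔠 k λ') i
        kconj⊆  : ∀ i → part (kconj k inner) i ≤ part (kconj k λ') i
        size≤   : size λ' ≤ size inner + count j
        -- When the count is sharp, every removal took effect; then the removed cells are the
        -- only ones of their residue that can be added back.
        tight   : size λ' ≡ size inner + count j → (∀ i → h i ≤ part (𝔠 k inner) i) →
                  ∀ i c j′ → part (𝔠 k λ') i < c → c ≤ g i → j′ ≤ k → residue k (suc i) c ≡ rot j′ → j < j′

    -- The invariant of the descent: cells not yet inside `h` have residues still to be removed. For
    -- `j = k` this is no condition; for `j = 0` only `r₀` is left, which does not occur in the
    -- strip.
    Outside : ℕ → List ℕ → Set
    Outside j λ' = ∀ i c j′ → h i < c → c ≤ part (𝔠 k λ') i → j′ ≤ k → residue k (suc i) c ≡ rot j′ → j′ ≤ j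

    stage-zero : ∀ {λ'} → KBounded k λ' → (∀ i → part (𝔠 k λ') i ≤ g i) → Outside 0 λ' → Stage 0 λ'
    stage-zero {λ'} kb sub outside = record
      { inner = λ' ; kb = kb ; inner⊆ = inside ; nested = λ _ → ≤-refl ; kconj⊆ = λ _ → ≤-refl
      ; size≤ = ≤-reflexive (sym (+-identityʳ _)) ; tight = tight }
      where
      inside : ∀ i → part (𝔠 k λ') i ≤ h i
      inside i = ≮⇒≥ λ lt → let (j , j≤k , eq) = residue-rot i (part (𝔠 k λ') i) in
        not-r₀ i (part (𝔠 k λ') i) lt (sub i)
            (trans eq (trans (cong rot (n≤0⇒n≡0 (outside i (part (𝔠 k λ') i) j lt ≤-refl j≤k eq))) rot-0))
      tight : _ → (∀ i → h i ≤ part (𝔠 k λ') i) → ∀ i c j′ → part (𝔠 k λ') i < c → c ≤ g i → j′ ≤ k →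
          residue k (suc i) c ≡ rot j′ → 0 < j′
      tight _ h⊆ i c zero    lt le _ eq = ⊥-elim (not-r₀ i c (≤-trans (s≤s (h⊆ i)) lt) le (trans eq rot-0))
      tight _ h⊆ i c (suc _) lt le _ eq = z<s
    stage-skip : ∀ {j λ'} → ¬ T (R (rot (suc j))) → (∀ i → part (𝔠 k λ') i ≤ g i) → Outside (suc j) λ' →
                 (Outside j λ' → Stage j λ') → Stage (suc j) λ'
    stage-skip {j} {λ'} ¬t sub outside stage = record
      { inner = S.inner ; kb = S.kb ; inner⊆ = S.inner⊆ ; nested = S.nested ; kconj⊆ = S.kconj⊆
      ; size≤ = subst (λ z → size λ' ≤ size S.inner + z) count≡ S.size≤
      ; tight = λ eq h⊆ i c j′ lt le j′≤k re → ≤∧≢⇒<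
          (S.tight (trans eq (cong (size S.inner +_) (sym count≡))) h⊆ i c j′ lt le j′≤k re)
            λ { refl → ¬t (subst (T ∘ R) re (hits i c (≤-trans (s≤s (≤-trans (h⊆ i) (S.nested i))) lt) le)) } }
      where
      outside′ : Outside j λ'
      outside′ i c j′ lt le j′≤k re with m≤n⇒m<n∨m≡n (outside i c j′ lt le j′≤k re)
      ... | inj₁ (s≤s p) = p
      ... | inj₂ refl = ⊥-elim (¬t (subst (T ∘ R) re (hits i c lt (≤-trans le (sub i)))))
      module S = Stage (stage outside′)
      count≡ : count j ≡ count (suc j)
      count≡ = trans (sym (+-identityʳ _)) (cong (count j +_) (sym (indicator-false ¬t)))
    indicator-true : ∀ {b} → T b → indicator b ≡ 1
    indicator-true {true} _ = refl

    stage-remove : ∀ {j λ'} → suc j ≤ k → T (R (rot (suc j))) → KBounded k λ' → (∀ i → part (𝔠 k λ') i ≤ g i) →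
                   Outside (suc j) λ' → (Rm : Removal k (rot (suc j)) λ') →
                   ((∀ i → part (𝔠 k (Removal.result Rm)) i ≤ g i) → Outside j (Removal.result Rm) → Stage j
                       (Removal.result Rm)) →
                   Stage (suc j) λ'
    stage-remove {j} {λ'} j<k t kb sub outside Rm stage = record
      { inner = S.inner ; kb = S.kb ; inner⊆ = S.inner⊆
      ; nested = λ i → ≤-trans (S.nested i) (result⊆ i)
      ; kconj⊆ = λ i → ≤-trans (S.kconj⊆ i) (kconj-⊆ Rm.kBounded′ kb result⊆ ver i)
      ; size≤ = size≤ ; tight = tight }
      where
      module Rm = Removal Rm
      result⊆ : ∀ i → part (𝔠 k Rm.result) i ≤ part (𝔠 k λ') i
      result⊆ i with Rm.row-cases i
      ... | inj₁ (_ , eq) = ≤-trans (n≤1+n _) (≤-reflexive eq)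
      ... | inj₂ (_ , eq) = ≤-reflexive eq
      ver : ∀ i → part (𝔠 k λ') i ≤ suc (part (𝔠 k Rm.result) i)
      ver i with Rm.row-cases i
      ... | inj₁ (_ , eq) = ≤-reflexive (sym eq)
      ... | inj₂ (_ , eq) = ≤-trans (≤-reflexive (sym eq)) (n≤1+n _)
      outside′ : Outside j Rm.result
      outside′ i c j′ lt le j′≤k re with m≤n⇒m<n∨m≡n (outside i c j′ lt (≤-trans le (result⊆ i)) j′≤k re)
      ... | inj₁ (s≤s p) = p
      ... | inj₂ refl with c <? part (𝔠 k λ') i
      -- The right neighbour of the cell would carry the next residue, which was dealt with before
      -- or, after the last index, is `r₀`.
      ...   | yes c< = ⊥-elim (wrap (m≤n⇒m<n∨m≡n j′≤k))
        where
        re′ = rot-suc i c (suc j) re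
        wrap : suc j < k ⊎ suc j ≡ k → ⊥
        wrap (inj₁ lt′) = <-irrefl refl (outside i (suc c) (suc (suc j)) (m<n⇒m<1+n lt) c< lt′ re′)
        wrap (inj₂ refl) = not-r₀ i (suc c) (m<n⇒m<1+n lt) (≤-trans c< (sub i)) (trans re′ rot-n)
      ...   | no c≮ with Rm.row-cases i
      ...     | inj₁ (_ , eq) = ⊥-elim (<⇒≱ (≤-trans (s≤s le) (≤-reflexive eq)) (≮⇒≥ c≮))
      -- The cell ends its row, and by interlacing the row above ends within `h i`, hence before
      -- column `c`: the cell was removable.
      ...     | inj₂ (¬rem , eq) = ⊥-elim (¬rem
                  ( ≤-trans (s≤s (≤-trans (sub (suc i)) (interlaced i))) (≤-trans lt (≤-trans le (result⊆ i)))
                  , trans (cong (residue k (suc i)) (≤-antisym (≮⇒≥ c≮) (≤-trans le (result⊆ i)))) re))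
      module S = Stage (stage (λ i → ≤-trans (result⊆ i) (sub i)) outside′)
      count≡ : count (suc j) ≡ count j + 1
      count≡ = cong (count j +_) (indicator-true t)
      size≤ : size λ' ≤ size S.inner + count (suc j)
      size≤ = subst (λ z → size λ' ≤ size S.inner + z) (sym count≡)
          (lin (size λ' ∷ size Rm.result ∷ size S.inner ∷ count j ∷ [])
        (λ a b c d → a ≼ con 1 ⊕ b ⇒ b ≼ c ⊕ d ⇒ ⊢ a ≼ c ⊕ (d ⊕ con 1)) (case Rm.size-cases) S.size≤)
        where
        case : _ ⊎ size λ' ≡ size Rm.result → size λ' ≤ suc (size Rm.result)
        case (inj₁ (_ , _ , eq)) = ≤-reflexive eq
        case (inj₂ eq)           = ≤-trans (≤-reflexive eq) (n≤1+n _)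
      tight : size λ' ≡ size S.inner + count (suc j) → (∀ i → h i ≤ part (𝔠 k S.inner) i) →
              ∀ i c j′ → part (𝔠 k λ') i < c → c ≤ g i → j′ ≤ k → residue k (suc i) c ≡ rot j′ → suc j < j′
      tight eq₀ h⊆ = tight-cases Rm.size-cases
        where
        eq : size λ' ≡ size S.inner + (count j + 1)
        eq = trans eq₀ (cong (size S.inner +_) count≡)
        tight-cases : (∃ λ i → Removable k (rot (suc j)) (part (𝔠 k λ')) i × size λ' ≡ suc (size Rm.result))
            ⊎ size λ' ≡ size Rm.result →
                      ∀ i c j′ → part (𝔠 k λ') i < c → c ≤ g i → j′ ≤ k → residue k (suc i) c ≡ rot j′ → suc
                          j < j′
        tight-cases (inj₂ same) = ⊥-elim (lin (size λ' ∷ size Rm.result ∷ size S.inner ∷ count j ∷ [])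
          (λ a b c d → a ≈ b ⇒ b ≼ c ⊕ d ⇒ a ≈ c ⊕ (d ⊕ con 1) ⇒ ⊢ falsum) same S.size≤ eq)
        tight-cases (inj₁ (i₀ , rem , drop)) = outer
          where
          inner-tight = S.tight (lin (size λ' ∷ size Rm.result ∷ size S.inner ∷ count j ∷ [])
            (λ a b c d → a ≈ con 1 ⊕ b ⇒ a ≈ c ⊕ (d ⊕ con 1) ⇒ ⊢ b ≈ c ⊕ d) drop eq) h⊆
          outer : ∀ i c j′ → part (𝔠 k λ') i < c → c ≤ g i → j′ ≤ k → residue k (suc i) c ≡ rot j′ → suc j < j′
          outer i (suc c) j′ (s≤s lt) le j′≤k re =
            ≤∧≢⇒< (inner-tight i (suc c) j′ (≤-trans (s≤s (result⊆ i)) (s≤s lt)) le j′≤k re) (λ { refl → absurd re })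
            where
            above : ∀ e → e < i → c < part (𝔠 k λ') e
            above e e<i = ≤-trans le (≤-trans (g-antitone e<i) (≤-trans (interlaced e) (≤-trans (h⊆ e)
                            (≤-trans (S.nested e) (result⊆ e)))))
            -- If the left neighbour is missing too, it has residue `rot j`, which `inner-tight`
            -- excludes. Otherwise `above` makes the cell addable, against `no-addable`, as row `i₀`
            -- ends in a removable cell of the same residue.
            absurd : residue k (suc i) (suc c) ≡ rot (suc j) → ⊥
            absurd re with m≤n⇒m<n∨m≡n lt
            ... | inj₁ lt′ = <-irrefl refl (inner-tight i c j (≤-trans (s≤s (result⊆ i)) lt′) (<⇒≤ le)
                (<⇒≤ j<k) (rot-pred i c j re))
            ... | inj₂ refl = no-addable (𝔠-core kb) {rot (suc j)} {i} {i₀} rem above re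

    descend-stage : ∀ j → j ≤ k → ∀ {λ'} → KBounded k λ' → (∀ i → part (𝔠 k λ') i ≤ g i) → Outside j λ' →
        Stage j λ'
    descend-stage zero    _   kb sub outside = stage-zero kb sub outside
    descend-stage (suc j) j<k kb sub outside with T? (R (rot (suc j)))
    ... | no ¬t = stage-skip ¬t sub outside (descend-stage j (<⇒≤ j<k) kb sub)
    ... | yes t = stage-remove j<k t kb sub outside Rm (descend-stage j (<⇒≤ j<k) (Removal.kBounded′ Rm))
      where Rm = remove 1≤k kb (rot (suc j))

    descend-missing : ∀ {λ'} → KBounded k λ' → (∀ i → part (𝔠 k λ') i ≤ g i) → Descent λ'
    descend-missing {λ'} kb sub = record
      { inner = S.inner ; kb = S.kb ; inner⊆ = S.inner⊆
      ; size≤ = ≤-trans S.size≤ (+-monoʳ-≤ (size S.inner) count≤)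
      -- A missing cell would need an index above `k`, yet every residue is `rot j` for some
      -- `j ≤ k`.
      ; tight-⊆ = λ eq h⊆ i → ≮⇒≥ λ lt → let (j , j≤k , re) = residue-rot i (g i) in
          <⇒≱ (S.tight (sharp eq) h⊆ i (g i) j lt ≤-refl j≤k re) j≤k
      ; tight-kconj = λ _ → S.kconj⊆ }
      where
      module S = Stage (descend-stage k ≤-refl kb sub (λ i c j lt le j≤k re → j≤k))
      sharp : size λ' ≡ size S.inner + numResidues k R → size λ' ≡ size S.inner + count k
      sharp eq = ≤-antisym S.size≤ (≤-trans (+-monoʳ-≤ (size S.inner) count≤) (≤-reflexive (sym eq)))

  descend : ∀ {λ'} → KBounded k λ' → (∀ i → part (𝔠 k λ') i ≤ g i) → Descent λ'
  descend kb sub with none-or-all R k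
  ... | inj₁ (r , r≤k , r∉R) = descend-missing r r≤k r∉R kb sub
  ... | inj₂ all             = descend-all all kb sub

-- Counting the residues of a strip

countB-remove : ∀ p x m → countB p m ≤ countB (λ c → p c ∧ not (c ≡ᵇ x)) m + countB (_≡ᵇ x) m
countB-remove p x zero    = z≤n
countB-remove p x (suc m) = ≤-trans (+-mono-≤ (countB-remove p x m) (split (p (suc m)) (suc m ≡ᵇ x)))
  (≤-reflexive (rearrange (countB (λ c → p c ∧ not (c ≡ᵇ x)) m) (countB (_≡ᵇ x) m)
      (indicator (p (suc m) ∧ not (suc m ≡ᵇ x))) (indicator (suc m ≡ᵇ x))))
  where
  rearrange : ∀ a b c d → a + b + (c + d) ≡ a + c + (b + d)
  rearrange a b c d = lin (a ∷ b ∷ c ∷ d ∷ []) (λ a b c d → ⊢ a ⊕ b ⊕ (c ⊕ d) ≈ a ⊕ c ⊕ (b ⊕ d))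
  split : ∀ a b → indicator a ≤ indicator (a ∧ not b) + indicator b
  split false b     = z≤n
  split true  true  = ≤-refl
  split true  false = ≤-refl

countB-≤-length : ∀ L p m → (∀ c → 1 ≤ c → c ≤ m → T (p c) → c ∈ L) → countB p m ≤ length L
countB-≤-length []      p m h = ≤-reflexive (countB-empty p m (λ c a b t → case (h c a b t)))
  where case : ∀ {c : ℕ} → c ∈ [] → ⊥
        case ()
countB-≤-length (x ∷ L) p m h = begin
  countB p m                                                            ≤⟨ countB-remove p x m ⟩
  countB (λ c → p c ∧ not (c ≡ᵇ x)) m + countB (_≡ᵇ x) m                ≤⟨ +-mono-≤
      (countB-≤-length L _ m rest) single ⟩
  length L + 1                                                          ≡⟨ +-comm (length L) 1 ⟩
  suc (length L)                                                        ∎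
  where
  open ≤-Reasoning
  single : countB (_≡ᵇ x) m ≤ 1
  single = countB≤1 (_≡ᵇ x) m λ i j _ i<j _ ti tj →
    <⇒≢ i<j (trans (≡ᵇ⇒≡ i x ti) (sym (≡ᵇ⇒≡ j x tj)))
  differ : ∀ {b} → T b → T (not b) → ⊥
  differ {true} _ ()
  rest : ∀ c → 1 ≤ c → c ≤ m → T (p c ∧ not (c ≡ᵇ x)) → c ∈ L
  rest c a b t with h c a b (∧-left t)
  ... | here eq = ⊥-elim (differ (≡⇒≡ᵇ c x eq) (∧-right {p c} t))
  ... | there i = i

sumFrom : (ℕ → ℕ) → ℕ → ℕ → ℕ
sumFrom f zero    i = 0
sumFrom f (suc d) i = f i + sumFrom f d (suc i)

sumFrom-0 : ∀ f d → sumFrom f d 0 ≡ sumTo f d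
sumFrom-0 f d = go f d 0 (λ t → cong f (sym (+-identityʳ t)))
  where
  go : ∀ f′ d i → (∀ t → f′ t ≡ f (t + i)) → sumFrom f d i ≡ sumTo f′ d
  go f′ zero    i eq = refl
  go f′ (suc d) i eq = trans (cong₂ _+_ (sym (eq 0))
      (go (f′ ∘ suc) d (suc i) (λ t → trans (eq (suc t)) (cong f (sym (+-suc t i))))))
                             (sym (sumTo-suc f′ d))

module _ {k : ℕ} {λ' μ : List ℕ} (kλ : KBounded k λ') (kμ : KBounded k μ)
         (ℓ⊆ : ∀ i → part λ' i ≤ part μ i)
         (ω⊆ : ∀ j → part (kconj k λ') j ≤ part (kconj k μ) j)
         (interlaced : ∀ i → part (𝔠 k μ) (suc i) ≤ part (𝔠 k λ') i) where
  private
    n = suc k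
    γ = 𝔠 k λ'
    δ = 𝔠 k μ
    g = part γ
    h = part δ
    ℓ = part λ'
    m = part μ
    pγ = 𝔠-partition kλ
    pδ = 𝔠-partition kμ
    module C = Core (𝔠-core kλ)
    module D = Core (𝔠-core kμ)
    module C′ = Core (kconj-core kλ)
    module D′ = Core (kconj-core kμ)
    g≤h : ∀ i → g i ≤ h i
    g≤h = core-mono (𝔠-core kλ) (𝔠-core kμ) ℓ⊆

  -- Otherwise column g a has the same height in both cores, and its cell in row i
  -- is k-bounded in 𝔠 λ' but not in 𝔠 μ.
  no-step : ∀ {i a} → D.below i ≤ a → a < C.below i → g a ≡ h (suc a)
  no-step {i} {a} B≤a a<A = ≤-antisym (≮⇒≥ absurd) (interlaced a)
    where
    absurd : h (suc a) < g a → ⊥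
    absurd lt with g a in eq
    ... | suc j = i<e
      where
      cγ = λ j → colLen γ (suc j)
      cδ = λ j → colLen δ (suc j)
      u = part (kconj k λ') j
      v = part (kconj k μ) j
      A′ = C′.below j
      B′ = D′.below j
      a<cγ : a < cγ j
      a<cγ = cell⇒<colLen pγ (≤-reflexive (sym eq))
      cδ≤ : cδ j ≤ suc a
      cδ≤ = ≮⇒≥ λ lt′ → <⇒≱ (<colLen⇒cell pδ lt′) (≤-pred lt)
      cγ≤cδ : cγ j ≤ cδ j
      cγ≤cδ = colLen-mono pγ pδ g≤h j
      e≤i : cγ A′ ≤ i
      e≤i = ≮⇒≥ λ lt′ → lin (i ∷ a ∷ k ∷ j ∷ u ∷ A′ ∷ cγ j ∷ cγ A′ ∷ g i ∷ ℓ i ∷ C.below i ∷ g (C.below i) ∷ [])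
        (λ i a k j u A′ c e gi li A gA → i ≺ e ⇒ c ≈ u ⊕ e ⇒ u ⊕ A′ ≈ j ⊕ (con 1 ⊕ k) ⇒ A′ ≺ gi ⇒
          gi ≈ li ⊕ gA ⇒ li ⊕ A ≈ i ⊕ (con 1 ⊕ k) ⇒ gA ≼ con 1 ⊕ j ⇒ a ≺ A ⇒ c ≼ con 1 ⊕ a ⇒ ⊢ falsum)
        lt′ (C′.rec j) (C′.below-+ j) (<colLen⇒cell pγ lt′) (C.rec i) (C.below-+ i)
        (≤-trans (C.mono (<⇒≤ a<A)) (≤-reflexive eq)) a<A (≤-trans cγ≤cδ cδ≤)
      f≤i : cδ B′ ≤ i
      f≤i = lin (u ∷ v ∷ cγ j ∷ cδ j ∷ cγ A′ ∷ cδ B′ ∷ i ∷ a ∷ [])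
        (λ u v c d e f i a → u ≼ v ⇒ c ≈ u ⊕ e ⇒ d ≈ v ⊕ f ⇒ d ≼ con 1 ⊕ a ⇒ a ≺ c ⇒ e ≼ i ⇒ ⊢ f ≼ i)
        (ω⊆ j) (C′.rec j) (D′.rec j) cδ≤ a<cγ e≤i
      i<e : ⊥
      i<e = lin (i ∷ a ∷ k ∷ j ∷ v ∷ B′ ∷ cδ j ∷ cδ B′ ∷ h i ∷ m i ∷ D.below i ∷ h (D.below i) ∷ [])
        (λ i a k j v B′ d f hi mi B hB → f ≼ i ⇒ d ≈ v ⊕ f ⇒ a ≺ d ⇒ v ⊕ B′ ≈ j ⊕ (con 1 ⊕ k) ⇒ hi ≼ B′ ⇒
          hi ≈ mi ⊕ hB ⇒ mi ⊕ B ≈ i ⊕ (con 1 ⊕ k) ⇒ con 1 ⊕ j ≼ hB ⇒ B ≼ a ⇒ ⊢ falsum)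
        f≤i (D′.rec j) (≤-trans a<cγ cγ≤cδ) (D′.below-+ j) (≮⇒≥ (≤⇒≯ f≤i ∘ cell⇒<colLen pδ))
        (D.rec i) (D.below-+ i) (≤-trans (≤-reflexive (sym eq)) (≤-trans (g≤h a) (D.mono B≤a))) B≤a

  record Hit (i r : ℕ) : Set where
    constructor stripCell
    field
      column : ℕ
      outer  : g i < column
      inner  : column ≤ h i
      class  : residue k (suc i) column ≡ r

  -- The contents of the strip cells of row i, moved down by k+1, run through
  -- the strip cells of the rows D.below i, …, C.below i and the contents between
  -- consecutive ones of these rows, which by no-step are single.
  hit-cover : ∀ {i r} → Hit i r →
              (∃ λ a → D.below i ≤ a × a < C.below i × r ≡ residue k (suc a) (g a)) ⊎ (∃ λ a → i < a × Hit a r)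
  hit-cover {i} {r} (stripCell c lo hi res) = walk A (≤-trans (B≤A) ≤-refl) ≤-refl start
    where
    A = C.below i
    B = D.below i
    B≤A : B ≤ A
    B≤A = +-monoʳ-≤ i (s≤s (∸-monoʳ-≤ k (ℓ⊆ i)))
    start : g A + i + n < c + A
    start = lin (g i ∷ ℓ i ∷ g A ∷ A ∷ c ∷ i ∷ k ∷ []) (λ gi l ga a c i k →
      gi ≺ c ⇒ gi ≈ l ⊕ ga ⇒ l ⊕ a ≈ i ⊕ (con 1 ⊕ k) ⇒ ⊢ ga ⊕ i ⊕ (con 1 ⊕ k) ≺ c ⊕ a) lo (C.rec i)
          (C.below-+ i)
    end : c + B ≤ h B + i + n
    end = lin (h i ∷ m i ∷ h B ∷ B ∷ c ∷ i ∷ k ∷ []) (λ hi l hb b c i k →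
      c ≼ hi ⇒ hi ≈ l ⊕ hb ⇒ l ⊕ b ≈ i ⊕ (con 1 ⊕ k) ⇒ ⊢ c ⊕ b ≼ hb ⊕ i ⊕ (con 1 ⊕ k)) hi (D.rec i)
          (D.below-+ i)
    shifted : ∀ a c′ → c + a ≡ c′ + i + n → r ≡ residue k (suc a) c′
    shifted a c′ eq = trans (sym res)
        (residue-shift k i c a c′ 1 (trans eq (cong (c′ + i +_) (sym (*-identityˡ n)))))
    Goal = (∃ λ a → B ≤ a × a < A × r ≡ residue k (suc a) (g a)) ⊎ (∃ λ a → i < a × Hit a r)
    -- Invariant: the content of column `c` in row `i`, lowered by k+1, lies beyond the end of row
    -- `a` of the inner core. It holds at `A` by `start`; at `B` it cannot lie beyond the outer
    -- core, by `end`.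
    walk : ∀ a → B ≤ a → a ≤ A → g a + i + n < c + a → Goal
    next-row : ∀ a → B ≤ a → a ≤ A → h a + i + n < c + a → B < a ⊎ B ≡ a → Goal
    walk a B≤a a≤A lt with c + a ≤? h a + i + n
    ... | no ¬le = next-row a B≤a a≤A (≰⇒> ¬le) (m≤n⇒m<n∨m≡n B≤a)
    ... | yes le = inj₂ (a , ≤-trans (<next k (m i) i) B≤a , stripCell c′ c′> c′≤ (sym (shifted a c′ c′≡)))
      where
      c′ = c + a ∸ (i + n)
      c′≡ : c + a ≡ c′ + i + n
      c′≡ = trans (sym (m∸n+n≡m (≤-trans (lin (g a ∷ i ∷ n ∷ []) (λ g i n → ⊢ i ⊕ n ≼ g ⊕ i ⊕ n))
          (<⇒≤ lt)))) (sym (+-assoc c′ i n))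
      c′> : g a < c′
      c′> = lin (g a ∷ i ∷ n ∷ c′ ∷ c ∷ a ∷ [])
          (λ g i n c′ c a → g ⊕ i ⊕ n ≺ c ⊕ a ⇒ c ⊕ a ≈ c′ ⊕ i ⊕ n ⇒ ⊢ g ≺ c′) lt c′≡
      c′≤ : c′ ≤ h a
      c′≤ = lin (h a ∷ i ∷ n ∷ c′ ∷ c ∷ a ∷ [])
          (λ h i n c′ c a → c ⊕ a ≼ h ⊕ i ⊕ n ⇒ c ⊕ a ≈ c′ ⊕ i ⊕ n ⇒ ⊢ c′ ≼ h) le c′≡
    next-row a B≤a a≤A lt (inj₂ refl) = ⊥-elim (<⇒≱ lt end)
    next-row (suc a) _ a<A lt (inj₁ (s≤s B≤a)) with m≤n⇒m<n∨m≡n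
      (lin (h (suc a) ∷ g a ∷ i ∷ n ∷ c ∷ a ∷ [])
          (λ h g i n c a → h ⊕ i ⊕ n ≺ c ⊕ (con 1 ⊕ a) ⇒ g ≈ h ⇒ ⊢ g ⊕ i ⊕ n ≼ c ⊕ a) lt (no-step B≤a a<A))
    ... | inj₁ lt′ = walk a B≤a (<⇒≤ a<A) lt′
    ... | inj₂ eq  = inj₁ (a , B≤a , a<A , shifted a (g a) (sym eq))

  -- By `no-step`, the strip cells of rows `a` and `suc a` leave out exactly one content between
  -- them, that of column `g a` in row `a`.
  rowCover : ℕ → List ℕ
  rowCover i = applyUpTo (λ t → residue k (suc (D.below i + t)) (g (D.below i + t))) (C.below i ∸ D.below i)

  length-rowCover : ∀ i → length (rowCover i) + ℓ i ≡ m i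
  length-rowCover i = lin (length (rowCover i) ∷ C.below i ∸ D.below i ∷ C.below i ∷ D.below i ∷ ℓ i ∷ m i ∷
      i ∷ k ∷ [])
    (λ L d A B l m i k → L ≈ d ⇒ d ⊕ B ≈ A ⇒ l ⊕ A ≈ i ⊕ (con 1 ⊕ k) ⇒ m ⊕ B ≈ i ⊕ (con 1 ⊕ k) ⇒ ⊢ L ⊕ l ≈ m)
    (length-applyUpTo _ (C.below i ∸ D.below i)) (m∸n+n≡m (+-monoʳ-≤ i (s≤s (∸-monoʳ-≤ k (ℓ⊆ i)))))
        (C.below-+ i) (D.below-+ i)

  ∈-rowCover : ∀ {i a} → D.below i ≤ a → a < C.below i → residue k (suc a) (g a) ∈ rowCover i
  ∈-rowCover {i} {a} B≤a a<A = subst (λ x → residue k (suc x) (g x) ∈ rowCover i) (m+[n∸m]≡n B≤a)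
    (∈-applyUpTo⁺ (λ t → residue k (suc (D.below i + t)) (g (D.below i + t))) (∸-monoˡ-< a<A B≤a))

  cover : ℕ → ℕ → List ℕ
  cover zero    i = []
  cover (suc d) i = rowCover i ++ cover d (suc i)

  length-cover : ∀ d i → length (cover d i) + sumFrom ℓ d i ≡ sumFrom m d i
  length-cover zero    i = refl
  length-cover (suc d) i = lin
    (length (rowCover i ++ cover d (suc i)) ∷ length (rowCover i) ∷ length (cover d (suc i)) ∷ ℓ i ∷ m i ∷
        sumFrom ℓ d (suc i) ∷ sumFrom m d (suc i) ∷ [])
    (λ L L₁ L₂ l m s t → L ≈ L₁ ⊕ L₂ ⇒ L₁ ⊕ l ≈ m ⇒ L₂ ⊕ s ≈ t ⇒ ⊢ L ⊕ (l ⊕ s) ≈ m ⊕ t)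
    (length-++ (rowCover i)) (length-rowCover i) (length-cover d (suc i))

  -- A residue escaping `rowCover i` is hit again in a later row, and the strip is empty from
  -- `D.height` on.
  ∈-cover : ∀ d i → D.height ≤ i + d → ∀ {i′ r} → i ≤ i′ → Hit i′ r → r ∈ cover d i
  ∈-cover zero i le {i′} i≤i′ (stripCell c lo hi _) = ⊥-elim (<⇒≱ lo (≤-trans hi (≤-trans
    (≤-reflexive (D.vanishing (≤-trans le (≤-trans (≤-reflexive (+-identityʳ i)) i≤i′)))) z≤n)))
  ∈-cover (suc d) i le {i′} {r} i≤i′ hit = go (m≤n⇒m<n∨m≡n i≤i′)
    where
    ih : ∀ {i″} → i < i″ → Hit i″ r → r ∈ cover (suc d) i
    ih lt hit′ = ∈-++⁺ʳ (rowCover i) (∈-cover d (suc i) (≤-trans le (≤-reflexive (+-suc i d))) lt hit′)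
    here-row : Hit i r → r ∈ cover (suc d) i
    here-row hit′ with hit-cover {i} {r} hit′
    ... | inj₁ (a , B≤a , a<A , eq) = subst (_∈ cover (suc d) i) (sym eq) (∈-++⁺ˡ (∈-rowCover B≤a a<A))
    ... | inj₂ (a , i<a , hit″)     = ih i<a hit″
    go : i < i′ ⊎ i ≡ i′ → r ∈ cover (suc d) i
    go (inj₁ lt)   = ih lt hit
    go (inj₂ refl) = here-row hit

  numResidues≤ : ∀ R → (∀ r → T (R r) → ∃ λ i → Hit i r) → numResidues k R + size λ' ≤ size μ
  numResidues≤ R hits = begin
    numResidues k R + size λ'                     ≤⟨ +-monoˡ-≤ (size λ')
        (countB-≤-length (map suc L) (λ c → R (c ∸ 1)) n covered) ⟩
    length (map suc L) + size λ'                  ≡⟨ cong₂ _+_ (length-map suc L)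
        (trans (size-sumTo λ' lenλ) (sym (sumFrom-0 ℓ d))) ⟩
    length L + sumFrom ℓ d 0                      ≡⟨ length-cover d 0 ⟩
    sumFrom m d 0                                 ≡⟨ trans (sumFrom-0 m d) (sym (size-sumTo μ lenμ)) ⟩
    size μ                                        ∎
    where
    open ≤-Reasoning
    d = D.height + (length λ' + length μ)
    L = cover d 0
    lenλ : length λ' ≤ d
    lenλ = ≤-trans (m≤m+n _ _) (m≤n+m _ D.height)
    lenμ : length μ ≤ d
    lenμ = ≤-trans (m≤n+m _ (length λ')) (m≤n+m _ D.height)
    covered : ∀ c → 1 ≤ c → c ≤ n → T (R (c ∸ 1)) → c ∈ map suc L
    covered (suc c) _ _ t = ∈-map⁺ suc (let (i , hit) = hits c t in ∈-cover d 0 (m≤m+n D.height _) z≤n hit)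

-- Chains of strips

sumTo-tight : ∀ {f g} r → (∀ m → m < r → f m ≤ g m) → sumTo g r ≤ sumTo f r → ∀ m → m < r → f m ≡ g m
sumTo-tight {f} {g} (suc r) le tight m m<r = go (m≤n⇒m<n∨m≡n (≤-pred m<r))
  where
  le′ : ∀ m → m < r → f m ≤ g m
  le′ m lt = le m (m<n⇒m<1+n lt)
  sums : sumTo f r ≤ sumTo g r
  sums = sumTo-mono r le′
  go : m < r ⊎ m ≡ r → f m ≡ g m
  go (inj₁ lt) = sumTo-tight r le′ (lin (sumTo f r ∷ sumTo g r ∷ f r ∷ g r ∷ [])
    (λ a b c d → b ⊕ d ≼ a ⊕ c ⇒ c ≼ d ⇒ ⊢ b ≼ a) tight (le r ≤-refl)) m lt
  go (inj₂ refl) = ≤-antisym (le r ≤-refl) (lin (sumTo f r ∷ sumTo g r ∷ f r ∷ g r ∷ [])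
    (λ a b c d → b ⊕ d ≼ a ⊕ c ⇒ a ≼ b ⇒ ⊢ d ≼ c) tight sums)

-- `G m` gives the row lengths of the letters up to `m`, and `R m` the residues of letter `m + 1`.
-- The shapes come from a tableau in one direction and from an admissible chain in the other.
module StripChain {k : ℕ} (1≤k : 1 ≤ k) (r : ℕ) (G : ℕ → ℕ → ℕ) (R : ℕ → ℕ → Bool)
  (G-antitone : ∀ m → Antitone (G m))
  (G-zero : ∀ i → G 0 i ≡ 0)
  (interlaced : ∀ m → m < r → ∀ i → G (suc m) (suc i) ≤ G m i)
  (hits : ∀ m → m < r → ∀ i c → G m i < c → c ≤ G (suc m) i → T (R m (residue k (suc i) c))) where

  total : ℕ → ℕ
  total = sumTo (λ m → numResidues k (R m))

  private
    Down : ∀ m → m < r → List ℕ → Set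
    Down m m<r = Descent 1≤k {G (suc m)} {G m} (G-antitone (suc m)) (interlaced m m<r) (R m) (hits m m<r)

    stepDown : ∀ m (m<r : m < r) {λ'} → KBounded k λ' → (∀ i → part (𝔠 k λ') i ≤ G (suc m) i) → Down m m<r λ'
    stepDown m m<r = descend 1≤k {G (suc m)} {G m} (G-antitone (suc m)) (interlaced m m<r) (R m) (hits m m<r)

  total-bound : ∀ m → m ≤ r → ∀ {λ'} → KBounded k λ' → (∀ i → part (𝔠 k λ') i ≤ G m i) → size λ' ≤ total m
  total-bound zero    _   {[]}    kb sub = z≤n
  total-bound zero    _   {x ∷ _} ((x>0 ∷ _ , _) , _) sub =
    ⊥-elim (<⇒≱ x>0 (≤-trans (m≤n+m x _) (≤-trans (sub 0) (≤-reflexive (G-zero 0)))))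
  total-bound (suc m) m<r kb sub = ≤-trans D.size≤ (+-monoˡ-≤ _ (total-bound m (<⇒≤ m<r) D.kb D.inner⊆))
    where module D = Descent (stepDown m m<r kb sub)

  record Level (m : ℕ) (λ' : List ℕ) : Set where
    field
      kb       : KBounded k λ'
      rows     : ∀ i → part (𝔠 k λ') i ≡ G m i
      size≡    : size λ' ≡ total m

  private
    -- Equality passes to the smaller shape: `total-bound` limits the inner size from above, and one
    -- descent limits it from below.
    inner-size : ∀ m (m<r : m < r) {λ'} (D : Down m m<r λ') → size λ' ≡ total (suc m) → size
        (Descent.inner D) ≡ total m
    inner-size m m<r {λ'} D eq = ≤-antisym (total-bound m (<⇒≤ m<r) D.kb D.inner⊆)
      (+-cancelʳ-≤ (numResidues k (R m)) _ _ (≤-trans (≤-reflexive (sym eq)) D.size≤))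
      where module D = Descent D

    inner-tight : ∀ m (m<r : m < r) {λ'} (D : Down m m<r λ') → size λ' ≡ total (suc m) →
                  size λ' ≡ size (Descent.inner D) + numResidues k (R m)
    inner-tight m m<r D eq = trans eq (cong (_+ numResidues k (R m)) (sym (inner-size m m<r D eq)))

  total-tight : ∀ m → m ≤ r → ∀ {λ'} → KBounded k λ' → (∀ i → part (𝔠 k λ') i ≤ G m i) → size λ' ≡ total m →
                ∀ i → G m i ≤ part (𝔠 k λ') i
  total-tight zero    _   kb sub eq i = ≤-trans (≤-reflexive (G-zero i)) z≤n
  total-tight (suc m) m<r kb sub eq = D.tight-⊆ (inner-tight m m<r (stepDown m m<r kb sub) eq)
      (total-tight m (<⇒≤ m<r) D.kb D.inner⊆ (inner-size m m<r (stepDown m m<r kb sub) eq))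
    where module D = Descent (stepDown m m<r kb sub)

  level-down : ∀ m → m < r → ∀ {λ'} → Level (suc m) λ' →
               ∃ λ μ → Level m μ × (∀ j → part (kconj k μ) j ≤ part (kconj k λ') j)
  level-down m m<r {λ'} L = D.inner
    , record { kb = D.kb ; size≡ = eq
             ; rows = λ i → ≤-antisym (D.inner⊆ i) (total-tight m (<⇒≤ m<r) D.kb D.inner⊆ eq i) }
    , D.tight-kconj (inner-tight m m<r D₀ L.size≡)
    where
    module L = Level L
    D₀ = stepDown m m<r L.kb (λ i → ≤-reflexive (L.rows i))
    module D = Descent D₀
    eq = inner-size m m<r D₀ L.size≡

-- numResidues≤ bounds the number of residues of each strip from above, and total-bound
-- bounds their sum from below.
module AdmissibleChain {k : ℕ} (1≤k : 1 ≤ k) (r : ℕ) (Λ : ℕ → List ℕ) (α : ℕ → ℕ)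
  (Λ-zero : Λ 0 ≡ [])
  (adm : ∀ m → m < r → Admissible k (α m) (Λ (suc m)) (Λ m))
  (kb : ∀ m → m ≤ r → KBounded k (Λ m))
  (R : ℕ → ℕ → Bool)
  (hits : ∀ m → m < r → ∀ i c → part (𝔠 k (Λ m)) i < c → c ≤ part (𝔠 k (Λ (suc m))) i → T
      (R m (residue k (suc i) c)))
  (hits⁻ : ∀ m → m < r → ∀ c → T (R m c) →
           ∃ λ i → ∃ λ j → part (𝔠 k (Λ m)) i < j × j ≤ part (𝔠 k (Λ (suc m))) i × residue k (suc i) j ≡ c) where

  private
    -- Constant from r on, since nothing is known about Λ there.
    G : ℕ → ℕ → ℕ
    G m = part (𝔠 k (Λ (m ⊓ r)))

    G≡ : ∀ {m} → m ≤ r → ∀ i → G m i ≡ part (𝔠 k (Λ m)) i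
    G≡ le i = cong (λ m → part (𝔠 k (Λ m)) i) (m≤n⇒m⊓n≡m le)

    G-antitone : ∀ m → Antitone (G m)
    G-antitone m = part-antitone (𝔠-partition (kb (m ⊓ r) (m⊓n≤n m r)))

    interlaced : ∀ m → m < r → ∀ i → G (suc m) (suc i) ≤ G m i
    interlaced m m<r i = subst₂ _≤_ (sym (G≡ m<r (suc i))) (sym (G≡ (<⇒≤ m<r) i))
      (admissible⇒interlaced (adm m m<r) i)

    hitsG : ∀ m → m < r → ∀ i c → G m i < c → c ≤ G (suc m) i → T (R m (residue k (suc i) c))
    hitsG m m<r i c lo hi = hits m m<r i c (subst (_< c) (G≡ (<⇒≤ m<r) i) lo) (subst (c ≤_) (G≡ m<r i) hi)

    open StripChain 1≤k r G R G-antitone (λ i → trans (G≡ z≤n i) (cong (λ xs → part (𝔠 k xs) i) Λ-zero))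
        interlaced hitsG

    size-Λ : ∀ m → m ≤ r → size (Λ m) ≡ sumTo α m
    size-Λ zero    _   = cong size Λ-zero
    size-Λ (suc m) m<r = trans (admissible⇒size (adm m m<r)) (cong (_+ α m) (size-Λ m (<⇒≤ m<r)))

    upper : ∀ m → m < r → numResidues k (R m) ≤ α m
    upper m m<r = +-cancelʳ-≤ (size (Λ m)) _ _ (≤-trans
      (numResidues≤ (kb m (<⇒≤ m<r)) (kb (suc m) m<r) (admissible⇒data-⊆ (adm m m<r))
          (admissible⇒kconj-⊆ (adm m m<r))
        (admissible⇒interlaced (adm m m<r)) (R m)
        (λ c t → let (i , j , lo , hi , eq) = hits⁻ m m<r c t in i , stripCell j lo hi eq))
      (≤-reflexive (trans (admissible⇒size (adm m m<r)) (+-comm (size (Λ m)) (α m)))))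

  numResidues≡ : ∀ m → m < r → numResidues k (R m) ≡ α m
  numResidues≡ = sumTo-tight r upper (≤-trans (≤-reflexive (sym (size-Λ r ≤-refl)))
    (total-bound r ≤-refl (kb r ≤-refl) (λ i → ≤-reflexive (sym (G≡ ≤-refl i)))))

-- Fillings

anyB-intro : ∀ p n {i} → 1 ≤ i → i ≤ n → T (p i) → T (anyB p n)
anyB-intro p zero    (s≤s _) () t
anyB-intro p (suc n) {i} pos le t with p (suc n) in eq
... | true = _
... | false with m≤n⇒m<n∨m≡n le
...   | inj₁ (s≤s le′) = anyB-intro p n pos le′ t
...   | inj₂ refl = ⊥-elim (subst T eq t)

anyB-elim : ∀ p n → T (anyB p n) → ∃ λ i → i < n × T (p (suc i))
anyB-elim p (suc n) t with p (suc n) in eq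
... | true = n , ≤-refl , subst T (sym eq) _
... | false with anyB-elim p n t
...   | i , lt , t′ = i , m<n⇒m<1+n lt , t′

letterRow : Filling → ℕ → List ℕ
letterRow F = nth [] F

part-shape : ∀ F i → part (shape F) i ≡ length (letterRow F i)
part-shape []      i       = refl
part-shape (w ∷ F) zero    = refl
part-shape (w ∷ F) (suc i) = part-shape F i

letterResidues : ℕ → Filling → ℕ → ℕ → Bool
letterResidues k F m c = anyB (λ i → anyB (λ j → (entry F i j ≡ᵇ m) ∧ (residue k i j ≡ᵇ c))
    (row (shape F) i)) (length F)

module _ (k : ℕ) (F : Filling) (m : ℕ) where

  letterResidues-intro : ∀ i j c → j < part (shape F) i → entry F (suc i) (suc j) ≡ m → residue k (suc i)
      (suc j) ≡ c →
                         T (letterResidues k F m c)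
  letterResidues-intro i j c lt eqm eqc =
    anyB-intro _ (length F) {suc i} z<s (part>0⇒<length′ (≤-trans z<s lt))
      (anyB-intro (λ j → (entry F (suc i) j ≡ᵇ m) ∧ (residue k (suc i) j ≡ᵇ c)) (part (shape F) i) {suc j}
          z<s lt
        (∧-intro (≡⇒≡ᵇ _ m eqm) (≡⇒≡ᵇ _ c eqc)))
    where
    part>0⇒<length′ : 0 < part (shape F) i → i < length F
    part>0⇒<length′ pos = subst (i <_) (length-map length F) (part>0⇒<length (shape F) pos)

  letterResidues-elim : ∀ c → T (letterResidues k F m c) →
    ∃ λ i → ∃ λ j → j < part (shape F) i × entry F (suc i) (suc j) ≡ m × residue k (suc i) (suc j) ≡ c
  letterResidues-elim c t =
    let (i , _ , t₁) = anyB-elim _ (length F) t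
        (j , lt , t₂) = anyB-elim (λ j → (entry F (suc i) j ≡ᵇ m) ∧ (residue k (suc i) j ≡ᵇ c))
            (part (shape F) i) t₁
    in i , j , lt , ≡ᵇ⇒≡ _ m (∧-left t₂) , ≡ᵇ⇒≡ _ c (∧-right {entry F (suc i) (suc j) ≡ᵇ m} t₂)

letters≤ : ℕ → List ℕ → ℕ
letters≤ m w = length (filter (_≤? m) w)

WeaklyIncreasing : List ℕ → Set
WeaklyIncreasing w = ∀ {i j} → i ≤ j → j < length w → nth 0 w i ≤ nth 0 w j

module _ (m : ℕ) where

  letters≤-length : ∀ w → letters≤ m w ≤ length w
  letters≤-length [] = z≤n
  letters≤-length (x ∷ w) with x ≤? m
  ... | yes p rewrite filter-accept (_≤? m) {xs = w} p = s≤s (letters≤-length w)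
  ... | no ¬p rewrite filter-reject (_≤? m) {xs = w} ¬p = m≤n⇒m≤1+n (letters≤-length w)

  letters≤-none : ∀ w → (∀ j → j < length w → m < nth 0 w j) → letters≤ m w ≡ 0
  letters≤-none []      h = refl
  letters≤-none (x ∷ w) h rewrite filter-reject (_≤? m) {xs = w} (<⇒≱ (h 0 z<s)) = letters≤-none w
      (λ j lt → h (suc j) (s≤s lt))

  <letters≤ : ∀ w → WeaklyIncreasing w → ∀ {j} → j < length w → nth 0 w j ≤ m → j < letters≤ m w
  <letters≤ (x ∷ w) inc {j} lt le rewrite filter-accept (_≤? m) {xs = w} (≤-trans (inc {0} {j} z≤n lt) le)
      with j | lt
  ... | zero   | _       = z<s
  ... | suc j′ | s≤s lt′ = s≤s (<letters≤ w (λ a b → inc (s≤s a) (s≤s b)) lt′ le)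

  letters≤⇒ : ∀ w → WeaklyIncreasing w → ∀ {j} → j < letters≤ m w → nth 0 w j ≤ m
  letters≤⇒ (x ∷ w) inc {j} lt with x ≤? m
  ... | no ¬p rewrite filter-reject (_≤? m) {xs = w} ¬p
      = ⊥-elim (<⇒≱ lt (≤-trans (≤-reflexive
          (letters≤-none w (λ i lt′ → <-≤-trans (≰⇒> ¬p) (inc {0} {suc i} z≤n (s≤s lt′))))) z≤n))
  ... | yes p rewrite filter-accept (_≤? m) {xs = w} p with j | lt
  ...   | zero   | _       = p
  ...   | suc j′ | s≤s lt′ = letters≤⇒ w (λ a b → inc (s≤s a) (s≤s b)) lt′

≡-by-< : ∀ {a b} → (∀ {j} → j < a → j < b) → (∀ {j} → j < b → j < a) → a ≡ b
≡-by-< f g = ≤-antisym (≮⇒≥ λ lt → <-irrefl refl (f lt)) (≮⇒≥ λ lt → <-irrefl refl (g lt))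

-- Tableaux described by the shapes of their smaller letters

record Tableau (r : ℕ) (γ : List ℕ) (F : Filling) : Set where
  field
    partition : IsPartition γ
    shape≡    : shape F ≡ γ
    range     : ∀ i j → j < part γ i → 1 ≤ entry F (suc i) (suc j) × entry F (suc i) (suc j) ≤ r
    weak      : ∀ i j → suc j < part γ i → entry F (suc i) (suc j) ≤ entry F (suc i) (suc (suc j))
    strict    : ∀ i j → j < part γ (suc i) → entry F (suc i) (suc j) < entry F (suc (suc i)) (suc j)

  length-row : ∀ i → length (letterRow F i) ≡ part γ i
  length-row i = trans (sym (part-shape F i)) (cong (λ s → part s i) shape≡)

  level : ℕ → ℕ → ℕ
  level m i = letters≤ m (letterRow F i)

  increasing : ∀ i → WeaklyIncreasing (letterRow F i)
  increasing i {a} {b} a≤b lt with m≤n⇒m<n∨m≡n a≤b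
  ... | inj₂ refl = ≤-refl
  increasing i {a} {suc b} a≤b lt | inj₁ (s≤s a≤b′) =
    ≤-trans (increasing i {a} {b} a≤b′ (<⇒≤ lt)) (weak i b (subst (suc b <_) (length-row i) lt))

  <level⇒cell : ∀ {m i j} → j < level m i → j < part γ i
  <level⇒cell {m} {i} lt = ≤-trans lt (≤-trans (letters≤-length m (letterRow F i)) (≤-reflexive (length-row i)))

  <level⇒≤ : ∀ {m i j} → j < level m i → entry F (suc i) (suc j) ≤ m
  <level⇒≤ {m} {i} = letters≤⇒ m (letterRow F i) (increasing i)

  ≤⇒<level : ∀ {m i j} → j < part γ i → entry F (suc i) (suc j) ≤ m → j < level m i
  ≤⇒<level {m} {i} {j} lt = <letters≤ m (letterRow F i) (increasing i) (subst (j <_) (sym (length-row i)) lt)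

  -- Columns increase strictly, so below a letter at most `suc m` stands one at most `m`.
  level-interlaced : ∀ m i → level (suc m) (suc i) ≤ level m i
  level-interlaced m i = ≮⇒≥ λ lt → let cell = <level⇒cell {suc m} {suc i} lt in
    <-irrefl refl (≤⇒<level {m} {i} (≤-trans cell (part-antitone partition (n≤1+n i)))
      (≤-pred (≤-trans (strict i (level m i) cell) (<level⇒≤ {suc m} {suc i} lt))))

  level-mono : ∀ {m m′} i → m ≤ m′ → level m i ≤ level m′ i
  level-mono {m} {m′} i le = ≮⇒≥ λ lt → <-irrefl refl
    (≤⇒<level {m′} {i} (<level⇒cell {m} {i} lt) (≤-trans (<level⇒≤ {m} {i} lt) le))

  level-antitone : ∀ m → Antitone (level m)
  level-antitone m = antitone λ i → ≤-trans (level-mono (suc i) (n≤1+n m)) (level-interlaced m i)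

  level-zero : ∀ i → level 0 i ≡ 0
  level-zero i = n≤0⇒n≡0 (≮⇒≥ λ lt → <⇒≱ (proj₁ (range i 0 (<level⇒cell {0} {i} lt))) (<level⇒≤ {0} {i} lt))

  level-full : ∀ i → level r i ≡ part γ i
  level-full i = ≡-by-< (<level⇒cell {r} {i}) (λ {j} lt → ≤⇒<level {r} {i} lt (proj₂ (range i j lt)))

  private
    part-levels : ∀ m i → part (map (letters≤ m) F) i ≡ level m i
    part-levels m i = go F i
      where
      go : ∀ F i → part (map (letters≤ m) F) i ≡ letters≤ m (letterRow F i)
      go []      i       = refl
      go (w ∷ F) zero    = refl
      go (w ∷ F) (suc i) = go F i

    levels-antitone : ∀ m → Antitone (part (map (letters≤ m) F))
    levels-antitone m {i} {j} le = subst₂ _≤_ (sym (part-levels m j)) (sym (part-levels m i))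
        (level-antitone m le)

  part-shapeLE : ∀ m i → part (shapeLE F m) i ≡ level m i
  part-shapeLE m i = trans (part-nonzero (map (letters≤ m) F) (levels-antitone m) i) (part-levels m i)

  shapeLE-partition : ∀ m → IsPartition (shapeLE F m)
  shapeLE-partition m = nonzero-partition (map (letters≤ m) F) (levels-antitone m)

  letter-hits : ∀ k m i c → level m i < c → c ≤ level (suc m) i → T
      (letterResidues k F (suc m) (residue k (suc i) c))
  letter-hits k m i (suc j) lo hi = letterResidues-intro k F (suc m) i j (residue k (suc i) (suc j))
    (subst (j <_) (cong (λ s → part s i) (sym shape≡)) cell)
    (≤-antisym (<level⇒≤ {suc m} {i} hi) (≰⇒> λ le → <⇒≱ (≤⇒<level {m} {i} cell le) (≤-pred lo))) refl
    where cell = <level⇒cell {suc m} {i} hi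

  letter-hits⁻ : ∀ k m c → T (letterResidues k F (suc m) c) →
                 ∃ λ i → ∃ λ j → level m i < j × j ≤ level (suc m) i × residue k (suc i) j ≡ c
  letter-hits⁻ k m c t =
    let (i , j , lt , eqm , eqc) = letterResidues-elim k F (suc m) c t
        cell = subst (j <_) (cong (λ s → part s i) shape≡) lt
    in i , suc j , s≤s (≮⇒≥ λ lt′ → <⇒≱ (≤-reflexive (sym eqm)) (<level⇒≤ {m} {i} lt′))
         , ≤⇒<level {suc m} {i} cell (≤-reflexive eqm) , eqc

module _ {r : ℕ} {γ : List ℕ} {F F′ : Filling} (t : Tableau r γ F) (t′ : Tableau r γ F′) where
  private
    module T₁ = Tableau t
    module T₂ = Tableau t′

  -- An entry is the first level containing its cell, so each of the two entries bounds the other.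
  tableau-ext : (∀ m i → m ≤ r → T₁.level m i ≡ T₂.level m i) → F ≡ F′
  tableau-ext same = nth-ext [] F F′ lengths λ i _ → nth-ext 0 (letterRow F i) (letterRow F′ i)
      (trans (T₁.length-row i) (sym (T₂.length-row i)))
      (λ j lt → entries i j (subst (j <_) (T₁.length-row i) lt))
    where
    lengths : length F ≡ length F′
    lengths = trans (sym (length-map length F))
        (trans (cong length (trans T₁.shape≡ (sym T₂.shape≡))) (length-map length F′))
    entries : ∀ i j → j < part γ i → entry F (suc i) (suc j) ≡ entry F′ (suc i) (suc j)
    entries i j lt = ≤-antisym
      (T₁.<level⇒≤ {e₂} {i} (subst (j <_) (sym (same e₂ i (proj₂ (T₂.range i j lt))))
          (T₂.≤⇒<level {e₂} {i} lt ≤-refl)))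
      (T₂.<level⇒≤ {e₁} {i} (subst (j <_) (same e₁ i (proj₂ (T₁.range i j lt)))
          (T₁.≤⇒<level {e₁} {i} lt ≤-refl)))
      where
      e₁ = entry F (suc i) (suc j)
      e₂ = entry F′ (suc i) (suc j)

-- The two maps

lookup-toList : ∀ {A : Set} (d : A) {n} (v : Vec A n) (j : Fin n) → lookup v j ≡ nth d (toList v) (toℕ j)
lookup-toList d (x ∷ v) Fin.zero    = refl
lookup-toList d (x ∷ v) (Fin.suc j) = lookup-toList d v j

last≡lookup : ∀ {A : Set} {n} (v : Vec A (suc n)) → last v ≡ lookup v (fromℕ n)
last≡lookup {n = zero}  (x ∷ [])    = refl
last≡lookup {n = suc n} (x ∷ y ∷ v) = last≡lookup (y ∷ v)

head≡lookup : ∀ {A : Set} {n} (v : Vec A (suc n)) → head v ≡ lookup v Fin.zero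
head≡lookup (x ∷ v) = refl

sumTo-toList : ∀ {r} (α : Vec ℕ r) → sumTo (nth 0 (toList α)) r ≡ sum (toList α)
sumTo-toList []      = refl
sumTo-toList {suc r} (x ∷ α) = trans (sumTo-suc (nth 0 (x ∷ toList α)) r) (cong (x +_) (sumTo-toList α))

∀-fromFin : ∀ {r} {P : ℕ → Set} → (∀ (j : Fin r) → P (toℕ j)) → ∀ m → m < r → P m
∀-fromFin {P = P} h m lt = subst P (toℕ-fromℕ< lt) (h (fromℕ< lt))

module _ {k r : ℕ} {α : Vec ℕ r} {λ' : List ℕ} (kb : KBounded k λ') {F : Filling} where
  private
    γ = 𝔠 k λ'

  InT⇒Tableau : InT k α λ' F → Tableau r γ F
  InT⇒Tableau (sh , rng , wk , st , _) = record
    { partition = 𝔠-partition kb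
    ; shape≡    = sh
    ; range     = λ i j lt → rng (suc i) (suc j) (z<s , z<s , cell i lt)
    ; weak      = λ i j lt → wk (suc i) (suc j) (z<s , z<s , cell i lt)
    ; strict    = λ i j lt → st (suc i) (suc j) (z<s , z<s , cell (suc i) lt) }
    where
    cell : ∀ i {j} → j < part γ i → j < part (shape F) i
    cell i = subst (λ s → _ < part s i) (sym sh)

  Tableau⇒InT : Tableau r γ F → (∀ m → m < r → distinctRes k F (suc m) ≡ nth 0 (toList α) m) → InT k α λ' F
  Tableau⇒InT t res = T.shape≡ , rng , wk , st , λ m → trans (res (toℕ m) (toℕ<n m)) (sym (lookup-toList 0 α m))
    where
    module T = Tableau t
    cell : ∀ i {j} → j < part (shape F) i → j < part γ i
    cell i = subst (λ s → _ < part s i) T.shape≡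
    rng : ∀ i j → IsCell (shape F) i j → (1 ≤ entry F i j) × (entry F i j ≤ r)
    rng (suc i) (suc j) (_ , _ , lt) = T.range i j (cell i lt)
    wk : ∀ i j → IsCell (shape F) i (suc j) → entry F i j ≤ entry F i (suc j)
    wk (suc i) zero    _            = z≤n
    wk (suc i) (suc j) (_ , _ , lt) = T.weak i j (cell i lt)
    st : ∀ i j → IsCell (shape F) (suc i) j → entry F i j < entry F (suc i) j
    -- `entry` is 0 in the fictitious row 0, so strictness there says that the letters of the first
    -- row are positive.
    st zero    (suc j) (_ , _ , lt) = proj₁ (T.range 0 j (cell 0 lt))
    st (suc i) (suc j) (_ , _ , lt) = T.strict i j (cell (suc i) lt)

module FromTableau {k : ℕ} (1≤k : 1 ≤ k) {λ' : List ℕ} (kb : KBounded k λ') {r : ℕ} (α : Vec ℕ r)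
  (comp : sum (toList α) ≡ size λ') {F : Filling} (inT : InT k α λ' F) where

  tableau : Tableau r (𝔠 k λ') F
  tableau = InT⇒Tableau {α = α} kb inT

  private
    module T = Tableau tableau
    R : ℕ → ℕ → Bool
    R m = letterResidues k F (suc m)
    open StripChain 1≤k r T.level R T.level-antitone T.level-zero (λ m _ → T.level-interlaced m)
        (λ m _ → T.letter-hits k m)

    res : ∀ m → m < r → numResidues k (R m) ≡ nth 0 (toList α) m
    res = ∀-fromFin λ j → trans (proj₂ (proj₂ (proj₂ (proj₂ inT))) j) (lookup-toList 0 α j)

    Λ : ℕ → List ℕ
    Λ m = 𝔭 k (shapeLE F m)

    -- At this point the shape of the letters up to `m` is recognized as a core.
    shape-level : ∀ {m μ} → Level m μ → shapeLE F m ≡ 𝔠 k μ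
    shape-level {m} L = partition-ext (T.shapeLE-partition m) (𝔠-partition (Level.kb L))
      (λ i → trans (T.part-shapeLE m i) (sym (Level.rows L i)))

    Λ-level : ∀ {m μ} → Level m μ → Λ m ≡ μ
    Λ-level L = trans (cong (𝔭 k) (shape-level L)) (𝔭𝔠 (Level.kb L))

    -- The evaluation sums to |λ|, so the bound of `total-bound` is attained; all lower levels
    -- follow from this one.
    top : Level r λ'
    top = record { kb = kb ; rows = λ i → sym (T.level-full i)
                 ; size≡ = sym (trans (sumTo-cong r res) (trans (sumTo-toList α) comp)) }

    levels : ∀ d m → m + d ≡ r → ∃ (Level m)
    levels zero m eq = λ' , subst (λ m → Level m λ') (trans (sym eq) (+-identityʳ m)) top
    levels (suc d) m eq =
      let (_ , L) = levels d (suc m) (trans (sym (+-suc m d)) eq)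
          (μ , L′ , _) = level-down m (≤-trans (s≤s (m≤m+n m d)) (≤-reflexive (trans (sym (+-suc m d)) eq))) L
      in μ , L′

    level : ∀ m → m ≤ r → Level m (Λ m)
    level m le = let (_ , L) = levels (r ∸ m) m (m+[n∸m]≡n le) in subst (Level m) (sym (Λ-level L)) L

    Λ-admissible : ∀ m → m < r → Admissible k (nth 0 (toList α) m) (Λ (suc m)) (Λ m)
    Λ-admissible m m<r =
      let L = level (suc m) m<r
          (μ , L′ , ω⊆) = level-down m m<r L
          L₀ = level m (<⇒≤ m<r)
      in admissible (Level.kb L₀) (Level.kb L)
           (λ i → subst₂ _≤_ (sym (Level.rows L₀ i)) (sym (Level.rows L i)) (T.level-mono i (n≤1+n m)))
           (λ i → subst₂ _≤_ (sym (Level.rows L (suc i))) (sym (Level.rows L₀ i)) (T.level-interlaced m i))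
           (subst (λ ν → ∀ j → part (kconj k ν) j ≤ part (kconj k (Λ (suc m))) j) (sym (Λ-level L′)) ω⊆)
           (trans (Level.size≡ L) (cong₂ _+_ (sym (Level.size≡ L₀)) (res m m<r)))

  Λ-core : ∀ m → m ≤ r → ∀ i → part (𝔠 k (Λ m)) i ≡ T.level m i
  Λ-core m le = Level.rows (level m le)

  lookup-Γ̄ : ∀ (j : Fin (suc r)) → lookup (Γ̄ k α F) j ≡ 𝔭 k (shapeLE F (toℕ j))
  lookup-Γ̄ = lookup∘tabulate (λ (m : Fin (suc r)) → 𝔭 k (shapeLE F (toℕ m)))

  nth-Γ̄ : ∀ m → m ≤ r → nth [] (toList (Γ̄ k α F)) m ≡ 𝔭 k (shapeLE F m)
  nth-Γ̄ m le = ∀-fromFin {P = λ m → nth [] (toList (Γ̄ k α F)) m ≡ 𝔭 k (shapeLE F m)}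
    (λ j → trans (sym (lookup-toList [] (Γ̄ k α F) j)) (lookup-Γ̄ j)) m (s≤s le)

  chain : InD k α λ' (Γ̄ k α F)
  chain = cong (𝔭 k) empty
        , trans (last≡lookup (Γ̄ k α F))
            (trans (lookup-Γ̄ (fromℕ r)) (trans (cong Λ (toℕ-fromℕ r)) (Λ-level top)))
        , (λ j → subst (KBounded k) (sym (lookup-Γ̄ j)) (Level.kb (level (toℕ j) (≤-pred (toℕ<n j)))))
        , λ j → subst₂ (Admissible k (lookup α j)) (sym (lookup-Γ̄ (Fin.suc j)))
            (sym (trans (lookup-Γ̄ (inject₁ j)) (cong Λ (toℕ-inject₁ j))))
            (subst (λ a → Admissible k a (Λ (suc (toℕ j))) (Λ (toℕ j))) (sym (lookup-toList 0 α j))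
              (Λ-admissible (toℕ j) (toℕ<n j)))
    where
    empty : shapeLE F 0 ≡ []
    empty = partition-ext (T.shapeLE-partition 0) ([] , Linked.[])
        (λ i → trans (T.part-shapeLE 0 i) (T.level-zero i))

module FromChain {k : ℕ} (1≤k : 1 ≤ k) {λ' : List ℕ} (kb : KBounded k λ') {r : ℕ} (α : Vec ℕ r)
  (P : Vec (List ℕ) (suc r)) (inD : InD k α λ' P) where

  Λ : ℕ → List ℕ
  Λ = nth [] (toList P)

  private
    γ = 𝔠 k λ'
    pγ = 𝔠-partition kb

    a : ℕ → ℕ
    a = nth 0 (toList α)

    Λ-zero : Λ 0 ≡ []
    Λ-zero = trans (sym (trans (head≡lookup P) (lookup-toList [] P Fin.zero))) (proj₁ inD)

    Λ-last : Λ r ≡ λ'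
    Λ-last = trans (cong Λ (sym (toℕ-fromℕ r))) (trans (sym (lookup-toList [] P (fromℕ r)))
               (trans (sym (last≡lookup P)) (proj₁ (proj₂ inD))))

    Λ-kb : ∀ m → m ≤ r → KBounded k (Λ m)
    Λ-kb m le = ∀-fromFin {P = λ m → KBounded k (Λ m)}
      (λ j → subst (KBounded k) (lookup-toList [] P j) (proj₁ (proj₂ (proj₂ inD)) j)) m (s≤s le)

    adm : ∀ m → m < r → Admissible k (a m) (Λ (suc m)) (Λ m)
    adm = ∀-fromFin {P = λ m → Admissible k (a m) (Λ (suc m)) (Λ m)} λ j →
      subst₂ (Admissible k (a (toℕ j))) (lookup-toList [] P (Fin.suc j))
        (trans (lookup-toList [] P (inject₁ j)) (cong Λ (toℕ-inject₁ j)))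
        (subst (λ x → Admissible k x (lookup P (Fin.suc j)) (lookup P (inject₁ j))) (lookup-toList 0 α j)
          (proj₂ (proj₂ (proj₂ inD)) j))

  G : ℕ → ℕ → ℕ
  G m = part (𝔠 k (Λ m))

  private
    G-zero : ∀ i → G 0 i ≡ 0
    G-zero i = cong (λ xs → part (𝔠 k xs) i) Λ-zero

    G-last : ∀ i → G r i ≡ part γ i
    G-last i = cong (λ xs → part (𝔠 k xs) i) Λ-last

    G-mono : ∀ {m m′} i → m ≤ m′ → m′ ≤ r → G m i ≤ G m′ i
    G-mono {m} {m′} i le le′ with m≤n⇒m<n∨m≡n le
    ... | inj₂ refl = ≤-refl
    G-mono {m} {suc m′} i le le′ | inj₁ (s≤s lt) = ≤-trans (G-mono i lt (<⇒≤ le′)) (admissible⇒⊆ (adm m′ le′) i)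

    search : ℕ → ℕ → ℕ → ℕ → ℕ
    search i j = letterSearch k (toList P) (suc i) (suc j)

    -- The fuel lasts exactly until letter `r`. Running out of it would mean that the cell is
    -- missing from `G r`, the whole core.
    search-spec : ∀ {i j} → j < G r i → ∀ f m → m + f ≡ suc r → (∀ m′ → m′ < m → ¬ j < G m′ i) →
                  let e = search i j f m in e ≤ r × j < G e i × (∀ m′ → m′ < e → ¬ j < G m′ i)
    search-spec {i} {j} cell zero m eq none = ⊥-elim
        (none r (≤-reflexive (sym (trans (sym (+-identityʳ m)) eq))) cell)
    search-spec {i} {j} cell (suc f) m eq none with suc j ≤ᵇ part (𝔠 k (Λ m)) i in eqb
    ... | true = ≤-pred (≤-trans (s≤s (m≤m+n m f)) (≤-reflexive (trans (sym (+-suc m f)) eq)))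
               , ≤ᵇ⇒≤ (suc j) _ (subst T (sym eqb) _) , none
    ... | false = search-spec cell f (suc m) (trans (sym (+-suc m f)) eq) λ m′ lt → none′ m′
        (m≤n⇒m<n∨m≡n (≤-pred lt))
      where
      none′ : ∀ m′ → m′ < m ⊎ m′ ≡ m → ¬ j < G m′ i
      none′ m′ (inj₁ lt)   = none m′ lt
      none′ m′ (inj₂ refl) = λ lt → subst T eqb (≤⇒≤ᵇ lt)

    F : Filling
    F = Γ k α λ' P

    row-Γ : ∀ i → letterRow F i ≡ map (λ j → letterSearch k (toList P) (suc i) j r 1) (oneTo (part γ i))
    row-Γ i with i <? length γ
    ... | yes lt = nth-map-oneTo [] (λ i → map (λ j → letterSearch k (toList P) i j r 1) (oneTo (row γ i)))
        (length γ) lt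
    ... | no  ge = trans (nth-≥length [] F
        (≤-trans (≤-reflexive (length-map-oneTo
            (λ i → map (λ j → letterSearch k (toList P) i j r 1) (oneTo (row γ i))) (length γ))) (≮⇒≥ ge)))
                     (sym (cong (λ x → map (λ j → letterSearch k (toList P) (suc i) j r 1) (oneTo x))
                         (nth-≥length 0 γ (≮⇒≥ ge))))

    shape-Γ : shape F ≡ γ
    shape-Γ = nth-ext 0 (shape F) γ
      (trans (length-map length F) (length-map-oneTo
          (λ i → map (λ j → letterSearch k (toList P) i j r 1) (oneTo (row γ i))) (length γ)))
      (λ i _ → trans (part-shape F i)
          (trans (cong length (row-Γ i)) (length-map-oneTo (λ j → letterSearch k (toList P) (suc i) j r 1)
              (part γ i))))

    entry-Γ : ∀ i j → j < part γ i → entry F (suc i) (suc j) ≡ search i j r 1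
    entry-Γ i j lt = trans (cong (λ w → nth 0 w j) (row-Γ i))
        (nth-map-oneTo 0 (λ j → letterSearch k (toList P) (suc i) j r 1) (part γ i) lt)

    entry-spec : ∀ i j → j < part γ i → let e = entry F (suc i) (suc j) in
                 e ≤ r × j < G e i × (∀ m → m < e → ¬ j < G m i)
    entry-spec i j lt = subst (λ e → e ≤ r × j < G e i × (∀ m → m < e → ¬ j < G m i)) (sym (entry-Γ i j lt))
      (search-spec (subst (j <_) (sym (G-last i)) lt) r 1 refl
        λ { zero _ cell → <⇒≱ cell (≤-trans (≤-reflexive (G-zero i)) z≤n) ; (suc _) (s≤s ()) })

    entry≤ : ∀ i j m → m ≤ r → j < G m i → entry F (suc i) (suc j) ≤ m
    entry≤ i j m le cell = ≮⇒≥ λ lt → proj₂ (proj₂ (entry-spec i j cell′)) m lt cell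
      where cell′ = ≤-trans cell (≤-trans (G-mono i le ≤-refl) (≤-reflexive (G-last i)))

  tableau : Tableau r γ F
  tableau = record
    { partition = pγ
    ; shape≡    = shape-Γ
    ; range     = λ i j lt → range i j (entry-spec i j lt) , proj₁ (entry-spec i j lt)
    ; weak      = λ i j lt → let (e≤r , cell , _) = entry-spec i (suc j) lt in
                    entry≤ i j (entry F (suc i) (suc (suc j))) e≤r (<⇒≤ cell)
    ; strict    = λ i j lt → let (e≤r , cell , _) = entry-spec (suc i) j lt in
                    strict i j (entry F (suc (suc i)) (suc j)) e≤r cell }
    where
    range : ∀ i j → _ → 1 ≤ entry F (suc i) (suc j)
    range i j (_ , cell , _) = n≢0⇒n>0 λ eq → <⇒≱ (subst (λ e → j < G e i) eq cell)
        (≤-trans (≤-reflexive (G-zero i)) z≤n)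
    strict : ∀ i j e → e ≤ r → j < G e (suc i) → entry F (suc i) (suc j) < e
    strict i j zero    le cell = ⊥-elim (<⇒≱ cell (≤-trans (≤-reflexive (G-zero (suc i))) z≤n))
    strict i j (suc e) le cell = s≤s (entry≤ i j e (<⇒≤ le) (≤-trans cell (admissible⇒interlaced (adm e le) i)))

  private
    module T = Tableau tableau

  level≡G : ∀ m i → m ≤ r → T.level m i ≡ G m i
  level≡G m i le = ≡-by-<
    (λ {j} lt → let (_ , cell , _) = entry-spec i j (T.<level⇒cell {m} {i} lt) in
       ≤-trans cell (G-mono i (T.<level⇒≤ {m} {i} lt) le))
    (λ {j} lt → T.≤⇒<level {m} {i} (≤-trans lt (≤-trans (G-mono i le ≤-refl) (≤-reflexive (G-last i)))) (entry≤ i j m le lt))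

  inT : InT k α λ' F
  inT = Tableau⇒InT {α = α} kb tableau A.numResidues≡
    where
    R : ℕ → ℕ → Bool
    R m = letterResidues k F (suc m)
    hits : ∀ m → m < r → ∀ i c → G m i < c → c ≤ G (suc m) i → T (R m (residue k (suc i) c))
    hits m m<r i c lo hi = T.letter-hits k m i c
      (subst (_< c) (sym (level≡G m i (<⇒≤ m<r))) lo) (subst (c ≤_) (sym (level≡G (suc m) i m<r)) hi)
    hits⁻ : ∀ m → m < r → ∀ c → T (R m c) → ∃ λ i → ∃ λ j → G m i < j × j ≤ G (suc m) i × residue k (suc i)
        j ≡ c
    hits⁻ m m<r c t = let (i , j , lo , hi , eq) = T.letter-hits⁻ k m c t in
      i , j , subst (_< j) (level≡G m i (<⇒≤ m<r)) lo , subst (j ≤_) (level≡G (suc m) i m<r) hi , eq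
    module A = AdmissibleChain 1≤k r Λ a Λ-zero adm Λ-kb R hits hits⁻

  𝔭-shapeLE : ∀ m → m ≤ r → 𝔭 k (shapeLE F m) ≡ Λ m
  𝔭-shapeLE m le = trans (cong (𝔭 k) (partition-ext (T.shapeLE-partition m) (𝔠-partition (Λ-kb m le))
      (λ i → trans (T.part-shapeLE m i) (level≡G m i le)))) (𝔭𝔠 (Λ-kb m le))

  Γ̄Γ : Γ̄ k α F ≡ P
  Γ̄Γ = trans (tabulate-cong λ j → trans (𝔭-shapeLE (toℕ j) (≤-pred (toℕ<n j))) (sym (lookup-toList [] P j)))
             (tabulate∘lookup P)

theorem71 : (k : ℕ) → 1 ≤ k → (λ' : List ℕ) → KBounded k λ' →
    {r : ℕ} (α : Vec ℕ r) → IsComposition α (size λ') →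
    ((P : Vec (List ℕ) (suc r)) → InD k α λ' P → InT k α λ' (Γ k α λ' P))
    × ((T : Filling) → InT k α λ' T → InD k α λ' (Γ̄ k α T))
    × ((P : Vec (List ℕ) (suc r)) → InD k α λ' P → Γ̄ k α (Γ k α λ' P) ≡ P)
    × ((T : Filling) → InT k α λ' T → Γ k α λ' (Γ̄ k α T) ≡ T)
theorem71 k 1≤k λ' kb {r} α (_ , comp) =
    (λ P inD → FromChain.inT 1≤k kb α P inD)
  , (λ F inT → FromTableau.chain 1≤k kb α comp inT)
  , (λ P inD → FromChain.Γ̄Γ 1≤k kb α P inD)
  , ΓΓ̄
  where
  -- Both tableaux have the cores of the same chain as shapes of their smaller letters, and these
  -- shapes determine a tableau.
  ΓΓ̄ : (F : Filling) → InT k α λ' F → Γ k α λ' (Γ̄ k α F) ≡ F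
  ΓΓ̄ F inT = tableau-ext D.tableau T.tableau λ m i le →
      trans (D.level≡G m i le) (trans (cong (λ xs → part (𝔠 k xs) i) (T.nth-Γ̄ m le)) (T.Λ-core m le i))
    where
    module T = FromTableau 1≤k kb α comp inT
    module D = FromChain 1≤k kb α (Γ̄ k α F) T.chain
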